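{- For all $n \geq 0$, $$p_{\xi}(24n+19) \equiv 0 \pmod{3},\qquad p_{\xi}(27n+18) \equiv 0 \pmod{3},\qquad p_{\xi}(72n+51) \equiv 0 \pmod{3}.$$
   Context: $(a;q)_n=(1-a)(1-aq)\cdots(1-aq^{n-1})$, $(a;q)_0=1$. The coefficients $p_\xi(n)$ are defined by $\sum_{n\ge0}p_\xi(n)q^n=\xi(q)=1+2\sum_{n\ge1}\frac{q^{6n^2-6n+1}}{(q;q^6)_n(q^5;q^6)_n}$. -}

module Defs where

open import Data.Nat using (ℕ; zero; suc; _+_; _*_; _∸_; _≤ᵇ_)
open import Data.Bool using (if_then_else_)

Series : Set
Series = ℕ → ℕ

mono : ℕ → Series
mono e m = if e ≤ᵇ m then (if m ≤ᵇ e then 1 else 0) else 0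

geomSum : ℕ → Series → ℕ → ℕ → ℕ
geomSum k f m zero = f m
geomSum k f m (suc t) =
  (if suc t * suc k ≤ᵇ m then f (m ∸ suc t * suc k) else 0) + geomSum k f m t

-- f(q) / (1 - q^(k+1)) ; coefficient of q^m is sum_{j ≥ 0, j(k+1) ≤ m} f(m - j(k+1))
divGeom : ℕ → Series → Series
divGeom k f m = geomSum k f m m

-- f(q) / ((q;q^6)_n (q^5;q^6)_n) = f / prod_{i<n} (1 - q^(6i+1)) (1 - q^(6i+5))
divPoch : ℕ → Series → Series
divPoch zero f = f
divPoch (suc i) f = divGeom (6 * i) (divGeom (6 * i + 4) (divPoch i f))

-- the summand q^(6n^2-6n+1) / ((q;q^6)_n (q^5;q^6)_n), for n ≥ 1 (written n = suc k)
summand : ℕ → Series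
summand k = divPoch (suc k) (mono (6 * (suc k * suc k) ∸ 6 * suc k + 1))

partialSum : ℕ → Series
partialSum zero m = summand zero m
partialSum (suc t) m = summand (suc t) m + partialSum t m

-- p_ξ(m): coefficient of q^m in ξ(q) = 1 + 2 Σ_{n≥1} q^(6n²-6n+1)/((q;q^6)_n (q^5;q^6)_n).
-- Summands with n ≥ m+1 have exponent 6n²-6n+1 > m, so they contribute nothing;
-- the sum over n = 1 .. m+1 (k = 0 .. m) is exact.
pξ : ℕ → ℕ
pξ m = mono 0 m + 2 * partialSum m m

{-# OPTIONS --safe #-}
module Submission where

-- Modulo 3 everything reduces to the overpartition series 1 / φ(-q), where φ(-q) = Σ (-1)ᵏ q^(k²).
--
-- Bailey's lemma, applied to the partial fraction expansion of 1 / ∏ (1 - q^(6i+1)) (1 - q^(6i+5)),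
-- gives (q⁶;q⁶)∞ ξ(q) = Σ_{m ≢ 1 mod 3} L_m with L_m = (-1)ᵐ q^(m²+m) (1 + q^(2m+1)) / (1 - q^(2m+1)),
-- while the expansion of 1 / (q;q²)∞² gives (q²;q²)∞² / (q;q²)∞² = Σ_m L_m. Over F₃ the terms with
-- m ≡ 1 mod 3 only have exponents ≡ 2 mod 3 and (q⁶;q⁶)∞ = (q²;q²)∞³, so by Gauss' product
-- φ(-q) = (q;q²)∞² (q²;q²)∞ the series ξ(q) and 1 / φ(-q) agree at all exponents ≢ 2 mod 3.
--
-- Put V = φ(-q), B = V³ = V(q³), C = V⁹ = V(q⁹) and W = V - C, which lives in the class 1 mod 3.
-- From 1/V = V² / V³ = B⁻¹ (C + W)² the part of 1/V in class 0 mod 3 is B² C and that in class 1 is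
-- 2 B² W. Let A₀, A₁ be the even and odd parts of V; they live in the classes 0 mod 4 and 1 mod 8,
-- and A₀⁴ + A₁⁴ = 1 over F₃ because V(q)⁴ + V(-q)⁴ is invariant under q ↦ q². Splitting B, C and W
-- in the same way, the class 3 mod 8 of B² W vanishes and that of B² C is that of 2 B; the
-- remaining cases follow from the supports of C and W modulo 9 and 27.

open import Defs
open import Algebra.Bundles using (CommutativeRing)
open import Algebra.Structures using (IsCommutativeRing)
open import Data.Fin using (Fin; zero; suc; toℕ)
open import Data.Fin.Properties using (all?; _≟_; toℕ-injective; toℕ-fromℕ<)
open import Data.Maybe using (Maybe; just; nothing)
open import Data.Nat as ℕ using (ℕ; zero; suc)
open import Data.Nat.Divisibility using (_∣_; divides; m%n≡0⇒n∣m)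
open import Data.Nat.DivMod
open import Data.Nat.Induction using (<-wellFounded; Acc; acc)
import Data.Nat.Properties as ℕₚ
open import Data.Nat.Tactic.RingSolver using (solve-∀)
open import Data.Product using (_×_; _,_)
open import Data.Sum using (inj₁; inj₂)
open import Data.Bool using (false; if_then_else_)
open import Data.Unit using (⊤; tt)
open import Level using (0ℓ)
open import Relation.Binary.PropositionalEquality as ≡ using (_≡_; cong; cong₂)
open import Relation.Nullary using (¬_; yes; no; contradiction)
open import Relation.Nullary.Decidable using (from-yes)

-- Infinite products are never formed. Each product identity is proved modulo q^(N+1) for every N,
-- in an abstract ring of characteristic 3 where high powers of q vanish; `PS.ring (upTo N)`
-- supplies such rings on the single set of coefficient sequences by weakening only the equality.
-- Bailey's lemma is stated for powers of an abstract `P` because it is run once with q⁶ and its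
-- partial fractions once more with q². The factor 2 in ξ and in theta is -1 throughout, and 1/2 is
-- -1 as well. The moduli come from the supports. A₁ lies in 1 mod 8, so A₁³ lies in 3 mod 8, and
-- 24n + 19 and 72n + 51 are both 3 mod 8. The obstacle is that A₀ is confined only modulo 4, so the
-- mixed term of (A₀³ + A₁³)² times an even part cannot be placed modulo 8; the relation A₀⁴ + A₁⁴ =
-- 1 trades it for terms that can. Further, V³ = C³ + W³ has exponents 0 or 3 mod 9 only, which
-- excludes 51 mod 72, while 18 mod 27 needs the expansion of C = V⁹ as well. No progression meets 2
-- mod 3, the one class where ξ and 1 / φ(-q) may differ.

F₃ : Set
F₃ = Fin 3

-- The field with three elements.

module F₃ where
  infixl 6 _+_
  infixl 7 _*_
  _+_ _*_ : F₃ → F₃ → F₃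
  x + y = (toℕ x ℕ.+ toℕ y) mod 3
  x * y = (toℕ x ℕ.* toℕ y) mod 3

  -_ : F₃ → F₃
  - x = (2 ℕ.* toℕ x) mod 3

  0# 1# : F₃
  0# = zero
  1# = suc zero

  +-assoc : ∀ x y z → (x + y) + z ≡ x + (y + z)
  +-assoc = from-yes (all? λ x → all? λ y → all? λ z → ((x + y) + z) ≟ (x + (y + z)))

  *-assoc : ∀ x y z → (x * y) * z ≡ x * (y * z)
  *-assoc = from-yes (all? λ x → all? λ y → all? λ z → ((x * y) * z) ≟ (x * (y * z)))

  *-distribˡ-+ : ∀ x y z → x * (y + z) ≡ x * y + x * z
  *-distribˡ-+ = from-yes (all? λ x → all? λ y → all? λ z → (x * (y + z)) ≟ (x * y + x * z))

  *-distribʳ-+ : ∀ x y z → (y + z) * x ≡ y * x + z * x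
  *-distribʳ-+ = from-yes (all? λ x → all? λ y → all? λ z → ((y + z) * x) ≟ (y * x + z * x))

  +-comm : ∀ x y → x + y ≡ y + x
  +-comm = from-yes (all? λ x → all? λ y → (x + y) ≟ (y + x))

  *-comm : ∀ x y → x * y ≡ y * x
  *-comm = from-yes (all? λ x → all? λ y → (x * y) ≟ (y * x))

  +-identityˡ : ∀ x → 0# + x ≡ x
  +-identityˡ = from-yes (all? λ x → (0# + x) ≟ x)

  +-identityʳ : ∀ x → x + 0# ≡ x
  +-identityʳ = from-yes (all? λ x → (x + 0#) ≟ x)

  *-identityˡ : ∀ x → 1# * x ≡ x
  *-identityˡ = from-yes (all? λ x → (1# * x) ≟ x)

  *-identityʳ : ∀ x → x * 1# ≡ x
  *-identityʳ = from-yes (all? λ x → (x * 1#) ≟ x)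

  -‿inverseˡ : ∀ x → - x + x ≡ 0#
  -‿inverseˡ = from-yes (all? λ x → (- x + x) ≟ 0#)

  -‿inverseʳ : ∀ x → x + - x ≡ 0#
  -‿inverseʳ = from-yes (all? λ x → (x + - x) ≟ 0#)

  isCommutativeRing : IsCommutativeRing _≡_ _+_ _*_ -_ 0# 1#
  isCommutativeRing = record
    { isRing = record
      { +-isAbelianGroup = record
        { isGroup = record
          { isMonoid = record
            { isSemigroup = record
              { isMagma = ≡.isMagma _+_ ; assoc = +-assoc }
            ; identity = +-identityˡ , +-identityʳ
            }
          ; inverse = -‿inverseˡ , -‿inverseʳ
          ; ⁻¹-cong = cong -_
          }
        ; comm = +-comm
        }
      ; *-cong = cong₂ _*_
      ; *-assoc = *-assoc
      ; *-identity = *-identityˡ , *-identityʳ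
      ; distrib = *-distribˡ-+ , *-distribʳ-+
      }
    ; *-comm = *-comm
    }

  ring : CommutativeRing 0ℓ 0ℓ
  ring = record { isCommutativeRing = isCommutativeRing }

-- Sums over k + r = n in a commutative ring.

module Convolution (R : CommutativeRing 0ℓ 0ℓ) where
  open CommutativeRing R
  open import Relation.Binary.Reasoning.Setoid setoid
  open import Algebra.Properties.CommutativeSemigroup +-commutativeSemigroup using (interchange)
  open import Algebra.Properties.Ring ring using (-‿+-comm)

  -- The two-index form covers Cauchy products, Bailey sums and, when `h` ignores its first
  -- argument, plain sums over r ≤ n, which is how truncated series are written below.
  conv : ℕ → (ℕ → ℕ → Carrier) → Carrier
  conv zero    h = h 0 0
  conv (suc n) h = h 0 (suc n) + conv n (λ k r → h (suc k) r)

  conv-cong : ∀ n {g h} → (∀ k r → k ℕ.+ r ≡ n → g k r ≈ h k r) → conv n g ≈ conv n h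
  conv-cong zero    e = e 0 0 ≡.refl
  conv-cong (suc n) e =
    +-cong (e 0 (suc n) ≡.refl) (conv-cong n λ k r p → e (suc k) r (cong suc p))

  conv-last : ∀ n h → conv (suc n) h ≈ conv n (λ k r → h k (suc r)) + h (suc n) 0
  conv-last zero    h = refl
  conv-last (suc n) h = begin
    h 0 (suc (suc n)) + conv (suc n) (λ k r → h (suc k) r)
      ≈⟨ +-congˡ (conv-last n (λ k r → h (suc k) r)) ⟩
    h 0 (suc (suc n)) + (conv n (λ k r → h (suc k) (suc r)) + h (suc (suc n)) 0)
      ≈⟨ +-assoc _ _ _ ⟨
    conv (suc n) (λ k r → h k (suc r)) + h (suc (suc n)) 0 ∎

  conv-+ : ∀ n g h → conv n (λ k r → g k r + h k r) ≈ conv n g + conv n h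
  conv-+ zero    g h = refl
  conv-+ (suc n) g h = trans (+-congˡ (conv-+ n _ _)) (interchange _ _ _ _)

  conv-*ˡ : ∀ c n h → conv n (λ k r → c * h k r) ≈ c * conv n h
  conv-*ˡ c zero    h = refl
  conv-*ˡ c (suc n) h = trans (+-congˡ (conv-*ˡ c n _)) (sym (distribˡ c _ _))

  conv-*ʳ : ∀ c n h → conv n (λ k r → h k r * c) ≈ conv n h * c
  conv-*ʳ c zero    h = refl
  conv-*ʳ c (suc n) h = trans (+-congˡ (conv-*ʳ c n _)) (sym (distribʳ c _ _))

  conv-0 : ∀ n {h} → (∀ k r → k ℕ.+ r ≡ n → h k r ≈ 0#) → conv n h ≈ 0#
  conv-0 zero    e = e 0 0 ≡.refl
  conv-0 (suc n) e = trans
    (+-cong (e 0 (suc n) ≡.refl) (conv-0 n λ k r p → e (suc k) r (cong suc p)))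
    (+-identityˡ _)

  conv-- : ∀ n h → conv n (λ k r → - h k r) ≈ - conv n h
  conv-- zero    h = refl
  conv-- (suc n) h = trans (+-congˡ (conv-- n _)) (-‿+-comm _ _)

  conv-comm : ∀ n h → conv n h ≈ conv n (λ k r → h r k)
  conv-comm zero    h = refl
  conv-comm (suc n) h = begin
    h 0 (suc n) + conv n (λ k r → h (suc k) r)  ≈⟨ +-comm _ _ ⟩
    conv n (λ k r → h (suc k) r) + h 0 (suc n)  ≈⟨ +-congʳ (conv-comm n _) ⟩
    conv n (λ k r → h (suc r) k) + h 0 (suc n)  ≈⟨ conv-last n (λ k r → h r k) ⟨
    conv (suc n) (λ k r → h r k)                ∎

  conv-assoc : ∀ n (h : ℕ → ℕ → ℕ → Carrier) →
    conv n (λ s j → conv s (λ k i → h k i j)) ≈ conv n (λ k s → conv s (λ i j → h k i j))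
  conv-assoc zero    h = refl
  conv-assoc (suc n) h = begin
    h 0 0 (suc n) + conv n (λ s j → h 0 (suc s) j + conv s (λ k i → h (suc k) i j))
      ≈⟨ +-congˡ (conv-+ n _ _) ⟩
    h 0 0 (suc n) + (conv n (λ s j → h 0 (suc s) j) + conv n (λ s j → conv s (λ k i → h (suc k) i j)))
      ≈⟨ +-assoc _ _ _ ⟨
    conv (suc n) (λ i j → h 0 i j) + conv n (λ s j → conv s (λ k i → h (suc k) i j))
      ≈⟨ +-congˡ (conv-assoc n (λ k → h (suc k))) ⟩
    conv (suc n) (λ i j → h 0 i j) + conv n (λ k s → conv s (λ i j → h (suc k) i j)) ∎

-- Abstract powers of q in characteristic 3.

Char3 : CommutativeRing 0ℓ 0ℓ → Set
Char3 R = 1# + (1# + 1#) ≈ 0#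
  where open CommutativeRing R

module _ (R : CommutativeRing 0ℓ 0ℓ) where
  open CommutativeRing R

  Sequence : Set
  Sequence = ℕ → Carrier

  -- A sequence with these two properties is n ↦ qⁿ for some q.
  UnitAt0 Multiplicative : Sequence → Set
  UnitAt0 P        = P 0 ≈ 1#
  Multiplicative P = ∀ m n → P (m ℕ.+ n) ≈ P m * P n

  Inverse₋ Inverse₊ : Sequence → Sequence → Set
  Inverse₋ P v = ∀ n → (1# - P (suc n)) * v n ≈ 1#
  Inverse₊ P j = ∀ n → (1# + P n) * j n ≈ 1#

  VanishesAbove : ℕ → Sequence → Set
  VanishesAbove N P = ∀ m → N ℕ.< m → P m ≈ 0#

-- Ring normalisation with coefficients in the prime field, so that 3 = 0 is used.
module Solver₃ (R : CommutativeRing 0ℓ 0ℓ)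
  (char3 : Char3 R) where
  open CommutativeRing R
  open import Algebra.Properties.Ring ring
  import Algebra.Solver.Ring.AlmostCommutativeRing as ACR

  ⟦_⟧₃ : F₃ → Carrier
  ⟦ zero ⟧₃          = 0#
  ⟦ suc zero ⟧₃      = 1#
  ⟦ suc (suc zero) ⟧₃ = - 1#

  private
    1+1≈-1 : 1# + 1# ≈ - 1#
    1+1≈-1 = +-inverseʳ-unique 1# (1# + 1#) char3

    -1-1≈1 : - 1# + - 1# ≈ 1#
    -1-1≈1 = trans (-‿+-comm 1# 1#) (trans (-‿cong 1+1≈-1) (-‿involutive 1#))

    -0≈0 : 0# ≈ - 0#
    -0≈0 = sym -0#≈0#

    +-homo : ∀ x y → ⟦ x F₃.+ y ⟧₃ ≈ ⟦ x ⟧₃ + ⟦ y ⟧₃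
    +-homo zero zero                         = sym (+-identityˡ _)
    +-homo zero (suc zero)                   = sym (+-identityˡ _)
    +-homo zero (suc (suc zero))             = sym (+-identityˡ _)
    +-homo (suc zero) zero                   = sym (+-identityʳ _)
    +-homo (suc zero) (suc zero)             = sym 1+1≈-1
    +-homo (suc zero) (suc (suc zero))       = sym (-‿inverseʳ _)
    +-homo (suc (suc zero)) zero             = sym (+-identityʳ _)
    +-homo (suc (suc zero)) (suc zero)       = sym (-‿inverseˡ _)
    +-homo (suc (suc zero)) (suc (suc zero)) = sym -1-1≈1

    *-homo : ∀ x y → ⟦ x F₃.* y ⟧₃ ≈ ⟦ x ⟧₃ * ⟦ y ⟧₃
    *-homo zero zero                         = sym (zeroˡ _)
    *-homo zero (suc zero)                   = sym (zeroˡ _)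
    *-homo zero (suc (suc zero))             = sym (zeroˡ _)
    *-homo (suc zero) zero                   = sym (zeroʳ _)
    *-homo (suc zero) (suc zero)             = sym (*-identityˡ _)
    *-homo (suc zero) (suc (suc zero))       = sym (*-identityˡ _)
    *-homo (suc (suc zero)) zero             = sym (zeroʳ _)
    *-homo (suc (suc zero)) (suc zero)       = sym (*-identityʳ _)
    *-homo (suc (suc zero)) (suc (suc zero)) =
      sym (trans (-1*x≈-x (- 1#)) (-‿involutive 1#))

    -‿homo : ∀ x → ⟦ F₃.- x ⟧₃ ≈ - ⟦ x ⟧₃
    -‿homo zero             = -0≈0
    -‿homo (suc zero)       = refl
    -‿homo (suc (suc zero)) = sym (-‿involutive 1#)

    morphism : CommutativeRing.rawRing F₃.ring
      ACR.-Raw-AlmostCommutative⟶ ACR.fromCommutativeRing R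
    morphism = record
      { ⟦_⟧ = ⟦_⟧₃ ; +-homo = +-homo ; *-homo = *-homo ; -‿homo = -‿homo
      ; 0-homo = refl ; 1-homo = refl }

    _coeff≟_ : ∀ x y → Maybe (⟦ x ⟧₃ ≈ ⟦ y ⟧₃)
    x coeff≟ y with x ≟ y
    ... | yes ≡.refl = just refl
    ... | no _       = nothing

  open import Algebra.Solver.Ring (CommutativeRing.rawRing F₃.ring) (ACR.fromCommutativeRing R)
    morphism _coeff≟_ public
    using (solve; Polynomial; _:=_; _:+_; _:*_; _:-_; :-_; con)

  :1 :0 : ∀ {n} → Polynomial n
  :1 = con F₃.1#
  :0 = con F₃.0#

-- Bailey pairs relative to q, Bailey's lemma and partial fractions.

module Bailey (R : CommutativeRing 0ℓ 0ℓ)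
  (char3 : Char3 R)
  (P : Sequence R) (P-0 : UnitAt0 R P) (P-+ : Multiplicative R P)
  (v : Sequence R) (v-inv : Inverse₋ R P v) where
  open CommutativeRing R
  open import Relation.Binary.Reasoning.Setoid setoid
  open Convolution R
  open Solver₃ R char3

  -- With `P n` = qⁿ these are `I n` = 1 / (q;q)_n, `F n` = (q;q)_n and `t r` = (-1)^r q^(r(r-1)/2);
  -- `u` is the sequence that the matrix `a` sends to the unit sequence.
  I F t u : ℕ → Carrier
  I zero    = 1#
  I (suc n) = v n * I n
  F zero    = 1#
  F (suc n) = (1# - P (suc n)) * F n
  t zero    = 1#
  t (suc r) = - (P r * t r)
  u r       = t r * (1# - P (suc (r ℕ.+ r)))

  -- For n = k + r this is 1 / ((q;q)_(n-r) (q;q)_(n+r+1)), the matrix of Bailey pairs relative to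
  -- q. The customary factor 1 - q is absorbed into the sequence on which it acts.
  a : ℕ → ℕ → Carrier
  a k r = I k * I (k ℕ.+ suc (r ℕ.+ r))

  I-suc : ∀ n → (1# - P (suc n)) * I (suc n) ≈ I n
  I-suc n = begin
    (1# - P (suc n)) * (v n * I n)  ≈⟨ *-assoc _ _ _ ⟨
    (1# - P (suc n)) * v n * I n    ≈⟨ *-congʳ (v-inv n) ⟩
    1# * I n                        ≈⟨ *-identityˡ _ ⟩
    I n                             ∎

  I-+suc : ∀ k m → (1# - P (k ℕ.+ suc m)) * I (k ℕ.+ suc m) ≈ I (k ℕ.+ m)
  I-+suc k m rewrite ℕₚ.+-suc k m = I-suc (k ℕ.+ m)

  F*I : ∀ n → F n * I n ≈ 1#
  F*I zero    = *-identityˡ _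
  F*I (suc n) = begin
    (1# - P (suc n)) * F n * (v n * I n)
      ≈⟨ solve 4 (λ q f w i → q :* f :* (w :* i) := (q :* w) :* (f :* i)) refl _ _ _ _ ⟩
    (1# - P (suc n)) * v n * (F n * I n)  ≈⟨ *-cong (v-inv n) (F*I n) ⟩
    1# * 1#                               ≈⟨ *-identityˡ _ ⟩
    1#                                    ∎

  cancel : ∀ n {x y} → (1# - P (suc n)) * x ≈ (1# - P (suc n)) * y → x ≈ y
  cancel n {x} {y} e = begin
    x                            ≈⟨ drop x ⟨
    v n * ((1# - P (suc n)) * x) ≈⟨ *-congˡ e ⟩
    v n * ((1# - P (suc n)) * y) ≈⟨ drop y ⟩
    y                            ∎
    where
    drop : ∀ z → v n * ((1# - P (suc n)) * z) ≈ z
    drop z = trans (sym (*-assoc _ _ _))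
      (trans (*-congʳ (trans (*-comm _ _) (v-inv n))) (*-identityˡ z))

  P-suc2 : ∀ r → P (suc (r ℕ.+ r)) ≈ P 1 * (P r * P r)
  P-suc2 r = trans (P-+ 1 _) (*-congˡ (P-+ r r))

  P-+suc2 : ∀ k r → P (k ℕ.+ suc (r ℕ.+ r)) ≈ P k * (P 1 * (P r * P r))
  P-+suc2 k r = trans (P-+ k _) (*-congˡ (P-suc2 r))

  1-P0 : 1# - P 0 ≈ 0#
  1-P0 = trans (+-congˡ (-‿cong P-0)) (-‿inverseʳ _)

  unit₀ : a 0 0 * u 0 ≈ 1#
  unit₀ = begin
    1# * (v 0 * 1#) * (1# * (1# - P 1))
      ≈⟨ solve 2 (λ w q → :1 :* (w :* :1) :* (:1 :* (:1 :- q)) := (:1 :- q) :* w) refl _ _ ⟩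
    (1# - P 1) * v 0  ≈⟨ v-inv 0 ⟩
    1#                ∎

  -- (1 - P N) times the summand splits as g + h with h k (r+1) = - g (k+1) r.
  unit : ∀ n → conv (suc n) (λ k r → a k r * u r) ≈ 0#
  unit n = cancel n (begin
    (1# - P N) * conv N (λ k r → a k r * u r)        ≈⟨ conv-*ˡ _ N (λ k r → a k r * u r) ⟨
    conv N (λ k r → (1# - P N) * (a k r * u r))      ≈⟨ conv-cong N split ⟩
    conv N (λ k r → g k r + h k r)                   ≈⟨ conv-+ N g h ⟩
    conv N g + conv N h                              ≈⟨ +-cong conv-g conv-h ⟩
    conv n (λ k r → g (suc k) r) + - conv n (λ k r → g (suc k) r)
                                                     ≈⟨ -‿inverseʳ _ ⟩
    0#                                               ≈⟨ zeroʳ _ ⟨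
    (1# - P N) * 0#                                  ∎)
    where
    N = suc n
    g h : ℕ → ℕ → Carrier
    g k r = t r * P r * (1# - P (suc r)) * ((1# - P k) * a k r)
    h k r = t r * (1# - P r) * (I k * I (k ℕ.+ (r ℕ.+ r)))

    split : ∀ k r → k ℕ.+ r ≡ N → (1# - P N) * (a k r * u r) ≈ g k r + h k r
    split k r e = begin
      (1# - P N) * (I k * J * (t r * (1# - P (suc (r ℕ.+ r)))))
        ≈⟨ *-cong (+-congˡ (-‿cong (trans (reflexive (cong P (≡.sym e))) (P-+ k r))))
             (*-congˡ (*-congˡ (+-congˡ (-‿cong (P-suc2 r))))) ⟩
      (1# - P k * P r) * (I k * J * (t r * (1# - P 1 * (P r * P r))))
        ≈⟨ solve 6 (λ k r p i j t →
             (:1 :- k :* r) :* (i :* j :* (t :* (:1 :- p :* (r :* r))))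
             := t :* r :* (:1 :- p :* r) :* ((:1 :- k) :* (i :* j))
                :+ t :* (:1 :- r) :* (i :* ((:1 :- k :* (p :* (r :* r))) :* j)))
             refl (P k) (P r) (P 1) (I k) J (t r) ⟩
      t r * P r * (1# - P 1 * P r) * ((1# - P k) * (I k * J))
        + t r * (1# - P r) * (I k * ((1# - P k * (P 1 * (P r * P r))) * J))
        ≈⟨ +-cong (*-congʳ (*-congˡ (+-congˡ (-‿cong (sym (P-+ 1 r))))))
             (*-congˡ (*-congˡ (trans (*-congʳ (+-congˡ (-‿cong (sym (P-+suc2 k r)))))
                (I-+suc k (r ℕ.+ r))))) ⟩
      g k r + h k r ∎
      where J = I (k ℕ.+ suc (r ℕ.+ r))

    conv-g : conv N g ≈ conv n (λ k r → g (suc k) r)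
    conv-g = trans (+-congʳ (trans (*-congˡ (trans (*-congʳ 1-P0) (zeroˡ _))) (zeroʳ _)))
      (+-identityˡ _)

    flip-sign : ∀ k r → h k (suc r) ≈ - g (suc k) r
    flip-sign k r = begin
      - (P r * t r) * (1# - P (suc r)) * (I k * I (k ℕ.+ (suc r ℕ.+ suc r)))
        ≈⟨ *-congˡ (*-congˡ (reflexive (cong I (index k r)))) ⟩
      - (P r * t r) * (1# - P (suc r)) * (I k * J)
        ≈⟨ solve 5 (λ p t q i j → :- (p :* t) :* q :* (i :* j) := :- (t :* p :* q :* (i :* j)))
             refl (P r) (t r) _ (I k) J ⟩
      - (t r * P r * (1# - P (suc r)) * (I k * J))
        ≈⟨ -‿cong (*-congˡ (trans (*-congʳ (sym (I-suc k))) (*-assoc _ _ _))) ⟩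
      - g (suc k) r ∎
      where
      J = I (suc k ℕ.+ suc (r ℕ.+ r))
      index : ∀ k r → k ℕ.+ (suc r ℕ.+ suc r) ≡ suc k ℕ.+ suc (r ℕ.+ r)
      index = solve-∀

    conv-h : conv N h ≈ - conv n (λ k r → g (suc k) r)
    conv-h = begin
      conv N h ≈⟨ conv-last n h ⟩
      conv n (λ k r → h k (suc r)) + h N 0
        ≈⟨ +-cong (conv-cong n λ k r _ → flip-sign k r)
             (trans (*-congʳ (trans (*-congˡ 1-P0) (zeroʳ _))) (zeroˡ _)) ⟩
      conv n (λ k r → - g (suc k) r) + 0#  ≈⟨ +-identityʳ _ ⟩
      conv n (λ k r → - g (suc k) r)       ≈⟨ conv-- n _ ⟩
      - conv n (λ k r → g (suc k) r)       ∎

  -- Partitions into at most K + m parts, sorted by their largest rectangle with j + m rows and j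
  -- columns, and divided by (q;q)_K. The induction on K needs all m at once: 1 - q^(K+1) = (1 - qⁱ)
  -- + qⁱ (1 - qʲ) leads to the instances (K, m) and (K, m + 1).
  durfee : ∀ K m → conv K (λ i j → P (j ℕ.* (j ℕ.+ m)) * (I j * I (j ℕ.+ m) * I i))
                   ≈ I K * I (K ℕ.+ m)
  durfee zero m = trans (*-cong P-0 (*-identityʳ _)) (*-identityˡ _)
  durfee (suc K) m = cancel K (begin
    (1# - P (suc K)) * conv (suc K) f  ≈⟨ conv-*ˡ _ (suc K) f ⟨
    conv (suc K) (λ i j → (1# - P (suc K)) * f i j)
      ≈⟨ conv-cong (suc K) split ⟩
    conv (suc K) (λ i j → (1# - P i) * f i j + P i * ((1# - P j) * f i j))
      ≈⟨ conv-+ (suc K) (λ i j → (1# - P i) * f i j) (λ i j → P i * ((1# - P j) * f i j)) ⟩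
    conv (suc K) (λ i j → (1# - P i) * f i j) + conv (suc K) (λ i j → P i * ((1# - P j) * f i j))
      ≈⟨ +-cong first second ⟩
    I K * I (K ℕ.+ m) + P (K ℕ.+ suc m) * (I K * I (K ℕ.+ suc m))
      ≈⟨ +-congʳ (*-congˡ (sym (I-+suc K m))) ⟩
    I K * ((1# - P (K ℕ.+ suc m)) * I (K ℕ.+ suc m)) + P (K ℕ.+ suc m) * (I K * I (K ℕ.+ suc m))
      ≈⟨ solve 3 (λ i p j → i :* ((:1 :- p) :* j) :+ p :* (i :* j) := i :* j) refl _ _ _ ⟩
    I K * I (K ℕ.+ suc m)
      ≈⟨ *-cong (sym (I-suc K)) (reflexive (cong I (ℕₚ.+-suc K m))) ⟩
    (1# - P (suc K)) * I (suc K) * I (suc K ℕ.+ m)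
      ≈⟨ *-assoc _ _ _ ⟩
    (1# - P (suc K)) * (I (suc K) * I (suc K ℕ.+ m)) ∎)
    where
    f : ℕ → ℕ → Carrier
    f i j = P (j ℕ.* (j ℕ.+ m)) * (I j * I (j ℕ.+ m) * I i)

    split : ∀ i j → i ℕ.+ j ≡ suc K →
      (1# - P (suc K)) * f i j ≈ (1# - P i) * f i j + P i * ((1# - P j) * f i j)
    split i j e = trans
      (*-congʳ (+-congˡ (-‿cong (trans (reflexive (cong P (≡.sym e))) (P-+ i j)))))
      (solve 3 (λ p q f → (:1 :- p :* q) :* f := (:1 :- p) :* f :+ p :* ((:1 :- q) :* f))
        refl _ _ _)

    first : conv (suc K) (λ i j → (1# - P i) * f i j) ≈ I K * I (K ℕ.+ m)
    first = begin
      (1# - P 0) * f 0 (suc K) + conv K (λ i j → (1# - P (suc i)) * f (suc i) j)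
        ≈⟨ +-cong (trans (*-congʳ 1-P0) (zeroˡ _)) (conv-cong K λ i j _ → reduce i j) ⟩
      0# + conv K (λ i j → P (j ℕ.* (j ℕ.+ m)) * (I j * I (j ℕ.+ m) * I i))
        ≈⟨ +-identityˡ _ ⟩
      conv K (λ i j → P (j ℕ.* (j ℕ.+ m)) * (I j * I (j ℕ.+ m) * I i))
        ≈⟨ durfee K m ⟩
      I K * I (K ℕ.+ m) ∎
      where
      reduce : ∀ i j → (1# - P (suc i)) * f (suc i) j ≈ P (j ℕ.* (j ℕ.+ m)) * (I j * I (j ℕ.+ m) * I i)
      reduce i j = trans
        (solve 4 (λ q p x y → q :* (p :* (x :* y)) := p :* (x :* (q :* y))) refl _ _ _ _)
        (*-congˡ (*-congˡ (I-suc i)))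

    second : conv (suc K) (λ i j → P i * ((1# - P j) * f i j))
             ≈ P (K ℕ.+ suc m) * (I K * I (K ℕ.+ suc m))
    second = begin
      conv (suc K) (λ i j → P i * ((1# - P j) * f i j))
        ≈⟨ conv-last K (λ i j → P i * ((1# - P j) * f i j)) ⟩
      conv K (λ i j → P i * ((1# - P (suc j)) * f i (suc j))) + P (suc K) * ((1# - P 0) * f (suc K) 0)
        ≈⟨ +-cong (conv-cong K reduce)
             (trans (*-congˡ (trans (*-congʳ 1-P0) (zeroˡ _))) (zeroʳ _)) ⟩
      conv K (λ i j → P (K ℕ.+ suc m) * (P (j ℕ.* (j ℕ.+ suc m)) * (I j * I (j ℕ.+ suc m) * I i))) + 0#
        ≈⟨ +-identityʳ _ ⟩
      conv K (λ i j → P (K ℕ.+ suc m) * (P (j ℕ.* (j ℕ.+ suc m)) * (I j * I (j ℕ.+ suc m) * I i)))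
        ≈⟨ conv-*ˡ _ K _ ⟩
      P (K ℕ.+ suc m) * conv K (λ i j → P (j ℕ.* (j ℕ.+ suc m)) * (I j * I (j ℕ.+ suc m) * I i))
        ≈⟨ *-congˡ (durfee K (suc m)) ⟩
      P (K ℕ.+ suc m) * (I K * I (K ℕ.+ suc m)) ∎
      where
      exponent : ∀ i j m → i ℕ.+ suc j ℕ.* (suc j ℕ.+ m) ≡ i ℕ.+ j ℕ.+ suc m ℕ.+ j ℕ.* (j ℕ.+ suc m)
      exponent = solve-∀

      reduce : ∀ i j → i ℕ.+ j ≡ K → P i * ((1# - P (suc j)) * f i (suc j))
        ≈ P (K ℕ.+ suc m) * (P (j ℕ.* (j ℕ.+ suc m)) * (I j * I (j ℕ.+ suc m) * I i))
      reduce i j ≡.refl = begin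
        P i * ((1# - P (suc j)) * (P (suc j ℕ.* (suc j ℕ.+ m)) * (I (suc j) * I (suc j ℕ.+ m) * I i)))
          ≈⟨ solve 6 (λ p q s x y z → p :* (q :* (s :* (x :* y :* z))) := (p :* s) :* ((q :* x) :* y :* z))
               refl _ _ _ _ _ _ ⟩
        P i * P (suc j ℕ.* (suc j ℕ.+ m)) * ((1# - P (suc j)) * I (suc j) * I (suc j ℕ.+ m) * I i)
          ≈⟨ *-cong (trans (sym (P-+ i _)) (trans (reflexive (cong P (exponent i j m))) (P-+ _ _)))
               (*-congʳ (*-cong (I-suc j) (reflexive (cong I (≡.sym (ℕₚ.+-suc j m)))))) ⟩
        P (K ℕ.+ suc m) * P (j ℕ.* (j ℕ.+ suc m)) * (I j * I (j ℕ.+ suc m) * I i)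
          ≈⟨ *-assoc _ _ _ ⟩
        P (K ℕ.+ suc m) * (P (j ℕ.* (j ℕ.+ suc m)) * (I j * I (j ℕ.+ suc m) * I i)) ∎

  -- Bailey's lemma with both free parameters sent to infinity. As n² + n = k (k + 2r + 1) + (r² +
  -- r) for n = k + r, regrouping the triple sum makes the inner sum over l + k = M an instance of
  -- `durfee` with m = 2r + 1.
  bailey : ∀ N (β γ : ℕ → Carrier) → (∀ n → β n ≈ conv n (λ k r → a k r * γ r)) →
    conv N (λ l n → I l * (P (n ℕ.* n ℕ.+ n) * β n)) ≈ conv N (λ k r → a k r * (P (r ℕ.* r ℕ.+ r) * γ r))
  bailey N β γ pair = begin
    conv N (λ l n → I l * (P (n ℕ.* n ℕ.+ n) * β n))
      ≈⟨ conv-cong N (λ l n _ → expand l n) ⟩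
    conv N (λ l n → conv n (λ k r → I l * (P (n ℕ.* n ℕ.+ n) * (a k r * γ r))))
      ≈⟨ conv-cong N (λ l n _ → conv-cong n λ k r e → rearrange l k r n e) ⟩
    conv N (λ l n → conv n (λ k r → s l k r))
      ≈⟨ conv-assoc N s ⟨
    conv N (λ M r → conv M (λ l k → s l k r))
      ≈⟨ conv-cong N (λ M r _ → trans (conv-*ʳ _ M _) (*-congʳ (durfee M (suc (r ℕ.+ r))))) ⟩
    conv N (λ k r → a k r * (P (r ℕ.* r ℕ.+ r) * γ r)) ∎
    where
    s : ℕ → ℕ → ℕ → Carrier
    s l k r = P (k ℕ.* (k ℕ.+ suc (r ℕ.+ r))) * (I k * I (k ℕ.+ suc (r ℕ.+ r)) * I l)
                * (P (r ℕ.* r ℕ.+ r) * γ r)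

    expand : ∀ l n → I l * (P (n ℕ.* n ℕ.+ n) * β n)
      ≈ conv n (λ k r → I l * (P (n ℕ.* n ℕ.+ n) * (a k r * γ r)))
    expand l n = trans (*-congˡ (*-congˡ (pair n)))
      (sym (trans (conv-*ˡ (I l) n _) (*-congˡ (conv-*ˡ _ n _))))

    exponent : ∀ k r → (k ℕ.+ r) ℕ.* (k ℕ.+ r) ℕ.+ (k ℕ.+ r)
      ≡ k ℕ.* (k ℕ.+ suc (r ℕ.+ r)) ℕ.+ (r ℕ.* r ℕ.+ r)
    exponent = solve-∀

    rearrange : ∀ l k r n → k ℕ.+ r ≡ n → I l * (P (n ℕ.* n ℕ.+ n) * (a k r * γ r)) ≈ s l k r
    rearrange l k r n ≡.refl = trans
      (*-congˡ (*-congʳ (trans (reflexive (cong P (exponent k r))) (P-+ _ _))))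
      (solve 6 (λ i p q x y g → i :* ((p :* q) :* ((x :* y) :* g)) := (p :* (x :* y :* i)) :* (q :* g))
        refl _ _ _ _ _ _)

  module PartialFractions (x y : Carrier) (xy≈P1 : x * y ≈ P 1)
    (d : ℕ → Carrier) (d-inv : ∀ r → (1# - x * P r) * (1# - y * P r) * d r ≈ 1#) where

    β : ℕ → Carrier
    β zero    = d 0
    β (suc n) = d (suc n) * β n

    -- Partial fractions by induction instead of residues. Multiplied by the last denominator, each
    -- summand splits into a multiple of the unit pair, which sums to 0 by `unit`, and a part where
    -- (1 - q^k) (1 - q^(k+2r+1)) lowers k by one in `a`, giving the sum of order n. The condition x
    -- y = q produces that second part.
    β≈conv : ∀ n → β n ≈ conv n (λ k r → a k r * (u r * (P r * d r)))
    β≈conv zero = sym (begin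
      a 0 0 * (u 0 * (P 0 * d 0))  ≈⟨ *-assoc _ _ _ ⟨
      a 0 0 * u 0 * (P 0 * d 0)    ≈⟨ *-cong unit₀ (*-congʳ P-0) ⟩
      1# * (1# * d 0)              ≈⟨ trans (*-identityˡ _) (*-identityˡ _) ⟩
      d 0                          ∎)
    β≈conv (suc n) = begin
      d N * β n                    ≈⟨ *-congˡ (trans (β≈conv n) (sym step)) ⟩
      d N * (D N * conv N s)       ≈⟨ *-assoc _ _ _ ⟨
      d N * D N * conv N s         ≈⟨ *-congʳ (trans (*-comm _ _) (d-inv N)) ⟩
      1# * conv N s                ≈⟨ *-identityˡ _ ⟩
      conv N s                     ∎
      where
      N = suc n
      D : ℕ → Carrier
      D r = (1# - x * P r) * (1# - y * P r)
      s s′ : ℕ → ℕ → Carrier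
      s k r = a k r * (u r * (P r * d r))
      s′ k r = (1# - P k) * (1# - P (k ℕ.+ suc (r ℕ.+ r))) * s k r

      -- D N = P k D r + (1 - P k) (1 - P (k + 2 r + 1)) for k + r = N.
      split : ∀ k r → k ℕ.+ r ≡ N → D N * s k r ≈ P N * (a k r * u r) + s′ k r
      split k r e = begin
        D N * s k r
          ≈⟨ *-congʳ (*-cong (+-congˡ (-‿cong (*-congˡ PN))) (+-congˡ (-‿cong (*-congˡ PN)))) ⟩
        (1# - x * (P k * P r)) * (1# - y * (P k * P r)) * s k r
          ≈⟨ solve 7 (λ x y k r a u d →
               (:1 :- x :* (k :* r)) :* (:1 :- y :* (k :* r)) :* (a :* (u :* (r :* d)))
               := k :* r :* (a :* u) :* ((:1 :- x :* r) :* (:1 :- y :* r) :* d)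
                  :+ (:1 :- k) :* (:1 :- k :* (x :* y :* (r :* r))) :* (a :* (u :* (r :* d))))
               refl x y (P k) (P r) (a k r) (u r) (d r) ⟩
        P k * P r * (a k r * u r) * (D r * d r)
          + (1# - P k) * (1# - P k * (x * y * (P r * P r))) * s k r
          ≈⟨ +-cong (trans (*-cong (*-congʳ (sym PN)) (d-inv r)) (*-identityʳ _))
               (*-congʳ (*-congˡ (+-congˡ (-‿cong
                 (trans (*-congˡ (*-congʳ xy≈P1)) (sym (P-+suc2 k r))))))) ⟩
        P N * (a k r * u r) + s′ k r ∎
        where
        PN : P N ≈ P k * P r
        PN = trans (reflexive (cong P (≡.sym e))) (P-+ k r)

      lower : ∀ k r → s′ (suc k) r ≈ s k r
      lower k r = begin
        (1# - P (suc k)) * (1# - P (suc m)) * (v k * I k * I (suc m) * w)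
          ≈⟨ solve 6 (λ p q v i j w → p :* q :* (v :* i :* j :* w) := (p :* (v :* i)) :* (q :* j) :* w)
               refl _ _ (v k) (I k) _ w ⟩
        ((1# - P (suc k)) * I (suc k)) * ((1# - P (suc m)) * I (suc m)) * w
          ≈⟨ *-congʳ (*-cong (I-suc k) (I-suc m)) ⟩
        I k * I m * w ∎
        where
        m = k ℕ.+ suc (r ℕ.+ r)
        w = u r * (P r * d r)

      step : D N * conv N s ≈ conv n s
      step = begin
        D N * conv N s                                        ≈⟨ conv-*ˡ _ N s ⟨
        conv N (λ k r → D N * s k r)                          ≈⟨ conv-cong N split ⟩
        conv N (λ k r → P N * (a k r * u r) + s′ k r)         ≈⟨ conv-+ N (λ k r → P N * (a k r * u r)) s′ ⟩
        conv N (λ k r → P N * (a k r * u r)) + conv N s′      ≈⟨ +-congʳ (conv-*ˡ _ N (λ k r → a k r * u r)) ⟩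
        P N * conv N (λ k r → a k r * u r) + conv N s′        ≈⟨ +-congʳ (trans (*-congˡ (unit n)) (zeroʳ _)) ⟩
        0# + conv N s′                                        ≈⟨ +-identityˡ _ ⟩
        conv N s′                                             ≈⟨ +-cong s′0 (conv-cong n λ k r _ → lower k r) ⟩
        0# + conv n s                                         ≈⟨ +-identityˡ _ ⟩
        conv n s                                              ∎
        where
        s′0 : s′ 0 N ≈ 0#
        s′0 = trans (*-congʳ (trans (*-congʳ 1-P0) (zeroˡ _))) (zeroˡ _)

  module Truncated (N : ℕ) (nil : VanishesAbove R N P) where

    -- `v n` is 1 + O(q^(n+1)), and q^e pushes the correction beyond q^N.
    absorb-v : ∀ e n → N ℕ.≤ e ℕ.+ n → P e * v n ≈ P e
    absorb-v e n le = begin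
      P e * v n
        ≈⟨ solve 3 (λ p q v → p :* v := p :* ((:1 :- q) :* v) :+ p :* q :* v) refl _ (P (suc n)) _ ⟩
      P e * ((1# - P (suc n)) * v n) + P e * P (suc n) * v n
        ≈⟨ +-cong (trans (*-congˡ (v-inv n)) (*-identityʳ _)) (*-congʳ vanish) ⟩
      P e + 0# * v n  ≈⟨ trans (+-congˡ (zeroˡ _)) (+-identityʳ _) ⟩
      P e             ∎
      where
      vanish : P e * P (suc n) ≈ 0#
      vanish = trans (sym (P-+ e (suc n)))
        (nil _ (ℕₚ.≤-trans (ℕ.s≤s le) (ℕₚ.≤-reflexive (≡.sym (ℕₚ.+-suc e n)))))

    absorb-F*I : ∀ e l n → N ℕ.≤ e ℕ.+ l → P e * (F l * I (n ℕ.+ l)) ≈ P e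
    absorb-F*I e l zero    le = trans (*-congˡ (F*I l)) (*-identityʳ _)
    absorb-F*I e l (suc n) le = begin
      P e * (F l * (v (n ℕ.+ l) * I (n ℕ.+ l)))
        ≈⟨ solve 4 (λ p f v i → p :* (f :* (v :* i)) := (p :* v) :* (f :* i)) refl _ _ _ _ ⟩
      P e * v (n ℕ.+ l) * (F l * I (n ℕ.+ l))
        ≈⟨ *-congʳ (absorb-v e (n ℕ.+ l) (ℕₚ.≤-trans le (ℕₚ.+-monoʳ-≤ e (ℕₚ.m≤n+m l n)))) ⟩
      P e * (F l * I (n ℕ.+ l))  ≈⟨ absorb-F*I e l n le ⟩
      P e                        ∎

    absorb-F*I′ : ∀ e l n → N ℕ.≤ e ℕ.+ l → P e * (F (n ℕ.+ l) * I l) ≈ P e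
    absorb-F*I′ e l zero    le = trans (*-congˡ (F*I l)) (*-identityʳ _)
    absorb-F*I′ e l (suc n) le = begin
      P e * ((1# - P (suc m)) * F m * I l)
        ≈⟨ solve 4 (λ p q f i → p :* ((:1 :- q) :* f :* i) := p :* (f :* i) :- p :* q :* (f :* i))
             refl _ _ _ _ ⟩
      P e * (F m * I l) - P e * P (suc m) * (F m * I l)
        ≈⟨ +-cong (absorb-F*I′ e l n le) (-‿cong (trans (*-congʳ vanish) (zeroˡ _))) ⟩
      P e - 0#  ≈⟨ solve 1 (λ p → p :- :0 := p) refl _ ⟩
      P e       ∎
      where
      m = n ℕ.+ l
      vanish : P e * P (suc m) ≈ 0#
      vanish = trans (sym (P-+ e (suc m)))
        (nil _ (ℕₚ.≤-trans (ℕ.s≤s (ℕₚ.≤-trans le (ℕₚ.+-monoʳ-≤ e (ℕₚ.m≤n+m l n))))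
          (ℕₚ.≤-reflexive (≡.sym (ℕₚ.+-suc e m)))))

    -- `F N * I k` with k = N - r is 1 only up to an error of order q^(k+1); the weight `P r` lifts
    -- that error above q^N. The index k + 2r + 1 of the other `I` exceeds N, so there `F N` cancels
    -- outright.
    conv-limit : ∀ (w : ℕ → Carrier) → F N * F N * conv N (λ k r → a k r * (P r * w r)) ≈ conv N (λ _ r → P r * w r)
    conv-limit w = trans (sym (conv-*ˡ _ N (λ k r → a k r * (P r * w r)))) (conv-cong N term)
      where
      shift : ∀ k r → k ℕ.+ suc (r ℕ.+ r) ≡ suc r ℕ.+ (k ℕ.+ r)
      shift = solve-∀

      F*I≈1 : ∀ k r → k ℕ.+ r ≡ N → F N * I (k ℕ.+ suc (r ℕ.+ r)) ≈ 1#
      F*I≈1 k r ≡.refl = begin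
        F N * I (k ℕ.+ suc (r ℕ.+ r))      ≈⟨ *-identityˡ _ ⟨
        1# * (F N * I (k ℕ.+ suc (r ℕ.+ r)))
          ≈⟨ *-cong (sym P-0) (*-congˡ (reflexive (cong I (shift k r)))) ⟩
        P 0 * (F N * I (suc r ℕ.+ N))      ≈⟨ absorb-F*I 0 N (suc r) ℕₚ.≤-refl ⟩
        P 0                                ≈⟨ P-0 ⟩
        1#                                 ∎

      term : ∀ k r → k ℕ.+ r ≡ N → F N * F N * (a k r * (P r * w r)) ≈ P r * w r
      term k r e = begin
        F N * F N * (I k * J * (P r * w r))
          ≈⟨ solve 5 (λ f i j p w → f :* f :* (i :* j :* (p :* w)) := (f :* j) :* (p :* (f :* i)) :* w)
               refl (F N) (I k) J (P r) (w r) ⟩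
        (F N * J) * (P r * (F N * I k)) * w r
          ≈⟨ *-congʳ (*-cong (F*I≈1 k r e) (trans (*-congˡ (*-congʳ (reflexive (cong F
               (≡.trans (≡.sym e) (ℕₚ.+-comm k r)))))) (absorb-F*I′ r k r
               (ℕₚ.≤-reflexive (≡.trans (≡.sym e) (ℕₚ.+-comm k r)))))) ⟩
        1# * P r * w r  ≈⟨ *-congʳ (*-identityˡ _) ⟩
        P r * w r       ∎
        where J = I (k ℕ.+ suc (r ℕ.+ r))

    -- The limit of `bailey` for large N. On both sides the linear part of the exponent n² + n is
    -- spent on absorbing the error of the truncated products.
    bailey-limit : ∀ (β γ : ℕ → Carrier) → (∀ n → β n ≈ conv n (λ k r → a k r * γ r)) →
      F N * conv N (λ _ n → P (n ℕ.* n ℕ.+ n) * β n) ≈ conv N (λ _ r → P (r ℕ.* r ℕ.+ r) * γ r)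
    bailey-limit β γ pair = begin
      F N * conv N (λ _ n → P (n ℕ.* n ℕ.+ n) * β n)
        ≈⟨ *-congˡ (trans (conv-cong N absorb) (conv-*ˡ _ N _)) ⟩
      F N * (F N * conv N (λ l n → I l * (P (n ℕ.* n ℕ.+ n) * β n)))
        ≈⟨ *-assoc _ _ _ ⟨
      F N * F N * conv N (λ l n → I l * (P (n ℕ.* n ℕ.+ n) * β n))
        ≈⟨ *-congˡ (trans (bailey N β γ pair) (conv-cong N λ k r _ → *-congˡ (factor r (γ r)))) ⟩
      F N * F N * conv N (λ k r → a k r * (P r * (P (r ℕ.* r) * γ r)))
        ≈⟨ conv-limit (λ r → P (r ℕ.* r) * γ r) ⟩
      conv N (λ _ r → P r * (P (r ℕ.* r) * γ r))
        ≈⟨ conv-cong N (λ _ r _ → factor r (γ r)) ⟨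
      conv N (λ _ r → P (r ℕ.* r ℕ.+ r) * γ r) ∎
      where
      factor : ∀ r z → P (r ℕ.* r ℕ.+ r) * z ≈ P r * (P (r ℕ.* r) * z)
      factor r z = trans (*-congʳ (trans (P-+ (r ℕ.* r) r) (*-comm _ _))) (*-assoc _ _ _)

      absorb : ∀ l n → l ℕ.+ n ≡ N →
        P (n ℕ.* n ℕ.+ n) * β n ≈ F N * (I l * (P (n ℕ.* n ℕ.+ n) * β n))
      absorb l n e = begin
        P (n ℕ.* n ℕ.+ n) * β n  ≈⟨ factor n (β n) ⟩
        P n * (P (n ℕ.* n) * β n)
          ≈⟨ *-congʳ (absorb-F*I′ n l n (ℕₚ.≤-reflexive (≡.trans (≡.sym e) (ℕₚ.+-comm l n)))) ⟨
        P n * (F (n ℕ.+ l) * I l) * (P (n ℕ.* n) * β n)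
          ≈⟨ *-congʳ (*-congˡ (*-congʳ (reflexive (cong F (≡.trans (ℕₚ.+-comm n l) e))))) ⟩
        P n * (F N * I l) * (P (n ℕ.* n) * β n)
          ≈⟨ solve 4 (λ p f i z → p :* (f :* i) :* z := f :* (i :* (p :* z))) refl _ _ _ _ ⟩
        F N * (I l * (P n * (P (n ℕ.* n) * β n)))
          ≈⟨ *-congˡ (*-congˡ (factor n (β n))) ⟨
        F N * (I l * (P (n ℕ.* n ℕ.+ n) * β n)) ∎

-- Gauss' product for φ(-q) by Shanks' finite sum.

module Gauss (R : CommutativeRing 0ℓ 0ℓ)
  (char3 : Char3 R)
  (P : Sequence R) (P-0 : UnitAt0 R P) (P-+ : Multiplicative R P)
  (j : Sequence R) (j-inv : Inverse₊ R P j) where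
  open CommutativeRing R
  open import Relation.Binary.Reasoning.Setoid setoid
  open Convolution R
  open Solver₃ R char3

  sg F E : ℕ → Carrier
  sg zero    = 1#
  sg (suc n) = - sg n
  F zero     = 1#
  F (suc n)  = (1# - P (suc n)) * F n
  E zero     = 1#
  E (suc n)  = (1# + P (suc n)) * E n

  -- The theta series 1 + 2 Σ (-1)ᵏ q^(k²), with 2 = -1.
  Θ : ℕ → Carrier
  Θ zero    = 1#
  Θ (suc n) = Θ n - sg (suc n) * P (suc n ℕ.* suc n)

  ρ : ℕ → ℕ → Carrier
  ρ s zero    = 1#
  ρ s (suc k) = ρ s k * ((1# - P (suc (k ℕ.+ s))) * j (suc (k ℕ.+ s)))

  ρ-left : ∀ s k → ρ s (suc k) ≈ (1# - P (suc s)) * j (suc s) * ρ (suc s) k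
  ρ-left s zero    = *-comm _ _
  ρ-left s (suc k) rewrite ℕₚ.+-suc k s = trans (*-congʳ (ρ-left s k)) (*-assoc _ _ _)

  -- The summand of Shanks' finite form of Gauss' theta identity.
  h : ℕ → ℕ → Carrier
  h k s = - (sg s * ρ s k * P (s ℕ.* suc (k ℕ.+ s)) * j s)

  -- Creative telescoping: raising k by one changes the summand by `lo k s - hi k s`, and
  -- `lo k (suc s)` equals `hi (suc k) s`. The sums for n + 1 and n therefore differ by two boundary
  -- terms, which `j N` = 1 / (1 + q^N) merges into the next theta term.
  shanks : ∀ n → conv n h ≈ Θ n
  shanks zero = begin
    - (1# * 1# * P 0 * j 0)
      ≈⟨ -‿cong (*-congʳ (*-congˡ P-0)) ⟩
    - (1# * 1# * 1# * j 0)
      -- The sign -1 is read as 2 = 1 + q⁰, which cancels `j 0`.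
      ≈⟨ solve 1 (λ j → :- (:1 :* :1 :* :1 :* j) := (:1 :+ :1) :* j) refl (j 0) ⟩
    (1# + 1#) * j 0  ≈⟨ *-congʳ (+-congˡ (sym P-0)) ⟩
    (1# + P 0) * j 0 ≈⟨ j-inv 0 ⟩
    1#               ∎
  shanks (suc n) = begin
    h 0 N + conv n (λ k s → h (suc k) s)
      ≈⟨ +-congˡ (conv-cong n difference) ⟩
    h 0 N + conv n (λ k s → h k s + (lo k s + - hi k s))
      ≈⟨ +-congˡ (trans (conv-+ n h _) (+-cong (shanks n) (trans (conv-+ n lo _) (+-congˡ (conv-- n hi))))) ⟩
    h 0 N + (Θ n + (conv n lo + - conv n hi))
      ≈⟨ +-congˡ (+-congˡ (telescope n ≡.refl)) ⟩
    h 0 N + (Θ n + - hi 0 n)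
      ≈⟨ +-congʳ (-‿cong (*-congʳ (*-congˡ
           (trans (reflexive (cong P (exponent₀ n))) (P-+ (N ℕ.* N) N))))) ⟩
    - (sg N * 1# * (P (N ℕ.* N) * P N) * j N) + (Θ n + - - (sg n * 1# * P (N ℕ.* N) * j N))
      ≈⟨ solve 5 (λ s a b j t →
           :- (:- s :* :1 :* (a :* b) :* j) :+ (t :+ :- (:- (s :* :1 :* a :* j)))
           := t :- :- s :* a :* ((:1 :+ b) :* j)) refl (sg n) (P (N ℕ.* N)) (P N) (j N) (Θ n) ⟩
    Θ n - sg N * P (N ℕ.* N) * ((1# + P N) * j N)
      ≈⟨ +-congˡ (-‿cong (trans (*-congˡ (j-inv N)) (*-identityʳ _))) ⟩
    Θ (suc n) ∎
    where
    N = suc n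
    lo hi : ℕ → ℕ → Carrier
    lo k s = sg s * ρ s k * P (s ℕ.* N) * ((1# - P s) * j s) * j N
    hi k s = - (sg s * ρ s k * P (suc s ℕ.* N) * j N)

    exponent₀ : ∀ n → suc n ℕ.* suc (suc n) ≡ suc n ℕ.* suc n ℕ.+ suc n
    exponent₀ = solve-∀

    exponent : ∀ k s → s ℕ.* suc (suc k ℕ.+ s) ≡ s ℕ.* suc (k ℕ.+ s) ℕ.+ s
    exponent = solve-∀

    difference : ∀ k s → k ℕ.+ s ≡ n → h (suc k) s ≈ h k s + (lo k s + - hi k s)
    difference k s ≡.refl = begin
      - (sg s * (ρ s k * ((1# - P N) * j N)) * P (s ℕ.* suc (suc k ℕ.+ s)) * j s)
        ≈⟨ -‿cong (*-congʳ (*-congˡ (trans (reflexive (cong P (exponent k s))) (P-+ (s ℕ.* N) s)))) ⟩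
      - (sg s * (ρ s k * ((1# - P N) * j N)) * (P (s ℕ.* N) * P s) * j s)
        ≈⟨ solve 7 (λ c p r b q j i →
             :- (c :* (r :* ((:1 :- b) :* j)) :* (p :* q) :* i)
             := :- (c :* r :* p :* i :* ((:1 :+ b) :* j))
                :+ (c :* r :* p :* ((:1 :- q) :* i) :* j :+ :- (:- (c :* r :* (b :* p) :* j :* ((:1 :+ q) :* i)))))
             refl (sg s) (P (s ℕ.* N)) (ρ s k) (P N) (P s) (j N) (j s) ⟩
      - (sg s * ρ s k * P (s ℕ.* N) * j s * ((1# + P N) * j N))
        + (lo k s + - - (sg s * ρ s k * (P N * P (s ℕ.* N)) * j N * ((1# + P s) * j s)))
        ≈⟨ +-cong (-‿cong (trans (*-congˡ (j-inv N)) (*-identityʳ _)))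
             (+-congˡ (-‿cong (-‿cong (trans (*-cong (*-congʳ (*-congˡ (sym (P-+ N _)))) (j-inv s))
               (*-identityʳ _))))) ⟩
      h k s + (lo k s + - hi k s) ∎

    lo-0 : ∀ k → lo k 0 ≈ 0#
    lo-0 k = trans (*-congʳ (trans (*-congˡ (trans
      (*-congʳ (trans (+-congˡ (-‿cong P-0)) (-‿inverseʳ _))) (zeroˡ _))) (zeroʳ _))) (zeroˡ _)

    lo-suc : ∀ k s → lo k (suc s) ≈ hi (suc k) s
    lo-suc k s = trans
      (solve 6 (λ c r p q i j → :- c :* r :* p :* (q :* i) :* j := :- (c :* (q :* i :* r) :* p :* j))
        refl (sg s) (ρ (suc s) k) (P (suc s ℕ.* N)) _ _ _)
      (-‿cong (*-congʳ (*-congʳ (*-congˡ (sym (ρ-left s k))))))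

    telescope : ∀ m → m ≡ n → conv m lo + - conv m hi ≈ - hi 0 m
    telescope zero    _ = trans (+-congʳ (lo-0 0)) (+-identityˡ _)
    telescope (suc m) _ = begin
      conv (suc m) lo + - (hi 0 (suc m) + conv m (λ k s → hi (suc k) s))
        ≈⟨ +-congʳ (trans (conv-last m lo) (+-cong (conv-cong m λ k s _ → lo-suc k s) (lo-0 (suc m)))) ⟩
      (conv m (λ k s → hi (suc k) s) + 0#) + - (hi 0 (suc m) + conv m (λ k s → hi (suc k) s))
        ≈⟨ solve 2 (λ c x → (c :+ :0) :+ :- (x :+ c) := :- x) refl _ _ ⟩
      - hi 0 (suc m) ∎

  ρ*E : ∀ n → ρ 0 n * E n ≈ F n
  ρ*E zero    = *-identityˡ _
  ρ*E (suc n) rewrite ℕₚ.+-identityʳ n = begin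
    ρ 0 n * ((1# - P (suc n)) * j (suc n)) * ((1# + P (suc n)) * E n)
      ≈⟨ solve 5 (λ r a j b e → r :* (a :* j) :* (b :* e) := (b :* j) :* (a :* (r :* e))) refl _ _ _ _ _ ⟩
    (1# + P (suc n)) * j (suc n) * ((1# - P (suc n)) * (ρ 0 n * E n))
      ≈⟨ *-cong (j-inv (suc n)) (*-congˡ (ρ*E n)) ⟩
    1# * F (suc n)  ≈⟨ *-identityˡ _ ⟩
    F (suc n)       ∎

  module Truncated (N : ℕ) (nil : VanishesAbove R N P) where

    -- For k + s = N the exponent s (N + 1) in `h k s` exceeds N unless s = 0, so Shanks' sum
    -- collapses to `ρ 0 N` = (q;q)_N / (-q;q)_N.
    gauss : Θ N * E N ≈ F N
    gauss = trans (*-congʳ (trans (sym (shanks N)) (first N ℕₚ.≤-refl))) (ρ*E N)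
      where
      vanish : ∀ k s → N ℕ.≤ k ℕ.+ suc s → h k (suc s) ≈ 0#
      vanish k s le = trans (-‿cong (trans (*-congʳ (trans (*-congˡ
        (nil _ (ℕₚ.≤-trans (ℕ.s≤s le) (ℕₚ.m≤m+n _ _)))) (zeroʳ _))) (zeroˡ _)))
        (solve 0 (:- :0 := :0) refl)

      h0 : ∀ n → h n 0 ≈ ρ 0 n
      h0 n = begin
        - (1# * ρ 0 n * P 0 * j 0)
          ≈⟨ -‿cong (*-congʳ (*-congˡ P-0)) ⟩
        - (1# * ρ 0 n * 1# * j 0)
          ≈⟨ solve 2 (λ r j → :- (:1 :* r :* :1 :* j) := r :* ((:1 :+ :1) :* j)) refl _ _ ⟩
        ρ 0 n * ((1# + 1#) * j 0)
          ≈⟨ *-congˡ (trans (*-congʳ (+-congˡ (sym P-0))) (j-inv 0)) ⟩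
        ρ 0 n * 1#  ≈⟨ *-identityʳ _ ⟩
        ρ 0 n       ∎

      first : ∀ n → N ℕ.≤ n → conv n h ≈ ρ 0 n
      first zero    le = h0 0
      first (suc n) le = begin
        conv (suc n) h  ≈⟨ conv-last n h ⟩
        conv n (λ k s → h k (suc s)) + h (suc n) 0
          ≈⟨ +-cong (conv-0 n λ k s e → vanish k s (ℕₚ.≤-trans le
               (ℕₚ.≤-reflexive (≡.trans (cong suc (≡.sym e)) (≡.sym (ℕₚ.+-suc k s)))))) (h0 (suc n)) ⟩
        0# + ρ 0 (suc n)  ≈⟨ +-identityˡ _ ⟩
        ρ 0 (suc n)       ∎

-- The relation between ξ and 1 / φ(-q) modulo q^(N+1).

-- Everything modulo q^(N+1): R stands for a ring in which Q m = q^m vanishes for m > N,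
-- w n = 1 / (1 - q^(n+1)) and j n = 1 / (1 + q^n).
module Truncation (R : CommutativeRing 0ℓ 0ℓ)
  (char3 : Char3 R)
  (Q : Sequence R) (Q-0 : UnitAt0 R Q) (Q-+ : Multiplicative R Q)
  (w : Sequence R) (w-inv : Inverse₋ R Q w)
  (j : Sequence R) (j-inv : Inverse₊ R Q j)
  (N : ℕ) (nil : VanishesAbove R N Q) where
  open CommutativeRing R
  open import Relation.Binary.Reasoning.Setoid setoid
  open Convolution R
  open Solver₃ R char3

  cube : Carrier → Carrier
  cube x = x * (x * x)

  cube-cong : ∀ {x y} → x ≈ y → cube x ≈ cube y
  cube-cong e = *-cong e (*-cong e e)

  conv-cube : ∀ n h → conv n (λ k r → cube (h k r)) ≈ cube (conv n h)
  conv-cube zero    h = refl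
  conv-cube (suc n) h = trans (+-congˡ (conv-cube n _))
    (solve 2 (λ x y → x :* (x :* x) :+ y :* (y :* y) := (x :+ y) :* ((x :+ y) :* (x :+ y))) refl _ _)

  Q-cong : ∀ {m n} → m ≡ n → Q m ≈ Q n
  Q-cong e = reflexive (cong Q e)

  inverse-unique : ∀ {x y z} → x * y ≈ 1# → x * z ≈ 1# → y ≈ z
  inverse-unique {x} {y} {z} xy xz = begin
    y            ≈⟨ *-identityʳ y ⟨
    y * 1#       ≈⟨ *-congˡ xz ⟨
    y * (x * z)  ≈⟨ solve 3 (λ x y z → y :* (x :* z) := x :* y :* z) refl x y z ⟩
    x * y * z    ≈⟨ *-congʳ xy ⟩
    1# * z       ≈⟨ *-identityˡ z ⟩
    z            ∎

  P₂ P₆ v₂ v₆ : ℕ → Carrier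
  P₂ e = Q (e ℕ.+ e)
  P₆ e = Q (6 ℕ.* e)
  v₂ n = w (n ℕ.+ suc n)
  v₆ n = cube (v₂ n)

  P₂-+ : ∀ m n → P₂ (m ℕ.+ n) ≈ P₂ m * P₂ n
  P₂-+ m n = trans (Q-cong (exponent m n)) (Q-+ _ _)
    where
    exponent : ∀ m n → (m ℕ.+ n) ℕ.+ (m ℕ.+ n) ≡ (m ℕ.+ m) ℕ.+ (n ℕ.+ n)
    exponent = solve-∀

  P₆-+ : ∀ m n → P₆ (m ℕ.+ n) ≈ P₆ m * P₆ n
  P₆-+ m n = trans (Q-cong (ℕₚ.*-distribˡ-+ 6 m n)) (Q-+ _ _)

  P₆-cube : ∀ e → P₆ e ≈ cube (P₂ e)
  P₆-cube e = trans (Q-cong (exponent e)) (trans (Q-+ (e ℕ.+ e) _) (*-congˡ (Q-+ _ _)))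
    where
    exponent : ∀ e → 6 ℕ.* e ≡ (e ℕ.+ e) ℕ.+ ((e ℕ.+ e) ℕ.+ (e ℕ.+ e))
    exponent = solve-∀

  cube-inv : ∀ p s → cube s ≈ p → ∀ x → (1# - s) * x ≈ 1# → (1# - p) * cube x ≈ 1#
  cube-inv p s e x sx = begin
    (1# - p) * cube x       ≈⟨ *-congʳ (+-congˡ (-‿cong (sym e))) ⟩
    (1# - cube s) * cube x
      ≈⟨ solve 2 (λ s x → (:1 :- s :* (s :* s)) :* (x :* (x :* x))
           := ((:1 :- s) :* x) :* (((:1 :- s) :* x) :* ((:1 :- s) :* x))) refl s x ⟩
    cube ((1# - s) * x)     ≈⟨ cube-cong sx ⟩
    cube 1#                 ≈⟨ solve 0 (:1 :* (:1 :* :1) := :1) refl ⟩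
    1#                      ∎

  v₆-inv : ∀ n → (1# - P₆ (suc n)) * v₆ n ≈ 1#
  v₆-inv n = cube-inv _ _ (sym (P₆-cube (suc n))) _ (w-inv (n ℕ.+ suc n))

  module B₂ = Bailey R char3 P₂ Q-0 P₂-+ v₂ (λ n → w-inv (n ℕ.+ suc n))
  module B₆ = Bailey R char3 P₆ Q-0 P₆-+ v₆ v₆-inv
  module G = Gauss R char3 Q Q-0 Q-+ j j-inv
  open G using (sg; Θ)

  F₆-cube : ∀ n → B₆.F n ≈ cube (B₂.F n)
  F₆-cube zero    = solve 0 (:1 := :1 :* (:1 :* :1)) refl
  F₆-cube (suc n) = trans (*-cong (+-congˡ (-‿cong (P₆-cube (suc n)))) (F₆-cube n))
    (solve 2 (λ p f → (:1 :- p :* (p :* p)) :* (f :* (f :* f))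
        := ((:1 :- p) :* f) :* (((:1 :- p) :* f) :* ((:1 :- p) :* f))) refl _ _)

  tri : ℕ → ℕ
  tri zero    = 0
  tri (suc r) = suc r ℕ.+ tri r

  tri+tri : ∀ r → tri r ℕ.+ tri r ≡ r ℕ.* r ℕ.+ r
  tri+tri zero    = ≡.refl
  tri+tri (suc r) = ≡.trans (step₁ r (tri r)) (≡.trans (cong (λ z → suc r ℕ.+ suc r ℕ.+ z) (tri+tri r)) (step₂ r))
    where
    step₁ : ∀ r t → suc r ℕ.+ t ℕ.+ (suc r ℕ.+ t) ≡ suc r ℕ.+ suc r ℕ.+ (t ℕ.+ t)
    step₁ = solve-∀
    step₂ : ∀ r → suc r ℕ.+ suc r ℕ.+ (r ℕ.* r ℕ.+ r) ≡ suc r ℕ.* suc r ℕ.+ suc r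
    step₂ = solve-∀

  t-closed : (P t : ℕ → Carrier) → P 0 ≈ 1# → (∀ m n → P (m ℕ.+ n) ≈ P m * P n) →
    t 0 ≈ 1# → (∀ r → t (suc r) ≈ - (P r * t r)) → ∀ r → t r * P r ≈ sg r * P (tri r)
  t-closed P t P0 P+ t0 ts zero    = *-congʳ t0
  t-closed P t P0 P+ t0 ts (suc r) = begin
    t (suc r) * P (suc r)      ≈⟨ *-congʳ (ts r) ⟩
    - (P r * t r) * P (suc r)  ≈⟨ solve 3 (λ p t q → :- (p :* t) :* q := :- (t :* p :* q)) refl _ _ _ ⟩
    - (t r * P r * P (suc r))  ≈⟨ -‿cong (*-congʳ (t-closed P t P0 P+ t0 ts r)) ⟩
    - (sg r * P (tri r) * P (suc r))
      ≈⟨ solve 3 (λ s p q → :- (s :* p :* q) := :- s :* (q :* p)) refl _ _ _ ⟩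
    - sg r * (P (suc r) * P (tri r))  ≈⟨ *-congˡ (sym (P+ _ _)) ⟩
    - sg r * P (tri (suc r))          ∎

  L : ℕ → Carrier
  L m = sg m * Q (m ℕ.* m ℕ.+ m) * (1# + Q (suc (m ℕ.+ m))) * w (m ℕ.+ m)

  sum-L : Carrier
  sum-L = conv N (λ _ r → L (r ℕ.* 3) + L (2 ℕ.+ r ℕ.* 3))

  sg-*3 : ∀ r → sg (r ℕ.* 3) ≈ sg r
  sg-*3 zero    = refl
  sg-*3 (suc r) = trans (-‿cong (-‿cong (-‿cong (sg-*3 r)))) (solve 1 (λ s → :- :- :- s := :- s) refl _)

  d₆ : ℕ → Carrier
  d₆ r = w (6 ℕ.* r) * w (4 ℕ.+ 6 ℕ.* r)

  d₆-inv : ∀ r → (1# - Q 1 * P₆ r) * (1# - Q 5 * P₆ r) * d₆ r ≈ 1#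
  d₆-inv r = begin
    (1# - Q 1 * P₆ r) * (1# - Q 5 * P₆ r) * d₆ r
      ≈⟨ *-congʳ (*-cong (+-congˡ (-‿cong (sym (Q-+ 1 _)))) (+-congˡ (-‿cong (sym (Q-+ 5 _))))) ⟩
    (1# - Q (1 ℕ.+ 6 ℕ.* r)) * (1# - Q (5 ℕ.+ 6 ℕ.* r)) * d₆ r
      ≈⟨ solve 4 (λ a b x y → a :* b :* (x :* y) := (a :* x) :* (b :* y)) refl _ _ _ _ ⟩
    (1# - Q (1 ℕ.+ 6 ℕ.* r)) * w (6 ℕ.* r) * ((1# - Q (5 ℕ.+ 6 ℕ.* r)) * w (4 ℕ.+ 6 ℕ.* r))
      ≈⟨ *-cong (w-inv _) (w-inv _) ⟩
    1# * 1#  ≈⟨ *-identityˡ _ ⟩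
    1#       ∎

  module PF₆ = B₆.PartialFractions (Q 1) (Q 5) (sym (Q-+ 1 5)) d₆ d₆-inv

  -- Since 2 = -1 and 6(n+1)² - 6(n+1) + 1 = 6(n² + n) + 1, the series ξ is the sum of q^(6(n²+n))
  -- `β̂ n`; the unit pair accounts for its leading 1, and `γ̂` is the other half of the Bailey
  -- pair.
  δ β̂ γ̂ : ℕ → Carrier
  δ zero    = 1#
  δ (suc n) = 0#
  β̂ n       = δ n - Q 1 * PF₆.β n
  γ̂ r       = B₆.u r * (1# - Q 1 * (P₆ r * d₆ r))

  ξ : Carrier
  ξ = conv N (λ _ n → P₆ (n ℕ.* n ℕ.+ n) * β̂ n)

  bailey-pair : ∀ n → β̂ n ≈ conv n (λ k r → B₆.a k r * γ̂ r)
  bailey-pair n = sym (begin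
    conv n (λ k r → B₆.a k r * γ̂ r)
      ≈⟨ conv-cong n (λ k r _ → solve 4 (λ a u q z → a :* (u :* (:1 :- q :* z))
           := a :* u :+ :- (q :* (a :* (u :* z)))) refl _ _ _ _) ⟩
    conv n (λ k r → B₆.a k r * B₆.u r + - (Q 1 * s k r))
      ≈⟨ trans (conv-+ n (λ k r → B₆.a k r * B₆.u r) (λ k r → - (Q 1 * s k r)))
           (+-congˡ (trans (conv-- n (λ k r → Q 1 * s k r)) (-‿cong (conv-*ˡ _ n s)))) ⟩
    conv n (λ k r → B₆.a k r * B₆.u r) - Q 1 * conv n s
      ≈⟨ +-cong (is-δ n) (-‿cong (*-congˡ (sym (PF₆.β≈conv n)))) ⟩
    β̂ n ∎)
    where
    s : ℕ → ℕ → Carrier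
    s k r = B₆.a k r * (B₆.u r * (P₆ r * d₆ r))
    is-δ : ∀ n → conv n (λ k r → B₆.a k r * B₆.u r) ≈ δ n
    is-δ zero    = B₆.unit₀
    is-δ (suc n) = B₆.unit n

  -- With A = q^(6r+1) and B = q^(6r+5), so that A B = q^(6(2r+1)), this is (1 - A B) (1 + A - B + A
  -- B) = (1 + A) (1 - B) + A B (1 + B) (1 - A) divided by (1 - A) (1 - B). The factor 1 + A - B + A
  -- B is (1 - A) (1 - B) - A because -2A = A.
  γ̂-split : ∀ r → P₆ (r ℕ.* r ℕ.+ r) * γ̂ r ≈ L (r ℕ.* 3) + L (2 ℕ.+ r ℕ.* 3)
  γ̂-split r = begin
    P₆ (r ℕ.* r ℕ.+ r) * (B₆.t r * (1# - P₆ (suc (r ℕ.+ r))) * (1# - Q 1 * (P₆ r * d₆ r)))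
      ≈⟨ *-cong (P₆-+ (r ℕ.* r) r) (*-cong (*-congˡ (+-congˡ (-‿cong (trans (Q-cong (e₁ r)) (Q-+ _ _)))))
           (+-cong (sym (trans (*-cong (w-inv _) (w-inv _)) (*-identityˡ _)))
             (-‿cong (trans (sym (*-assoc _ _ _)) (*-congʳ (sym (Q-+ 1 _))))))) ⟩
    P₆ (r ℕ.* r) * P₆ r * (B₆.t r * (1# - A * B)
      * ((1# - A) * wA * ((1# - B) * wB) - A * (wA * wB)))
      ≈⟨ solve 7 (λ p q t a b x y →
           p :* q :* (t :* (:1 :- a :* b) :* ((:1 :- a) :* x :* ((:1 :- b) :* y) :- a :* (x :* y)))
           := p :* (t :* q) :* ((:1 :+ a) :* x :* ((:1 :- b) :* y)
                :+ a :* b :* ((:1 :+ b) :* y :* ((:1 :- a) :* x))))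
           refl (P₆ (r ℕ.* r)) (P₆ r) (B₆.t r) A B wA wB ⟩
    P₆ (r ℕ.* r) * (B₆.t r * P₆ r)
      * ((1# + A) * wA * ((1# - B) * wB) + A * B * ((1# + B) * wB * ((1# - A) * wA)))
      ≈⟨ *-cong (*-congˡ (t-closed P₆ B₆.t Q-0 P₆-+ refl (λ _ → refl) r))
           (+-cong (trans (*-congˡ (w-inv _)) (*-identityʳ _))
             (*-congˡ (trans (*-congˡ (w-inv _)) (*-identityʳ _)))) ⟩
    P₆ (r ℕ.* r) * (sg r * P₆ (tri r)) * ((1# + A) * wA + A * B * ((1# + B) * wB))
      ≈⟨ solve 8 (λ p s t a b x y c → p :* (s :* t) :* ((:1 :+ a) :* x :+ c :* ((:1 :+ b) :* y))
           := s :* (p :* t) :* (:1 :+ a) :* x :+ s :* (p :* t :* c) :* (:1 :+ b) :* y)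
           refl (P₆ (r ℕ.* r)) (sg r) (P₆ (tri r)) A B wA wB (A * B) ⟩
    sg r * (P₆ (r ℕ.* r) * P₆ (tri r)) * (1# + A) * wA
      + sg r * (P₆ (r ℕ.* r) * P₆ (tri r) * (A * B)) * (1# + B) * wB
      ≈⟨ +-cong
           (*-cong (*-cong (*-cong (sym (sg-*3 r)) (trans (sym (Q-+ _ _)) (Q-cong e₃)))
             (+-congˡ (Q-cong (e₄ r)))) (reflexive (cong w (e₅ r))))
           (*-cong (*-cong (*-cong (trans (sym (sg-*3 r)) (solve 1 (λ s → s := :- :- s) refl _))
               (trans (*-cong (sym (Q-+ _ _)) (sym (Q-+ _ _))) (trans (sym (Q-+ _ _)) (Q-cong e₆))))
             (+-congˡ (Q-cong (e₇ r)))) (reflexive (cong w (e₈ r)))) ⟩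
    L (r ℕ.* 3) + L (2 ℕ.+ r ℕ.* 3) ∎
    where
    A B wA wB : Carrier
    A = Q (1 ℕ.+ 6 ℕ.* r)
    B = Q (5 ℕ.+ 6 ℕ.* r)
    wA = w (6 ℕ.* r)
    wB = w (4 ℕ.+ 6 ℕ.* r)
    e₁ : ∀ r → 6 ℕ.* suc (r ℕ.+ r) ≡ (1 ℕ.+ 6 ℕ.* r) ℕ.+ (5 ℕ.+ 6 ℕ.* r)
    e₁ = solve-∀
    e₂ : ∀ t → 6 ℕ.* t ≡ 3 ℕ.* (t ℕ.+ t)
    e₂ = solve-∀
    e₂′ : 6 ℕ.* tri r ≡ 3 ℕ.* (r ℕ.* r ℕ.+ r)
    e₂′ = ≡.trans (e₂ (tri r)) (cong (3 ℕ.*_) (tri+tri r))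
    e₃′ : ∀ r → 6 ℕ.* (r ℕ.* r) ℕ.+ 3 ℕ.* (r ℕ.* r ℕ.+ r) ≡ (r ℕ.* 3) ℕ.* (r ℕ.* 3) ℕ.+ r ℕ.* 3
    e₃′ = solve-∀
    e₃ : 6 ℕ.* (r ℕ.* r) ℕ.+ 6 ℕ.* tri r ≡ (r ℕ.* 3) ℕ.* (r ℕ.* 3) ℕ.+ r ℕ.* 3
    e₃ = ≡.trans (cong (6 ℕ.* (r ℕ.* r) ℕ.+_) e₂′) (e₃′ r)
    e₄ : ∀ r → 1 ℕ.+ 6 ℕ.* r ≡ suc (r ℕ.* 3 ℕ.+ r ℕ.* 3)
    e₄ = solve-∀
    e₅ : ∀ r → 6 ℕ.* r ≡ r ℕ.* 3 ℕ.+ r ℕ.* 3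
    e₅ = solve-∀
    e₆′ : ∀ r → 6 ℕ.* (r ℕ.* r) ℕ.+ 3 ℕ.* (r ℕ.* r ℕ.+ r) ℕ.+ ((1 ℕ.+ 6 ℕ.* r) ℕ.+ (5 ℕ.+ 6 ℕ.* r))
      ≡ (2 ℕ.+ r ℕ.* 3) ℕ.* (2 ℕ.+ r ℕ.* 3) ℕ.+ (2 ℕ.+ r ℕ.* 3)
    e₆′ = solve-∀
    e₆ : 6 ℕ.* (r ℕ.* r) ℕ.+ 6 ℕ.* tri r ℕ.+ ((1 ℕ.+ 6 ℕ.* r) ℕ.+ (5 ℕ.+ 6 ℕ.* r))
      ≡ (2 ℕ.+ r ℕ.* 3) ℕ.* (2 ℕ.+ r ℕ.* 3) ℕ.+ (2 ℕ.+ r ℕ.* 3)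
    e₆ = ≡.trans (cong (λ z → 6 ℕ.* (r ℕ.* r) ℕ.+ z ℕ.+ ((1 ℕ.+ 6 ℕ.* r) ℕ.+ (5 ℕ.+ 6 ℕ.* r))) e₂′) (e₆′ r)
    e₇ : ∀ r → 5 ℕ.+ 6 ℕ.* r ≡ suc (2 ℕ.+ r ℕ.* 3 ℕ.+ (2 ℕ.+ r ℕ.* 3))
    e₇ = solve-∀
    e₈ : ∀ r → 4 ℕ.+ 6 ℕ.* r ≡ 2 ℕ.+ r ℕ.* 3 ℕ.+ (2 ℕ.+ r ℕ.* 3)
    e₈ = solve-∀

  nil₆ : ∀ m → N ℕ.< m → P₆ m ≈ 0#
  nil₆ m lt = nil _ (ℕₚ.≤-trans lt (ℕₚ.m≤n*m m 6))

  F₆*ξ : B₆.F N * ξ ≈ sum-L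
  F₆*ξ = trans (B₆.Truncated.bailey-limit N nil₆ β̂ γ̂ bailey-pair) (conv-cong N λ _ r _ → γ̂-split r)

  d₂ : ℕ → Carrier
  d₂ r = w (r ℕ.+ r) * w (r ℕ.+ r)

  w-odd : ∀ r → (1# - Q 1 * P₂ r) * w (r ℕ.+ r) ≈ 1#
  w-odd r = trans (*-congʳ (+-congˡ (-‿cong (sym (Q-+ 1 _))))) (w-inv _)

  d₂-inv : ∀ r → (1# - Q 1 * P₂ r) * (1# - Q 1 * P₂ r) * d₂ r ≈ 1#
  d₂-inv r = begin
    (1# - Q 1 * P₂ r) * (1# - Q 1 * P₂ r) * d₂ r
      ≈⟨ solve 2 (λ a x → a :* a :* (x :* x) := (a :* x) :* (a :* x)) refl _ _ ⟩
    (1# - Q 1 * P₂ r) * w (r ℕ.+ r) * ((1# - Q 1 * P₂ r) * w (r ℕ.+ r))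
      ≈⟨ *-cong (w-odd r) (w-odd r) ⟩
    1# * 1#  ≈⟨ *-identityˡ _ ⟩
    1#       ∎

  module PF₂ = B₂.PartialFractions (Q 1) (Q 1) (sym (Q-+ 1 1)) d₂ d₂-inv

  -- This bound makes the indices 0, ..., M fall into three full classes modulo 3, each with r ≤ N,
  -- to match `sum-L`.
  M : ℕ
  M = 2 ℕ.+ N ℕ.* 3

  N≤M : N ℕ.≤ M
  N≤M = ℕₚ.≤-trans (ℕₚ.m≤m*n N 3) (ℕₚ.m≤n+m _ 2)

  nil₂ : ∀ m → M ℕ.< m → P₂ m ≈ 0#
  nil₂ m lt = nil _ (ℕₚ.≤-trans (ℕₚ.≤-<-trans N≤M lt) (ℕₚ.m≤m+n m m))

  L-γ : ∀ r → P₂ r * (B₂.u r * d₂ r) ≈ L r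
  L-γ r = begin
    P₂ r * (B₂.t r * (1# - P₂ (suc (r ℕ.+ r))) * (x * x))
      ≈⟨ *-congˡ (*-congʳ (*-congˡ (+-congˡ (-‿cong (Q-+ c c))))) ⟩
    P₂ r * (B₂.t r * (1# - C * C) * (x * x))
      ≈⟨ solve 4 (λ p t c x → p :* (t :* (:1 :- c :* c) :* (x :* x))
           := (t :* p) :* (:1 :+ c) :* x :* ((:1 :- c) :* x)) refl _ _ _ _ ⟩
    B₂.t r * P₂ r * (1# + C) * x * ((1# - C) * x)
      ≈⟨ trans (*-congˡ (w-inv _)) (*-identityʳ _) ⟩
    B₂.t r * P₂ r * (1# + C) * x
      ≈⟨ *-congʳ (*-congʳ (trans (t-closed P₂ B₂.t Q-0 P₂-+ refl (λ _ → refl) r)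
           (*-congˡ (Q-cong (tri+tri r))))) ⟩
    L r ∎
    where
    c = suc (r ℕ.+ r)
    C = Q c
    x = w (r ℕ.+ r)

  -- The partial fraction pair with x = y = q already carries the weight q^(2r) that `conv-limit`
  -- asks for, so the limit is taken in the pair itself.
  F₂²β : B₂.F M * B₂.F M * PF₂.β M ≈ conv M (λ _ r → L r)
  F₂²β = trans (*-congˡ (trans (PF₂.β≈conv M) (conv-cong M λ k r _ →
      solve 4 (λ a u p d → a :* (u :* (p :* d)) := a :* (p :* (u :* d))) refl (B₂.a k r) (B₂.u r) (P₂ r) (d₂ r))))
    (trans (B₂.Truncated.conv-limit M nil₂ (λ r → B₂.u r * d₂ r)) (conv-cong M λ _ r _ → L-γ r))

  L₁ : ℕ → Carrier
  L₁ r = sg r * Q (3 ℕ.* (r ℕ.* r) ℕ.+ 3 ℕ.* r) * (1# + Q (suc (r ℕ.+ r))) * w (r ℕ.+ r)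

  Q-cube : ∀ m → cube (Q m) ≈ Q (m ℕ.+ (m ℕ.+ m))
  Q-cube m = sym (trans (Q-+ m _) (*-congˡ (Q-+ m m)))

  w-cube : ∀ m n → suc n ℕ.+ (suc n ℕ.+ suc n) ≡ suc m → w m ≈ cube (w n)
  w-cube m n e = inverse-unique (w-inv m)
    (cube-inv _ _ (trans (Q-cube (suc n)) (Q-cong e)) _ (w-inv n))

  sg-cube : ∀ r → sg r ≈ cube (sg r)
  sg-cube zero    = solve 0 (:1 := :1 :* (:1 :* :1)) refl
  sg-cube (suc r) = trans (-‿cong (sg-cube r))
    (solve 1 (λ s → :- (s :* (s :* s)) := :- s :* (:- s :* :- s)) refl _)

  -- For m = 3r + 1 both m² + m - 2 = 3 (3r² + 3r) and 2m + 1 = 3 (2r + 1) are multiples of 3. As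
  -- cubing is additive, these terms add up to -q² times a cube, confined to exponents 2 mod 3.
  L-cube : ∀ r → L (1 ℕ.+ r ℕ.* 3) ≈ - Q 2 * cube (L₁ r)
  L-cube r = begin
    - sg (r ℕ.* 3) * Q (m ℕ.* m ℕ.+ m) * (1# + Q (suc (m ℕ.+ m))) * w (m ℕ.+ m)
      ≈⟨ *-cong (*-cong (*-cong (-‿cong (trans (sg-*3 r) (sg-cube r)))
           (trans (Q-cong (e₁ r)) (trans (Q-+ 2 _) (*-congˡ (sym (Q-cube x))))))
           (+-congˡ (trans (Q-cong (e₂ r)) (sym (Q-cube (suc (r ℕ.+ r)))))))
           (w-cube (m ℕ.+ m) (r ℕ.+ r) (e₃ r)) ⟩
    - cube (sg r) * (Q 2 * cube (Q x)) * (1# + cube (Q (suc (r ℕ.+ r)))) * cube (w (r ℕ.+ r))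
      ≈⟨ solve 5 (λ s q a b c → :- (s :* (s :* s)) :* (q :* (a :* (a :* a))) :* (:1 :+ b :* (b :* b)) :* (c :* (c :* c))
           := :- q :* ((s :* a :* (:1 :+ b) :* c) :* ((s :* a :* (:1 :+ b) :* c) :* (s :* a :* (:1 :+ b) :* c))))
           refl (sg r) (Q 2) (Q x) _ _ ⟩
    - Q 2 * cube (L₁ r) ∎
    where
    m = 1 ℕ.+ r ℕ.* 3
    x = 3 ℕ.* (r ℕ.* r) ℕ.+ 3 ℕ.* r
    e₁ : ∀ r → (1 ℕ.+ r ℕ.* 3) ℕ.* (1 ℕ.+ r ℕ.* 3) ℕ.+ (1 ℕ.+ r ℕ.* 3)
      ≡ 2 ℕ.+ ((3 ℕ.* (r ℕ.* r) ℕ.+ 3 ℕ.* r)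
        ℕ.+ ((3 ℕ.* (r ℕ.* r) ℕ.+ 3 ℕ.* r) ℕ.+ (3 ℕ.* (r ℕ.* r) ℕ.+ 3 ℕ.* r)))
    e₁ = solve-∀
    e₂ : ∀ r → suc (1 ℕ.+ r ℕ.* 3 ℕ.+ (1 ℕ.+ r ℕ.* 3))
      ≡ suc (r ℕ.+ r) ℕ.+ (suc (r ℕ.+ r) ℕ.+ suc (r ℕ.+ r))
    e₂ = solve-∀
    e₃ : ∀ r → suc (r ℕ.+ r) ℕ.+ (suc (r ℕ.+ r) ℕ.+ suc (r ℕ.+ r))
      ≡ suc (1 ℕ.+ r ℕ.* 3 ℕ.+ (1 ℕ.+ r ℕ.* 3))
    e₃ = solve-∀

  sum-by-threes : ∀ n (f : ℕ → Carrier) → conv (2 ℕ.+ n ℕ.* 3) (λ _ r → f r)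
    ≈ conv n (λ _ r → f (r ℕ.* 3) + f (2 ℕ.+ r ℕ.* 3)) + conv n (λ _ r → f (1 ℕ.+ r ℕ.* 3))
  sum-by-threes zero    f = solve 3 (λ x y z → z :+ (y :+ x) := (x :+ z) :+ y) refl _ _ _
  sum-by-threes (suc n) f = trans (+-congˡ (+-congˡ (+-congˡ (sum-by-threes n f))))
    (solve 5 (λ x y z s t → z :+ (y :+ (x :+ (s :+ t))) := ((x :+ z) :+ s) :+ (y :+ t)) refl _ _ _ _ _)

  sum-L₁ : Carrier
  sum-L₁ = conv N (λ _ r → L₁ r)

  F₂²β-split : B₂.F M * B₂.F M * PF₂.β M ≈ sum-L + - Q 2 * cube sum-L₁
  F₂²β-split = trans F₂²β (trans (sum-by-threes N L) (+-congˡ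
    (trans (conv-cong N λ _ r _ → L-cube r) (trans (conv-*ˡ _ N (λ _ r → cube (L₁ r)))
      (*-congˡ (conv-cube N (λ _ → L₁)))))))

  X : ℕ → Carrier
  X zero    = 1#
  X (suc n) = (1# - Q (suc (n ℕ.+ n))) * X n

  E*F : ∀ n → G.E n * G.F n ≈ B₂.F n
  E*F zero    = *-identityˡ _
  E*F (suc n) = trans
    (solve 3 (λ q e f → ((:1 :+ q) :* e) :* ((:1 :- q) :* f) := (:1 :- q :* q) :* (e :* f)) refl _ _ _)
    (*-cong (+-congˡ (-‿cong (sym (Q-+ _ _)))) (E*F n))

  F-double : ∀ n → G.F (n ℕ.+ n) ≈ X n * B₂.F n
  F-double zero = sym (*-identityˡ _)
  F-double (suc n) rewrite ℕₚ.+-suc n n = trans (*-congˡ (*-congˡ (F-double n)))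
    (solve 4 (λ p q x f → p :* (q :* (x :* f)) := (q :* x) :* (p :* f)) refl _ _ _ _)

  β*X² : ∀ n → PF₂.β n * (X (suc n) * X (suc n)) ≈ 1#
  β*X² zero = begin
    x * x * ((1# - Q 1) * 1# * ((1# - Q 1) * 1#))
      ≈⟨ solve 2 (λ x q → x :* x :* (q :* :1 :* (q :* :1)) := (q :* x) :* (q :* x)) refl _ _ ⟩
    (1# - Q 1) * x * ((1# - Q 1) * x)  ≈⟨ *-cong (w-inv 0) (w-inv 0) ⟩
    1# * 1#                            ≈⟨ *-identityˡ _ ⟩
    1#                                 ∎
    where x = w 0
  β*X² (suc n) = begin
    x * x * PF₂.β n * (q * X (suc n) * (q * X (suc n)))
      ≈⟨ solve 4 (λ x q b z → x :* x :* b :* (q :* z :* (q :* z)) := (q :* x) :* (q :* x) :* (b :* (z :* z)))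
           refl _ _ _ _ ⟩
    q * x * (q * x) * (PF₂.β n * (X (suc n) * X (suc n)))
      ≈⟨ *-cong (*-cong (w-inv _) (w-inv _)) (β*X² n) ⟩
    1# * 1# * 1#  ≈⟨ trans (*-identityʳ _) (*-identityˡ _) ⟩
    1#            ∎
    where
    x = w (suc n ℕ.+ suc n)
    q = 1# - Q (suc (suc n ℕ.+ suc n))

  stable : (p f : ℕ → Carrier) → (∀ n → f (suc n) ≈ (1# - p (suc n)) * f n) →
    (∀ m → N ℕ.< m → p m ≈ 0#) → ∀ {n} → N ℕ.≤ n → f n ≈ f N
  stable p f step p≈0 le = go (ℕₚ.≤⇒≤′ le)
    where
    go : ∀ {n} → N ℕ.≤′ n → f n ≈ f N
    go (ℕ.≤′-reflexive ≡.refl) = refl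
    go {suc n} (ℕ.≤′-step le) = begin
      f (suc n)                ≈⟨ step n ⟩
      (1# - p (suc n)) * f n   ≈⟨ *-cong (+-congˡ (-‿cong (p≈0 _ (ℕ.s≤s (ℕₚ.≤′⇒≤ le))))) (go le) ⟩
      (1# - 0#) * f N          ≈⟨ solve 1 (λ x → (:1 :- :0) :* x := x) refl _ ⟩
      f N                      ∎

  stable₁ : ∀ {n} → N ℕ.≤ n → G.F n ≈ G.F N
  stable₁ = stable Q G.F (λ _ → refl) nil

  stable₂ : ∀ {n} → N ℕ.≤ n → B₂.F n ≈ B₂.F N
  stable₂ = stable P₂ B₂.F (λ _ → refl) (λ m lt → nil _ (ℕₚ.≤-trans lt (ℕₚ.m≤m+n m m)))

  -- Multiply `gauss` by (q;q): on the left (-q;q) (q;q) becomes (q²;q²), on the right (q;q) =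
  -- (q;q²) (q²;q²) is squared; then one (q²;q²) cancels.
  Θ-product : ∀ {n} → N ℕ.≤ n → Θ N ≈ X n * X n * B₂.F n
  Θ-product {n} le = begin
    Θ N                          ≈⟨ *-identityʳ _ ⟨
    Θ N * 1#                     ≈⟨ *-congˡ (B₂.F*I N) ⟨
    Θ N * (B₂.F N * B₂.I N)      ≈⟨ *-congˡ (*-congʳ (E*F N)) ⟨
    Θ N * (G.E N * G.F N * B₂.I N)
      ≈⟨ solve 4 (λ t e f i → t :* (e :* f :* i) := (t :* e) :* f :* i) refl _ _ _ _ ⟩
    Θ N * G.E N * G.F N * B₂.I N
      ≈⟨ *-congʳ (*-cong (trans (G.Truncated.gauss N nil) F≈) F≈) ⟩
    X n * B₂.F n * (X n * B₂.F n) * B₂.I N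
      ≈⟨ solve 3 (λ x f i → x :* f :* (x :* f) :* i := x :* x :* f :* (f :* i)) refl _ _ _ ⟩
    X n * X n * B₂.F n * (B₂.F n * B₂.I N)
      ≈⟨ trans (*-congˡ (trans (*-congʳ (stable₂ le)) (B₂.F*I N))) (*-identityʳ _) ⟩
    X n * X n * B₂.F n ∎
    where
    F≈ : G.F N ≈ X n * B₂.F n
    F≈ = trans (sym (stable₁ (ℕₚ.≤-trans le (ℕₚ.m≤m+n n n)))) (F-double n)

  -- Eliminating `sum-L` between `F₆*ξ` and `F₂²β-split`, with (q⁶;q⁶) = (q²;q²)³, leaves β /
  -- (q²;q²) in the bracket, which is inverse to φ(-q) = X² (q²;q²). Here X is taken at M + 1, since
  -- `PF₂.β M` has the M + 1 factors 0, ..., M.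
  Θ*ξ : Θ N * (ξ - Q 2 * cube (B₂.I N * sum-L₁)) ≈ 1#
  Θ*ξ = begin
    Θ N * (ξ - Q 2 * cube (i * m))
      ≈⟨ *-congˡ (+-congʳ (trans (sym (*-identityˡ _)) (*-congʳ (trans (sym cube-1) (cube-cong (sym gi)))))) ⟩
    Θ N * (cube (g * i) * ξ - Q 2 * cube (i * m))
      ≈⟨ solve 6 (λ t g i x q m → t :* (((g :* i) :* ((g :* i) :* (g :* i))) :* x :- q :* ((i :* m) :* ((i :* m) :* (i :* m))))
           := t :* (i :* (i :* i)) :* ((g :* (g :* g)) :* x :+ :- q :* (m :* (m :* m)))) refl (Θ N) g i ξ (Q 2) m ⟩
    Θ N * cube i * (cube g * ξ + - Q 2 * cube m)
      ≈⟨ *-cong (*-congʳ (trans (Θ-product (ℕₚ.m≤n⇒m≤1+n N≤M))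
             (*-congˡ (stable₂ (ℕₚ.m≤n⇒m≤1+n N≤M)))))
           (trans (+-congʳ (trans (*-congʳ (sym (F₆-cube N))) F₆*ξ))
             (trans (sym F₂²β-split) (*-congʳ (*-cong (stable₂ N≤M) (stable₂ N≤M))))) ⟩
    (x * x * g) * cube i * (g * g * b)
      ≈⟨ solve 4 (λ x g i b → (x :* x :* g) :* (i :* (i :* i)) :* (g :* g :* b)
           := ((g :* i) :* ((g :* i) :* (g :* i))) :* (b :* (x :* x))) refl _ _ _ _ ⟩
    cube (g * i) * (b * (x * x))
      ≈⟨ *-cong (trans (cube-cong gi) cube-1) (β*X² M) ⟩
    1# * 1#  ≈⟨ *-identityˡ _ ⟩
    1#       ∎
    where
    g = B₂.F N
    i = B₂.I N
    m = sum-L₁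
    x = X (suc M)
    b = PF₂.β M
    gi : g * i ≈ 1#
    gi = B₂.F*I N
    cube-1 : cube 1# ≈ 1#
    cube-1 = solve 0 (:1 :* (:1 :* :1) := :1) refl

-- Power series over F₃, exact and truncated.

PS : Set
PS = ℕ → F₃

-- The coefficient of q^m in a product involves only coefficients of index at most m, so agreement
-- on a downward closed set of exponents is a ring congruence.
record DownSet : Set₁ where
  field
    _∋_  : ℕ → Set
    down : ∀ {k m} → k ℕ.≤ m → _∋_ m → _∋_ k
open DownSet using (_∋_)

everything : DownSet
everything = record { _∋_ = λ _ → ⊤ ; down = λ _ _ → tt }

upTo : ℕ → DownSet
upTo N = record { _∋_ = ℕ._≤ N ; down = ℕₚ.≤-trans }

-- For D = upTo N this is congruence modulo q^(N+1).
record _≈[_]_ (f : PS) (D : DownSet) (g : PS) : Set where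
  constructor mk≈
  field at : ∀ m → D ∋ m → f m ≡ g m
open _≈[_]_ public

module PS where
  open Convolution F₃.ring

  infixl 6 _+_
  infixl 7 _*_
  opaque
    _+_ _*_ : PS → PS → PS
    (f + g) m = f m F₃.+ g m
    (f * g) m = conv m (λ k r → f k F₃.* g r)

    -_ : PS → PS
    (- f) m = F₃.- f m

    const : F₃ → PS
    const c zero    = c
    const c (suc m) = F₃.0#

    shift : PS → PS
    shift f zero    = F₃.0#
    shift f (suc m) = f m

  tail : PS → PS
  tail f m = f (suc m)

  mon : ℕ → PS
  mon zero    = const F₃.1#
  mon (suc m) = shift (mon m)

  opaque
    unfolding _+_

    +-at : ∀ f g m → (f + g) m ≡ f m F₃.+ g m
    +-at f g m = ≡.refl

    *-at : ∀ f g m → (f * g) m ≡ conv m (λ k r → f k F₃.* g r)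
    *-at f g m = ≡.refl

    neg-at : ∀ f m → (- f) m ≡ F₃.- f m
    neg-at f m = ≡.refl

    const-0 : ∀ c → const c 0 ≡ c
    const-0 c = ≡.refl

    const-suc : ∀ c m → const c (suc m) ≡ F₃.0#
    const-suc c m = ≡.refl

    shift-0 : ∀ f → shift f 0 ≡ F₃.0#
    shift-0 f = ≡.refl

    shift-suc : ∀ f m → shift f (suc m) ≡ f m
    shift-suc f m = ≡.refl

    private
      zero-at : ∀ m → const F₃.0# m ≡ F₃.0#
      zero-at zero    = ≡.refl
      zero-at (suc m) = ≡.refl

    const-* : ∀ c f m → (const c * f) m ≡ c F₃.* f m
    const-* c f zero    = ≡.refl
    const-* c f (suc m) = ≡.trans (cong (c F₃.* f (suc m) F₃.+_) (conv-0 m (λ _ _ _ → ≡.refl)))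
      (F₃.+-identityʳ _)

    *-comm-at : ∀ f g m → (f * g) m ≡ (g * f) m
    *-comm-at f g m = ≡.trans (conv-comm m _) (conv-cong m λ k r _ → F₃.*-comm (f r) (g k))

    private
      *-assoc-at : ∀ f g h m → ((f * g) * h) m ≡ (f * (g * h)) m
      *-assoc-at f g h m = begin
        conv m (λ s j → conv s (λ k i → f k F₃.* g i) F₃.* h j)
          ≡⟨ conv-cong m (λ s j _ → conv-*ʳ (h j) s _) ⟨
        conv m (λ s j → conv s (λ k i → f k F₃.* g i F₃.* h j))
          ≡⟨ conv-assoc m (λ k i j → f k F₃.* g i F₃.* h j) ⟩
        conv m (λ k s → conv s (λ i j → f k F₃.* g i F₃.* h j))
          ≡⟨ conv-cong m (λ k s _ → ≡.trans
               (conv-cong s λ i j _ → F₃.*-assoc (f k) (g i) (h j)) (conv-*ˡ (f k) s _)) ⟩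
        conv m (λ k s → f k F₃.* conv s (λ i j → g i F₃.* h j)) ∎
        where open ≡.≡-Reasoning

      distribˡ-at : ∀ f g h m → (f * (g + h)) m ≡ ((f * g) + (f * h)) m
      distribˡ-at f g h m = ≡.trans
        (conv-cong m λ k r _ → F₃.*-distribˡ-+ (f k) (g r) (h r)) (conv-+ m _ _)

    isRing : ∀ D → IsCommutativeRing _≈[ D ]_ _+_ _*_ -_ (const F₃.0#) (const F₃.1#)
    isRing D = record
      { isRing = record
        { +-isAbelianGroup = record
          { isGroup = record
            { isMonoid = record
              { isSemigroup = record
                { isMagma = record
                  { isEquivalence = record
                    { refl  = mk≈ λ _ _ → ≡.refl
                    ; sym   = λ e → mk≈ λ m d → ≡.sym (at e m d)
                    ; trans = λ e e′ → mk≈ λ m d → ≡.trans (at e m d) (at e′ m d) }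
                  ; ∙-cong = λ e e′ → mk≈ λ m d → cong₂ F₃._+_ (at e m d) (at e′ m d) }
                ; assoc = λ f g h → mk≈ λ m _ → F₃.+-assoc (f m) (g m) (h m) }
              ; identity = (λ f → mk≈ λ m _ → ≡.trans (cong (F₃._+ f m) (zero-at m)) (F₃.+-identityˡ (f m)))
                         , (λ f → mk≈ λ m _ → ≡.trans (cong (f m F₃.+_) (zero-at m)) (F₃.+-identityʳ (f m))) }
            ; inverse = (λ f → mk≈ λ m _ → ≡.trans (F₃.-‿inverseˡ (f m)) (≡.sym (zero-at m)))
                      , (λ f → mk≈ λ m _ → ≡.trans (F₃.-‿inverseʳ (f m)) (≡.sym (zero-at m)))
            ; ⁻¹-cong = λ e → mk≈ λ m d → cong F₃.-_ (at e m d) }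
          ; comm = λ f g → mk≈ λ m _ → F₃.+-comm (f m) (g m) }
        ; *-cong = λ e e′ → mk≈ λ m d → conv-cong m λ k r k+r≡m → cong₂ F₃._*_
            (at e k (DownSet.down D (ℕₚ.≤-trans (ℕₚ.m≤m+n k r) (ℕₚ.≤-reflexive k+r≡m)) d))
            (at e′ r (DownSet.down D (ℕₚ.≤-trans (ℕₚ.m≤n+m r k) (ℕₚ.≤-reflexive k+r≡m)) d))
        ; *-assoc = λ f g h → mk≈ λ m _ → *-assoc-at f g h m
        ; *-identity = (λ f → mk≈ λ m _ → ≡.trans (const-* F₃.1# f m) (F₃.*-identityˡ (f m)))
                     , (λ f → mk≈ λ m _ → ≡.trans (*-comm-at f _ m)
                          (≡.trans (const-* F₃.1# f m) (F₃.*-identityˡ (f m))))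
        ; distrib = (λ f g h → mk≈ λ m _ → distribˡ-at f g h m)
                  , (λ f g h → mk≈ λ m _ → ≡.trans (*-comm-at (g + h) f m) (≡.trans (distribˡ-at f g h m)
                      (cong₂ F₃._+_ (*-comm-at f g m) (*-comm-at f h m))))
        }
      ; *-comm = λ f g → mk≈ λ m _ → *-comm-at f g m
      }

    char3-at : ∀ m → (const F₃.1# + (const F₃.1# + const F₃.1#)) m ≡ const F₃.0# m
    char3-at zero    = ≡.refl
    char3-at (suc m) = ≡.refl

    const-shift : ∀ f m → f m ≡ (const (f 0) + shift (tail f)) m
    const-shift f zero    = ≡.sym (F₃.+-identityʳ (f 0))
    const-shift f (suc m) = ≡.sym (F₃.+-identityˡ (f (suc m)))

    shift-* : ∀ f g m → (shift f * g) m ≡ shift (f * g) m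
    shift-* f g zero    = ≡.refl
    shift-* f g (suc m) = F₃.+-identityˡ _

    const-homo-* : ∀ a b m → (const a * const b) m ≡ const (a F₃.* b) m
    const-homo-* a b zero    = ≡.refl
    const-homo-* a b (suc m) = ≡.trans (const-* a (const b) (suc m)) (F₃.*-comm a F₃.0#)

  ring : DownSet → CommutativeRing 0ℓ 0ℓ
  ring D = record { isCommutativeRing = isRing D }

  char3 : ∀ D → (const F₃.1# + (const F₃.1# + const F₃.1#)) ≈[ D ] const F₃.0#
  char3 D = mk≈ λ m _ → char3-at m

  module Calculus (D : DownSet) where
    open CommutativeRing (ring D) public hiding (_+_; _*_; -_; ring)
    open import Relation.Binary.Reasoning.Setoid setoid public
    open Solver₃ (ring D) (char3 D) public

  exact : ∀ {f g} → (∀ m → f m ≡ g m) → ∀ {D} → f ≈[ D ] g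
  exact e = mk≈ λ m _ → e m

  weaken : ∀ {f g} → f ≈[ everything ] g → ∀ {D} → f ≈[ D ] g
  weaken e = mk≈ λ m _ → at e m tt

  by-truncation : ∀ {f g} → (∀ N → f ≈[ upTo N ] g) → f ≈[ everything ] g
  by-truncation e = mk≈ λ m _ → at (e m) m ℕₚ.≤-refl

  mon-0 : ∀ {D} → mon 0 ≈[ D ] const F₃.1#
  mon-0 = mk≈ λ _ _ → ≡.refl

  mon-+ : ∀ {D} m n → mon (m ℕ.+ n) ≈[ D ] (mon m * mon n)
  mon-+ m n = exact (go m)
    where
    go : ∀ m k → mon (m ℕ.+ n) k ≡ (mon m * mon n) k
    go zero    k = ≡.sym (≡.trans (const-* F₃.1# (mon n) k) (F₃.*-identityˡ _))
    go (suc m) zero = ≡.trans (shift-0 _) (≡.sym (≡.trans (shift-* (mon m) (mon n) 0) (shift-0 _)))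
    go (suc m) (suc k) = ≡.trans (shift-suc _ k) (≡.trans (go m k)
      (≡.sym (≡.trans (shift-* (mon m) (mon n) (suc k)) (shift-suc _ k))))

  mon-< : ∀ m k → k ℕ.< m → mon m k ≡ F₃.0#
  mon-< (suc m) zero    lt         = shift-0 _
  mon-< (suc m) (suc k) (ℕ.s≤s lt) = ≡.trans (shift-suc _ k) (mon-< m k lt)

  mon-nil : ∀ N m → N ℕ.< m → mon m ≈[ upTo N ] const F₃.0#
  mon-nil N m lt = mk≈ λ k le → ≡.trans (mon-< m k (ℕₚ.≤-<-trans le lt)) (≡.sym (zero-coef k))
    where
    zero-coef : ∀ k → const F₃.0# k ≡ F₃.0#
    zero-coef zero    = const-0 _
    zero-coef (suc k) = const-suc _ k

  shift-cong : ∀ {f g} N → f ≈[ upTo N ] g → shift f ≈[ upTo (suc N) ] shift g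
  shift-cong {f} {g} N e = mk≈ λ where
    zero    _          → ≡.trans (shift-0 f) (≡.sym (shift-0 g))
    (suc m) (ℕ.s≤s le) → ≡.trans (shift-suc f m) (≡.trans (at e m le) (≡.sym (shift-suc g m)))

  -- The diagonal is the limit of sequences whose coefficient of q^m no longer changes from index m
  -- on.
  lim : (ℕ → PS) → PS
  lim s m = s m m

  lim-≈ : ∀ s → (∀ n → s (suc n) ≈[ upTo n ] s n) → ∀ N → lim s ≈[ upTo N ] s N
  lim-≈ s step N = mk≈ λ m le → ≡.sym (go m (ℕₚ.≤⇒≤′ le))
    where
    go : ∀ m {n} → m ℕ.≤′ n → s n m ≡ s m m
    go m (ℕ.≤′-reflexive ≡.refl) = ≡.refl
    go m (ℕ.≤′-step le)          = ≡.trans (at (step _) m (ℕₚ.≤′⇒≤ le)) (go m le)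

  -- With c = f 0 = ±1, the inverse of f = c + q f′ is the fixed point of x ↦ c (1 - q f′ x).
  inv-approx : PS → ℕ → PS
  inv-approx f zero    = const (f 0)
  inv-approx f (suc n) = const (f 0) * (const F₃.1# + - shift (tail f * inv-approx f n))

  inv : PS → PS
  inv f = lim (inv-approx f)

  inv-step : ∀ f n → inv-approx f (suc n) ≈[ upTo n ] inv-approx f n
  inv-step f zero = mk≈ go
    where
    open ≡.≡-Reasoning
    h = tail f * const (f 0)
    go : ∀ m → m ℕ.≤ 0 → inv-approx f 1 m ≡ inv-approx f 0 m
    go zero _ = begin
      (const (f 0) * (const F₃.1# + - shift h)) 0   ≡⟨ const-* (f 0) _ 0 ⟩
      f 0 F₃.* (const F₃.1# + - shift h) 0          ≡⟨ cong (f 0 F₃.*_) (+-at _ _ 0) ⟩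
      f 0 F₃.* (const F₃.1# 0 F₃.+ (- shift h) 0)
        ≡⟨ cong₂ (λ x y → f 0 F₃.* (x F₃.+ y)) (const-0 _) (≡.trans (neg-at _ 0) (cong F₃.-_ (shift-0 h))) ⟩
      f 0 F₃.* F₃.1#                                ≡⟨ F₃.*-identityʳ (f 0) ⟩
      f 0                                           ≡⟨ const-0 (f 0) ⟨
      const (f 0) 0                                 ∎
  inv-step f (suc n) = *-congˡ (+-congˡ (-‿cong (shift-cong n
      (Calculus.*-congˡ (upTo n) (inv-step f n)))))
    where open Calculus (upTo (suc n)) using (*-congˡ; +-congˡ; -‿cong)

  *-inv : ∀ f → ¬ (f 0 ≡ F₃.0#) → (f * inv f) ≈[ everything ] const F₃.1#
  *-inv f f0≢0 = by-truncation λ N →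
    let open Calculus (upTo N)
        c = const (f 0)
        t = tail f
        x = inv-approx f N
    in begin
      f * inv f                   ≈⟨ *-cong (exact (const-shift f)) (lim-≈ _ (inv-step f) N) ⟩
      (c + shift t) * x           ≈⟨ trans (distribʳ x c (shift t)) (+-congˡ (exact (shift-* t x))) ⟩
      c * x + shift (t * x)       ≈⟨ +-congʳ (*-congˡ (sym (inv-step f N))) ⟩
      c * (c * (const F₃.1# + - shift (t * x))) + shift (t * x)
        ≈⟨ +-congʳ (trans (sym (*-assoc _ _ _)) (trans (*-congʳ c*c) (*-identityˡ _))) ⟩
      const F₃.1# + - shift (t * x) + shift (t * x)
        ≈⟨ solve 1 (λ y → :1 :+ :- y :+ y := :1) refl _ ⟩
      const F₃.1#                 ∎
    where
    square : ∀ a → ¬ (a ≡ F₃.0#) → a F₃.* a ≡ F₃.1#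
    square zero             a≢0 = contradiction ≡.refl a≢0
    square (suc zero)       _   = ≡.refl
    square (suc (suc zero)) _   = ≡.refl

    c*c : ∀ {D} → (const (f 0) * const (f 0)) ≈[ D ] const F₃.1#
    c*c = exact λ m → ≡.trans (const-homo-* (f 0) (f 0) m) (cong (λ a → const a m) (square (f 0) f0≢0))

-- The substitutions q², -q and q³, and supports in residue classes.

module _ where
  open PS
  open Convolution F₃.ring

  -- dbl f is f(q²).
  dbl : PS → PS
  dbl f zero          = f 0
  dbl f (suc zero)    = F₃.0#
  dbl f (suc (suc m)) = dbl (tail f) m

  dbl-ext : ∀ {f g} → (∀ m → f m ≡ g m) → ∀ m → dbl f m ≡ dbl g m
  dbl-ext e zero          = e 0
  dbl-ext e (suc zero)    = ≡.refl
  dbl-ext e (suc (suc m)) = dbl-ext (λ k → e (suc k)) m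

  dbl-cong : ∀ {N f g} → f ≈[ upTo N ] g → dbl f ≈[ upTo N ] dbl g
  dbl-cong {f = f} {g} e = mk≈ (λ m le → go f g m λ k k≤m → at e k (ℕₚ.≤-trans k≤m le))
    where
    go : ∀ f g m → (∀ k → k ℕ.≤ m → f k ≡ g k) → dbl f m ≡ dbl g m
    go f g zero          e = e 0 ℕ.z≤n
    go f g (suc zero)    e = ≡.refl
    go f g (suc (suc m)) e = go (tail f) (tail g) m
      (λ k le → e (suc k) (ℕ.s≤s (ℕₚ.m≤n⇒m≤1+n le)))

  dbl-cong′ : ∀ {f g} → f ≈[ everything ] g → dbl f ≈[ everything ] dbl g
  dbl-cong′ e = exact (dbl-ext λ m → at e m tt)

  dbl-linear : ∀ c f g m → dbl (λ k → c F₃.* f k F₃.+ g k) m ≡ c F₃.* dbl f m F₃.+ dbl g m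
  dbl-linear c f g zero          = ≡.refl
  dbl-linear c f g (suc zero)    = ≡.sym (≡.trans (F₃.+-identityʳ _) (F₃.*-comm c F₃.0#))
  dbl-linear c f g (suc (suc m)) = dbl-linear c (tail f) (tail g) m

  dbl-+ : ∀ {D} f g → dbl (f + g) ≈[ D ] (dbl f + dbl g)
  dbl-+ f g = exact λ m → begin
    dbl (f + g) m  ≡⟨ dbl-ext (λ k → ≡.trans (+-at f g k) (cong (F₃._+ g k) (≡.sym (F₃.*-identityˡ (f k))))) m ⟩
    dbl (λ k → F₃.1# F₃.* f k F₃.+ g k) m  ≡⟨ dbl-linear F₃.1# f g m ⟩
    F₃.1# F₃.* dbl f m F₃.+ dbl g m        ≡⟨ cong (F₃._+ dbl g m) (F₃.*-identityˡ (dbl f m)) ⟩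
    dbl f m F₃.+ dbl g m                   ≡⟨ +-at _ _ m ⟨
    (dbl f + dbl g) m                      ∎
    where open ≡.≡-Reasoning

  dbl-neg : ∀ {D} f → dbl (- f) ≈[ D ] (- dbl f)
  dbl-neg f = exact λ m → ≡.trans (dbl-ext (neg-at f) m) (≡.trans (go f m) (≡.sym (neg-at _ m)))
    where
    go : ∀ f m → dbl (λ k → F₃.- f k) m ≡ F₃.- dbl f m
    go f zero          = ≡.refl
    go f (suc zero)    = ≡.refl
    go f (suc (suc m)) = go (tail f) m

  dbl-* : ∀ {D} f g → dbl (f * g) ≈[ D ] (dbl f * dbl g)
  dbl-* f g = exact λ m → ≡.trans (dbl-ext (*-at f g) m) (≡.trans (go f g m) (≡.sym (*-at _ _ m)))
    where
    prod : PS → PS → PS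
    prod f g m = conv m (λ k r → f k F₃.* g r)
    go : ∀ f g m → dbl (prod f g) m ≡ prod (dbl f) (dbl g) m
    go f g zero          = ≡.refl
    go f g (suc zero)    = ≡.sym (≡.trans (cong (F₃._+ _) (F₃.*-comm (f 0) F₃.0#)) ≡.refl)
    go f g (suc (suc m)) = begin
      dbl (λ k → f 0 F₃.* tail g k F₃.+ prod (tail f) g k) m
        ≡⟨ dbl-linear (f 0) (tail g) (prod (tail f) g) m ⟩
      f 0 F₃.* dbl (tail g) m F₃.+ dbl (prod (tail f) g) m
        ≡⟨ cong (f 0 F₃.* dbl (tail g) m F₃.+_) (≡.trans (go (tail f) g m) (≡.sym (F₃.+-identityˡ _))) ⟩
      prod (dbl f) (dbl g) (suc (suc m)) ∎
      where open ≡.≡-Reasoning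

  dbl-shift : ∀ f m → dbl (shift f) m ≡ shift (shift (dbl f)) m
  dbl-shift f zero          = ≡.trans (shift-0 _) (≡.sym (shift-0 _))
  dbl-shift f (suc zero)    = ≡.sym (≡.trans (shift-suc _ 0) (shift-0 _))
  dbl-shift f (suc (suc m)) = ≡.trans (dbl-ext (shift-suc f) m)
    (≡.sym (≡.trans (shift-suc _ (suc m)) (shift-suc _ m)))

  dbl-const : ∀ {D} c → dbl (const c) ≈[ D ] const c
  dbl-const c = exact go
    where
    dbl-0 : ∀ m → dbl (λ _ → F₃.0#) m ≡ F₃.0#
    dbl-0 zero          = ≡.refl
    dbl-0 (suc zero)    = ≡.refl
    dbl-0 (suc (suc m)) = dbl-0 m
    go : ∀ m → dbl (const c) m ≡ const c m
    go zero          = ≡.refl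
    go (suc zero)    = ≡.sym (const-suc c 0)
    go (suc (suc m)) = ≡.trans (dbl-ext (const-suc c) m) (≡.trans (dbl-0 m) (≡.sym (const-suc c (suc m))))

  shift-ext : ∀ {f g} → (∀ m → f m ≡ g m) → ∀ m → shift f m ≡ shift g m
  shift-ext e zero    = ≡.trans (shift-0 _) (≡.sym (shift-0 _))
  shift-ext e (suc m) = ≡.trans (shift-suc _ m) (≡.trans (e m) (≡.sym (shift-suc _ m)))

  dbl-mon : ∀ {D} n → dbl (mon n) ≈[ D ] mon (n ℕ.+ n)
  dbl-mon n = exact (go n)
    where
    go : ∀ n m → dbl (mon n) m ≡ mon (n ℕ.+ n) m
    go zero    m = at (dbl-const {everything} F₃.1#) m tt
    go (suc n) m rewrite ℕₚ.+-suc n n =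
      ≡.trans (dbl-shift (mon n) m) (shift-ext (shift-ext (go n)) m)

  -- If f(q) = f(q²), each coefficient of positive index is 0 or equals one of smaller positive
  -- index. The identities for sums of squares and of fourth powers of theta functions rest on this.
  dbl-fixed : ∀ {f} → f ≈[ everything ] dbl f → f ≈[ everything ] const (f 0)
  dbl-fixed {f} e = exact λ m → go m (<-wellFounded m)
    where
    halve : ∀ g m → (∀ k → k ℕ.≤ m → g k ≡ F₃.0#) → dbl g m ≡ F₃.0#
    halve g zero          h = h 0 ℕ.z≤n
    halve g (suc zero)    h = ≡.refl
    halve g (suc (suc m)) h = halve (tail g) m λ k le → at′ k le
      where
      at′ : ∀ k → k ℕ.≤ m → g (suc k) ≡ F₃.0#
      at′ k le = h (suc k) (ℕ.s≤s (ℕₚ.m≤n⇒m≤1+n le))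
    go : ∀ m → Acc ℕ._<_ m → f m ≡ const (f 0) m
    go zero          _         = ≡.sym (const-0 _)
    go (suc zero)    _         = ≡.trans (at e 1 tt) (≡.sym (const-suc _ 0))
    go (suc (suc m)) (acc rec) = ≡.trans (at e (suc (suc m)) tt) (≡.trans
      (halve (tail f) m λ k le → ≡.trans (go (suc k) (rec (ℕ.s≤s (ℕ.s≤s le)))) (const-suc _ k))
      (≡.sym (const-suc _ (suc m))))

  parity : ℕ → F₃
  parity zero    = F₃.1#
  parity (suc m) = F₃.- parity m

  -- alt f is f(-q).
  alt : PS → PS
  alt f m = parity m F₃.* f m

  alt-cong : ∀ {D f g} → f ≈[ D ] g → alt f ≈[ D ] alt g
  alt-cong e = mk≈ λ m d → cong (parity m F₃.*_) (at e m d)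

  alt-+ : ∀ {D} f g → alt (f + g) ≈[ D ] (alt f + alt g)
  alt-+ f g = exact λ m → ≡.trans (cong (parity m F₃.*_) (+-at f g m))
    (≡.trans (F₃.*-distribˡ-+ (parity m) (f m) (g m)) (≡.sym (+-at _ _ m)))

  private
    neg-*ʳ : ∀ x y → x F₃.* (F₃.- y) ≡ F₃.- (x F₃.* y)
    neg-*ʳ = from-yes (all? λ x → all? λ y → (x F₃.* (F₃.- y)) ≟ (F₃.- (x F₃.* y)))

    neg-*ˡ : ∀ x y → (F₃.- x) F₃.* y ≡ F₃.- (x F₃.* y)
    neg-*ˡ = from-yes (all? λ x → all? λ y → ((F₃.- x) F₃.* y) ≟ (F₃.- (x F₃.* y)))

    swap : ∀ a b x y → (a F₃.* b) F₃.* (x F₃.* y) ≡ (a F₃.* x) F₃.* (b F₃.* y)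
    swap = from-yes (all? λ a → all? λ b → all? λ x → all? λ y →
      ((a F₃.* b) F₃.* (x F₃.* y)) ≟ ((a F₃.* x) F₃.* (b F₃.* y)))

  parity-+ : ∀ k r → parity (k ℕ.+ r) ≡ parity k F₃.* parity r
  parity-+ zero    r = ≡.sym (F₃.*-identityˡ (parity r))
  parity-+ (suc k) r = ≡.trans (cong F₃.-_ (parity-+ k r)) (≡.sym (neg-*ˡ (parity k) (parity r)))

  alt-neg : ∀ {D} f → alt (- f) ≈[ D ] (- alt f)
  alt-neg f = exact λ m → ≡.trans (cong (parity m F₃.*_) (neg-at f m))
    (≡.trans (neg-*ʳ (parity m) (f m)) (≡.sym (neg-at _ m)))

  alt-* : ∀ {D} f g → alt (f * g) ≈[ D ] (alt f * alt g)
  alt-* f g = exact λ m → begin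
    parity m F₃.* (f * g) m
      ≡⟨ cong (parity m F₃.*_) (*-at f g m) ⟩
    parity m F₃.* conv m (λ k r → f k F₃.* g r)
      ≡⟨ conv-*ˡ (parity m) m _ ⟨
    conv m (λ k r → parity m F₃.* (f k F₃.* g r))
      ≡⟨ conv-cong m (λ { k r ≡.refl → ≡.trans (cong (F₃._* (f k F₃.* g r)) (parity-+ k r))
           (swap (parity k) (parity r) (f k) (g r)) }) ⟩
    conv m (λ k r → alt f k F₃.* alt g r)
      ≡⟨ *-at _ _ m ⟨
    (alt f * alt g) m ∎
    where open ≡.≡-Reasoning

  alt-const : ∀ {D} c → alt (const c) ≈[ D ] const c
  alt-const c = exact λ where
    zero    → F₃.*-identityˡ _
    (suc m) → ≡.trans (cong (parity (suc m) F₃.*_) (const-suc c m))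
      (≡.trans (F₃.*-comm (parity (suc m)) F₃.0#) (≡.sym (const-suc c m)))

  alt-mon : ∀ {D} n → alt (mon n) ≈[ D ] (const (parity n) * mon n)
  alt-mon n = exact λ m → ≡.trans (go n m) (≡.sym (const-* (parity n) (mon n) m))
    where
    go : ∀ n m → alt (mon n) m ≡ parity n F₃.* mon n m
    go zero zero       = ≡.refl
    go zero (suc m)    = ≡.trans (at (alt-const {everything} F₃.1#) (suc m) tt)
      (≡.sym (F₃.*-identityˡ (mon 0 (suc m))))
    go (suc n) zero    rewrite shift-0 (mon n) = ≡.sym (F₃.*-comm (parity (suc n)) F₃.0#)
    go (suc n) (suc m) rewrite shift-suc (mon n) m =
      ≡.trans (neg-*ˡ (parity m) (mon n m)) (≡.trans (cong F₃.-_ (go n m)) (≡.sym (neg-*ˡ (parity n) (mon n m))))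

  cube : PS → PS
  cube f = f * (f * f)

  -- triple f is f(q³).
  triple : PS → PS
  triple f zero                = f 0
  triple f (suc zero)          = F₃.0#
  triple f (suc (suc zero))    = F₃.0#
  triple f (suc (suc (suc m))) = triple (tail f) m

  cube-step : ∀ f m → cube f m ≡ (const (f 0) + shift (shift (shift (cube (tail f))))) m
  cube-step f m = at (begin
    cube f
      ≈⟨ *-cong f≈ (*-cong f≈ f≈) ⟩
    (c + q * t) * ((c + q * t) * (c + q * t))
      ≈⟨ solve 3 (λ c q t → (c :+ q :* t) :* ((c :+ q :* t) :* (c :+ q :* t))
           := c :* (c :* c) :+ q :* (q :* (q :* (t :* (t :* t))))) refl c q t ⟩
    c * (c * c) + q * (q * (q * cube t))
      ≈⟨ +-cong ccc (trans q* (exact (shift-ext λ m → at (trans q* (exact (shift-ext λ m → at (q* {cube t}) m tt))) m tt))) ⟩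
    c + shift (shift (shift (cube t))) ∎) m tt
    where
    open Calculus everything
    c q t : PS
    c = const (f 0)
    q = mon 1
    t = tail f
    q* : ∀ {g} → (q * g) ≈ shift g
    q* {g} = trans (exact (shift-* (mon 0) g)) (exact (shift-ext λ m →
      at (*-identityˡ g) m tt))
    f≈ : f ≈ (c + q * t)
    f≈ = trans (exact (const-shift f)) (+-congˡ (sym q*))
    power : ∀ a → a F₃.* (a F₃.* a) ≡ a
    power = from-yes (all? λ a → (a F₃.* (a F₃.* a)) ≟ a)
    ccc : (c * (c * c)) ≈ c
    ccc = trans (*-congˡ (exact (const-homo-* (f 0) (f 0)))) (trans (exact (const-homo-* (f 0) _))
      (reflexive (cong const (power (f 0)))))

  -- Cubing is additive in characteristic 3 and fixes F₃; the recursion strips the constant term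
  -- from f = f(0) + q f′.
  frobenius : ∀ f m → cube f m ≡ triple f m
  frobenius f m = ≡.trans (cube-step f m) (≡.trans (+-at _ _ m) (go m))
    where
    g = cube (tail f)
    go : ∀ m → const (f 0) m F₃.+ shift (shift (shift g)) m ≡ triple f m
    go zero = ≡.trans (cong₂ F₃._+_ (const-0 _) (shift-0 _)) (F₃.+-identityʳ (f 0))
    go (suc zero) = cong₂ F₃._+_ (const-suc _ 0) (≡.trans (shift-suc _ 0) (shift-0 _))
    go (suc (suc zero)) = cong₂ F₃._+_ (const-suc _ 1)
      (≡.trans (shift-suc _ 1) (≡.trans (shift-suc _ 0) (shift-0 _)))
    go (suc (suc (suc m))) = ≡.trans (cong₂ F₃._+_ (const-suc _ (suc (suc m)))
        (≡.trans (shift-suc _ (suc (suc m))) (≡.trans (shift-suc _ (suc m)) (shift-suc _ m))))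
      (≡.trans (F₃.+-identityˡ (g m)) (frobenius (tail f) m))

  -- Taking remainders on both sides leaves the representative a unreduced, so that products add
  -- representatives and cubes triple both representative and modulus.
  record Supp (n : ℕ) .{{_ : ℕ.NonZero n}} (a : ℕ) (f : PS) : Set where
    constructor mkSupp
    field vanish : ∀ m → ¬ (m % n ≡ a % n) → f m ≡ F₃.0#
  open Supp public

  Supp-all : ∀ {f} → Supp 1 0 f
  Supp-all = mkSupp λ m ne → contradiction (n%1≡0 m) ne

  module _ {n : ℕ} .{{_ : ℕ.NonZero n}} where

    Supp-resp : ∀ {a f g} → f ≈[ everything ] g → Supp n a f → Supp n a g
    Supp-resp e s = mkSupp λ m ne → ≡.trans (≡.sym (at e m tt)) (vanish s m ne)

    Supp-class : ∀ {a b f} → a % n ≡ b % n → Supp n a f → Supp n b f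
    Supp-class e s = mkSupp λ m ne → vanish s m λ m≡a → ne (≡.trans m≡a e)

    Supp-+ : ∀ {a f g} → Supp n a f → Supp n a g → Supp n a (f + g)
    Supp-+ s s′ = mkSupp λ m ne → ≡.trans (+-at _ _ m) (cong₂ F₃._+_ (vanish s m ne) (vanish s′ m ne))

    Supp-neg : ∀ {a f} → Supp n a f → Supp n a (- f)
    Supp-neg s = mkSupp λ m ne → ≡.trans (neg-at _ m) (cong F₃.-_ (vanish s m ne))

    Supp-* : ∀ {a b f g} → Supp n a f → Supp n b g → Supp n (a ℕ.+ b) (f * g)
    Supp-* {a} {b} {f} {g} s s′ = mkSupp λ m ne → ≡.trans (*-at f g m) (conv-0 m (term m ne))
      where
      term : ∀ m → ¬ (m % n ≡ (a ℕ.+ b) % n) → ∀ k r → k ℕ.+ r ≡ m → f k F₃.* g r ≡ F₃.0#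
      term m ne k r k+r≡m with k % n ℕ.≟ a % n | r % n ℕ.≟ b % n
      ... | no k≢a  | _      = cong (F₃._* g r) (vanish s k k≢a)
      ... | yes _   | no r≢b = ≡.trans (cong (f k F₃.*_) (vanish s′ r r≢b)) (F₃.*-comm (f k) F₃.0#)
      ... | yes k≡a | yes r≡b = contradiction (begin
        m % n                      ≡⟨ cong (_% n) k+r≡m ⟨
        (k ℕ.+ r) % n              ≡⟨ %-distribˡ-+ k r n ⟩
        (k % n ℕ.+ r % n) % n      ≡⟨ cong₂ (λ x y → (x ℕ.+ y) % n) k≡a r≡b ⟩
        (a % n ℕ.+ b % n) % n      ≡⟨ %-distribˡ-+ a b n ⟨
        (a ℕ.+ b) % n              ∎) ne
        where open ≡.≡-Reasoning

    Supp-mon : ∀ a → Supp n a (mon a)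
    Supp-mon a = mkSupp λ m ne → go a m λ m≡a → ne (cong (_% n) m≡a)
      where
      go : ∀ a m → ¬ (m ≡ a) → mon a m ≡ F₃.0#
      go zero    zero    ne = contradiction ≡.refl ne
      go zero    (suc m) ne = const-suc _ m
      go (suc a) zero    ne = shift-0 _
      go (suc a) (suc m) ne = ≡.trans (shift-suc _ m) (go a m λ e → ne (cong suc e))

    Supp-truncation : ∀ {a f} (g : ℕ → PS) → (∀ N → f ≈[ upTo N ] g N) →
      (∀ N → Supp n a (g N)) → Supp n a f
    Supp-truncation g e s = mkSupp λ m ne → ≡.trans (at (e m) m ℕₚ.≤-refl) (vanish (s m) m ne)

    Supp-cube : ∀ {a f} .{{_ : ℕ.NonZero (n ℕ.* 3)}} → Supp n a f → Supp (n ℕ.* 3) (a ℕ.* 3) (cube f)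
    Supp-cube {a} {f} s = mkSupp λ m ne → ≡.trans (frobenius f m) (go f m (s′ m ne))
      where
      s′ : ∀ m → ¬ (m % (n ℕ.* 3) ≡ (a ℕ.* 3) % (n ℕ.* 3)) → ∀ k → m ≡ k ℕ.* 3 → f k ≡ F₃.0#
      s′ m ne k m≡3k = vanish s k λ k≡a → ne (≡.trans (cong (_% (n ℕ.* 3)) m≡3k)
        (≡.trans (≡.sym (m%n*o≡m*o%[n*o] k n 3)) (≡.trans (cong (ℕ._* 3) k≡a) (m%n*o≡m*o%[n*o] a n 3))))
      go : ∀ f m → (∀ k → m ≡ k ℕ.* 3 → f k ≡ F₃.0#) → triple f m ≡ F₃.0#
      go f zero                h = h 0 ≡.refl
      go f (suc zero)          h = ≡.refl
      go f (suc (suc zero))    h = ≡.refl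
      go f (suc (suc (suc m))) h = go (tail f) m λ k e → h (suc k) (cong (3 ℕ.+_) e)

    Supp-dbl : ∀ {a f} .{{_ : ℕ.NonZero (n ℕ.* 2)}} → Supp n a f → Supp (n ℕ.* 2) (a ℕ.* 2) (dbl f)
    Supp-dbl {a} {f} s = mkSupp λ m ne → go f m (s′ m ne)
      where
      s′ : ∀ m → ¬ (m % (n ℕ.* 2) ≡ (a ℕ.* 2) % (n ℕ.* 2)) → ∀ k → m ≡ k ℕ.* 2 → f k ≡ F₃.0#
      s′ m ne k m≡2k = vanish s k λ k≡a → ne (≡.trans (cong (_% (n ℕ.* 2)) m≡2k)
        (≡.trans (≡.sym (m%n*o≡m*o%[n*o] k n 2)) (≡.trans (cong (ℕ._* 2) k≡a) (m%n*o≡m*o%[n*o] a n 2))))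
      go : ∀ f m → (∀ k → m ≡ k ℕ.* 2 → f k ≡ F₃.0#) → dbl f m ≡ F₃.0#
      go f zero          h = h 0 ≡.refl
      go f (suc zero)    h = ≡.refl
      go f (suc (suc m)) h = go (tail f) m λ k e → h (suc k) (cong (2 ℕ.+_) e)

  Supp-coarsen : ∀ n k .{{_ : ℕ.NonZero n}} .{{_ : ℕ.NonZero (k ℕ.* n)}} {a f} →
    Supp (k ℕ.* n) a f → Supp n a f
  Supp-coarsen n k {a} s = mkSupp λ m ne → vanish s m λ e → ne (begin
    m % n                ≡⟨ m∣n⇒o%n%m≡o%m n (k ℕ.* n) m (divides k ≡.refl) ⟨
    m % (k ℕ.* n) % n    ≡⟨ cong (_% n) e ⟩
    a % (k ℕ.* n) % n    ≡⟨ m∣n⇒o%n%m≡o%m n (k ℕ.* n) a (divides k ≡.refl) ⟩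
    a % n                ∎)
    where open ≡.≡-Reasoning

-- Theta series, their even and odd parts, and the part W.

module _ where
  open PS

  one : PS
  one = const F₃.1#

  sgn theta phi : ℕ → PS
  sgn zero      = one
  sgn (suc n)   = - sgn n
  -- Partial sums of 1 + 2 Σ (-1)ᵏ q^(k²) and of 1 + 2 Σ q^(k²).
  theta zero    = one
  theta (suc n) = theta n + - (sgn (suc n) * mon (suc n ℕ.* suc n))
  phi zero      = one
  phi (suc n)   = phi n + - mon (suc n ℕ.* suc n)

  V U : PS
  V = lim theta
  U = alt V

  vanishing-step : ∀ f c n → (f + - (c * mon (suc n ℕ.* suc n))) ≈[ upTo n ] f
  vanishing-step f c n = trans (+-congˡ (-‿cong (*-congˡ (mon-nil n _ (ℕ.s≤s (ℕₚ.m≤m+n n _))))))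
    (solve 2 (λ f c → f :+ :- (c :* :0) := f) refl f c)
    where open Calculus (upTo n)

  V≈theta : ∀ N → V ≈[ upTo N ] theta N
  V≈theta = lim-≈ theta λ n → vanishing-step (theta n) _ n

  shrink : ∀ {f g M N} → N ℕ.≤ M → f ≈[ upTo M ] g → f ≈[ upTo N ] g
  shrink N≤M e = mk≈ λ m m≤N → at e m (ℕₚ.≤-trans m≤N N≤M)

  neg-const : ∀ {D} c → const (F₃.- c) ≈[ D ] (- const c)
  neg-const c = exact λ where
    zero    → ≡.trans (const-0 _) (≡.sym (≡.trans (neg-at _ 0) (cong F₃.-_ (const-0 c))))
    (suc m) → ≡.trans (const-suc _ m) (≡.sym (≡.trans (neg-at _ (suc m)) (cong F₃.-_ (const-suc c m))))

  parity-double : ∀ n → parity (n ℕ.+ n) ≡ F₃.1#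
  parity-double zero    = ≡.refl
  parity-double (suc n) rewrite ℕₚ.+-suc n n | parity-double n = ≡.refl

  parity-square : ∀ n → parity (suc n ℕ.* suc n) ≡ F₃.- parity (n ℕ.* n)
  parity-square n = ≡.trans (cong parity (expand n)) (≡.trans (parity-+ (suc (n ℕ.+ n)) (n ℕ.* n))
    (≡.trans (cong (λ x → (F₃.- x) F₃.* parity (n ℕ.* n)) (parity-double n)) (-1* (parity (n ℕ.* n)))))
    where
    expand : ∀ n → suc n ℕ.* suc n ≡ suc (n ℕ.+ n) ℕ.+ n ℕ.* n
    expand = solve-∀
    -1* : ∀ x → (F₃.- F₃.1#) F₃.* x ≡ F₃.- x
    -1* = from-yes (all? λ x → ((F₃.- F₃.1#) F₃.* x) ≟ (F₃.- x))

  -- n² and n have the same parity, which is why q ↦ -q removes the signs of theta.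
  sgn-parity : ∀ n → (sgn n * const (parity (n ℕ.* n))) ≈[ everything ] one
  sgn-parity zero    = *-identityˡ _
    where open Calculus everything
  sgn-parity (suc n) = begin
    (- sgn n) * const (parity (suc n ℕ.* suc n))
      ≈⟨ *-congˡ (trans (reflexive (cong const (parity-square n))) (neg-const _)) ⟩
    (- sgn n) * (- const (parity (n ℕ.* n)))
      ≈⟨ solve 2 (λ x y → :- x :* :- y := x :* y) refl _ _ ⟩
    sgn n * const (parity (n ℕ.* n))
      ≈⟨ sgn-parity n ⟩
    one ∎
    where open Calculus everything

  alt-sgn : ∀ n → alt (sgn n) ≈[ everything ] sgn n
  alt-sgn zero    = alt-const F₃.1#
  alt-sgn (suc n) = trans (alt-neg (sgn n)) (-‿cong (alt-sgn n))
    where open Calculus everything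

  alt-theta : ∀ n → alt (theta n) ≈[ everything ] phi n
  alt-theta zero    = alt-const F₃.1#
  alt-theta (suc n) = begin
    alt (theta n + - (sgn N * mon e))
      ≈⟨ trans (alt-+ _ _) (+-cong (alt-theta n) (alt-neg _)) ⟩
    phi n + - alt (sgn N * mon e)
      ≈⟨ +-congˡ (-‿cong (trans (alt-* _ _) (*-cong (alt-sgn N) (alt-mon e)))) ⟩
    phi n + - (sgn N * (const (parity e) * mon e))
      ≈⟨ +-congˡ (-‿cong (trans (sym (*-assoc _ _ _)) (trans (*-congʳ (sgn-parity N)) (*-identityˡ _)))) ⟩
    phi n + - mon e ∎
    where
    open Calculus everything
    N = suc n
    e = N ℕ.* N

  U≈phi : ∀ N → U ≈[ upTo N ] phi N
  U≈phi N = trans (alt-cong (V≈theta N)) (weaken (alt-theta N))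
    where open Calculus (upTo N)

  sgn-double : ∀ n → sgn (n ℕ.+ n) ≈[ everything ] one
  sgn-double zero    = refl
    where open Calculus everything
  sgn-double (suc n) rewrite ℕₚ.+-suc n n =
    trans (solve 1 (λ s → :- :- s := s) refl _) (sgn-double n)
    where open Calculus everything

  -- With 2 = -1 these are φ(-q) + φ(q) = 2 φ(q⁴) and φ(q) - φ(-q) = 4 Σ q^((2j+1)²).
  theta+phi : ∀ n → (theta (n ℕ.+ n) + phi (n ℕ.+ n)) ≈[ everything ] (- dbl (dbl (phi n)))
  theta+phi zero    = begin
    one + one               ≈⟨ solve 0 (:1 :+ :1 := :- :1) refl ⟩
    - one                   ≈⟨ -‿cong (trans (dbl-cong′ (dbl-const F₃.1#)) (dbl-const F₃.1#)) ⟨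
    - dbl (dbl one)         ∎
    where open Calculus everything
  theta+phi (suc n) rewrite ℕₚ.+-suc n n = begin
    theta k + - ((- sgn k) * a) + - ((- (- sgn k)) * b) + (phi k + - a + - b)
      ≈⟨ +-congʳ (+-cong (+-congˡ (-‿cong (*-congʳ (-‿cong (sgn-double n)))))
           (-‿cong (*-congʳ (-‿cong (-‿cong (sgn-double n)))))) ⟩
    theta k + - ((- one) * a) + - ((- (- one)) * b) + (phi k + - a + - b)
      ≈⟨ solve 4 (λ t p a b → t :+ :- (:- :1 :* a) :+ :- (:- :- :1 :* b) :+ (p :+ :- a :+ :- b)
           := (t :+ p) :+ b) refl _ _ a b ⟩
    theta k + phi k + b
      ≈⟨ +-cong (theta+phi n) (trans (reflexive (cong mon (square n)))
           (sym (trans (dbl-cong′ (dbl-mon e)) (dbl-mon (e ℕ.+ e))))) ⟩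
    (- dbl (dbl (phi n))) + dbl (dbl (mon e))
      ≈⟨ solve 2 (λ x y → :- x :+ y := :- (x :+ :- y)) refl _ _ ⟩
    - (dbl (dbl (phi n)) + - dbl (dbl (mon e)))
      ≈⟨ -‿cong (trans (+-congˡ (sym (trans (dbl-cong′ (dbl-neg _)) (dbl-neg _))))
           (sym (trans (dbl-cong′ (dbl-+ _ _)) (dbl-+ _ _)))) ⟩
    - dbl (dbl (phi (suc n))) ∎
    where
    open Calculus everything
    k = n ℕ.+ n
    a = mon (suc k ℕ.* suc k)
    b = mon (suc (suc k) ℕ.* suc (suc k))
    e = suc n ℕ.* suc n
    square : ∀ n → suc (suc (n ℕ.+ n)) ℕ.* suc (suc (n ℕ.+ n))
      ≡ suc n ℕ.* suc n ℕ.+ suc n ℕ.* suc n ℕ.+ (suc n ℕ.* suc n ℕ.+ suc n ℕ.* suc n)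
    square = solve-∀

  phi-theta : ∀ n → Supp 8 1 (phi (n ℕ.+ n) + - theta (n ℕ.+ n))
  phi-theta zero    = Supp-resp {f = const F₃.0#} (solve 0 (:0 := :1 :+ :- :1) refl) Supp-0
    where
    open Calculus everything
    Supp-0 : Supp 8 1 (const F₃.0#)
    Supp-0 = mkSupp λ where
      zero    _ → const-0 _
      (suc m) _ → const-suc _ m
  phi-theta (suc n) rewrite ℕₚ.+-suc n n = Supp-resp step
    (Supp-+ (phi-theta n) (Supp-class (odd-square n) (Supp-mon (suc k ℕ.* suc k))))
    where
    open Calculus everything
    k = n ℕ.+ n
    a = mon (suc k ℕ.* suc k)
    b = mon (suc (suc k) ℕ.* suc (suc k))
    step : (phi k + - theta k + a)
      ≈ (phi k + - a + - b + - (theta k + - ((- sgn k) * a) + - ((- (- sgn k)) * b)))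
    step = begin
      phi k + - theta k + a
        ≈⟨ solve 4 (λ t p a b → p :+ :- t :+ a
             := p :+ :- a :+ :- b :+ :- (t :+ :- (:- :1 :* a) :+ :- (:- :- :1 :* b))) refl _ _ a b ⟩
      phi k + - a + - b + - (theta k + - ((- one) * a) + - ((- (- one)) * b))
        ≈⟨ +-congˡ (-‿cong (+-cong (+-congˡ (-‿cong (*-congʳ (-‿cong (sgn-double n)))))
             (-‿cong (*-congʳ (-‿cong (-‿cong (sgn-double n))))))) ⟨
      phi k + - a + - b + - (theta k + - ((- sgn k) * a) + - ((- (- sgn k)) * b)) ∎
    -- An odd square is 1 + 8 T with T a triangular number.
    odd-square : ∀ n → (suc (n ℕ.+ n) ℕ.* suc (n ℕ.+ n)) % 8 ≡ 1
    odd-square n = ≡.trans (cong (_% 8) (expand n)) (≡.trans (cong (λ t → (1 ℕ.+ t) % 8) (four-tri n))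
      ([m+kn]%n≡m%n 1 (triangle n) 8))
      where
      triangle : ℕ → ℕ
      triangle zero    = 0
      triangle (suc n) = suc n ℕ.+ triangle n
      expand : ∀ n → suc (n ℕ.+ n) ℕ.* suc (n ℕ.+ n) ≡ 1 ℕ.+ 4 ℕ.* (n ℕ.* n ℕ.+ n)
      expand = solve-∀
      four-tri : ∀ n → 4 ℕ.* (n ℕ.* n ℕ.+ n) ≡ triangle n ℕ.* 8
      four-tri zero    = ≡.refl
      four-tri (suc n) = ≡.trans (step₁ n) (≡.trans (cong (8 ℕ.* suc n ℕ.+_) (four-tri n)) (step₂ n (triangle n)))
        where
        step₁ : ∀ n → 4 ℕ.* (suc n ℕ.* suc n ℕ.+ suc n) ≡ 8 ℕ.* suc n ℕ.+ 4 ℕ.* (n ℕ.* n ℕ.+ n)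
        step₁ = solve-∀
        step₂ : ∀ n t → 8 ℕ.* suc n ℕ.+ t ℕ.* 8 ≡ (suc n ℕ.+ t) ℕ.* 8
        step₂ = solve-∀

  -- The even and odd parts of V = φ(-q).
  A₀ A₁ : PS
  A₀ = - (V + U)
  A₁ = U + - V

  V+U : (V + U) ≈[ everything ] (- dbl (dbl U))
  V+U = by-truncation λ N → let open Calculus (upTo N) in
    trans (shrink (ℕₚ.m≤m+n N N) (Calculus.+-cong (upTo (N ℕ.+ N)) (V≈theta (N ℕ.+ N)) (U≈phi (N ℕ.+ N))))
      (trans (weaken (theta+phi N)) (-‿cong (dbl-cong (dbl-cong (sym (U≈phi N))))))

  -- The even part of φ(-q) is φ(q⁴); two substitutions q ↦ q² then give the class 0 mod 4.
  A₀≈ : dbl (dbl U) ≈[ everything ] A₀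
  A₀≈ = trans (solve 1 (λ x → x := :- :- x) refl _) (-‿cong (sym V+U))
    where open Calculus everything

  Supp-A₀ : Supp 4 0 A₀
  Supp-A₀ = Supp-resp A₀≈ (Supp-dbl (Supp-dbl {n = 1} {a = 0} Supp-all))

  Supp-A₁ : Supp 8 1 A₁
  Supp-A₁ = Supp-truncation (λ N → phi (N ℕ.+ N) + - theta (N ℕ.+ N))
    (λ N → let open Calculus (upTo (N ℕ.+ N)) in shrink (ℕₚ.m≤m+n N N)
      (+-cong (U≈phi (N ℕ.+ N)) (-‿cong (V≈theta (N ℕ.+ N)))))
    phi-theta

  C W : PS
  C = cube (cube V)
  W = V + - C

  sgn-*3 : ∀ n → sgn (n ℕ.* 3) ≈[ everything ] sgn n
  sgn-*3 zero    = refl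
    where open Calculus everything
  sgn-*3 (suc n) = trans (solve 1 (λ s → :- :- :- s := :- s) refl _) (-‿cong (sgn-*3 n))
    where open Calculus everything

  sgn-cube : ∀ n → cube (sgn n) ≈[ everything ] sgn n
  sgn-cube zero    = solve 0 (:1 :* (:1 :* :1) := :1) refl
    where open Calculus everything
  sgn-cube (suc n) = trans (solve 1 (λ s → :- s :* (:- s :* :- s) := :- (s :* (s :* s))) refl _)
      (-‿cong (sgn-cube n))
    where open Calculus everything

  cube-cong : ∀ {D f g} → f ≈[ D ] g → cube f ≈[ D ] cube g
  cube-cong {D} e = *-cong e (*-cong e e)
    where open Calculus D

  cube-+ : ∀ {D} f g → cube (f + g) ≈[ D ] (cube f + cube g)
  cube-+ {D} = solve 2 (λ a b → (a :+ b) :* ((a :+ b) :* (a :+ b)) := a :* (a :* a) :+ b :* (b :* b)) refl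
    where open Calculus D

  Supp-sgn : ∀ n {m} .{{_ : ℕ.NonZero m}} → Supp m 0 (sgn n)
  Supp-sgn zero    = Supp-mon 0
  Supp-sgn (suc n) = Supp-neg (Supp-sgn n)

  -- The ninth power replaces q by q⁹, and since (-1)^(3k) = (-1)^k its terms are exactly those of
  -- index 3k in theta. The remaining squares are 1 mod 3. The bound 3n + 2 stops just before the
  -- next index divisible by 3.
  theta-ninth : ∀ n → Supp 3 1 (theta (2 ℕ.+ n ℕ.* 3) + - cube (cube (theta n)))
  theta-ninth zero = Supp-resp
    (solve 2 (λ a b → a :+ :- b := (:1 :+ :- (:- :1 :* a) :+ :- (:- :- :1 :* b))
      :+ :- (:1 :* (:1 :* :1) :* (:1 :* (:1 :* :1) :* (:1 :* (:1 :* :1))))) refl (mon 1) (mon 4))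
    (Supp-+ (Supp-mon 1) (Supp-neg (Supp-class {a = 4} ≡.refl (Supp-mon 4))))
    where open Calculus everything
  theta-ninth (suc n) = Supp-resp step (Supp-+ (Supp-+ (theta-ninth n) (term 4 ≡.refl)) (term 5 ≡.refl))
    where
    open Calculus everything
    k = n ℕ.* 3
    s = sgn (suc n)
    q = mon (suc n ℕ.* suc n)
    y : ℕ → PS
    y i = sgn (i ℕ.+ k) * mon ((i ℕ.+ k) ℕ.* (i ℕ.+ k))
    term : ∀ i → (i ℕ.* i) % 3 ≡ 1 → Supp 3 1 (- y i)
    term i e = Supp-neg (Supp-* {a = 0} (Supp-sgn (i ℕ.+ k)) (Supp-class square (Supp-mon ((i ℕ.+ k) ℕ.* (i ℕ.+ k)))))
      where
      expand : ∀ i n → (i ℕ.+ n ℕ.* 3) ℕ.* (i ℕ.+ n ℕ.* 3) ≡ i ℕ.* i ℕ.+ (2 ℕ.* (i ℕ.* n) ℕ.+ 3 ℕ.* (n ℕ.* n)) ℕ.* 3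
      expand = solve-∀
      square : ((i ℕ.+ k) ℕ.* (i ℕ.+ k)) % 3 ≡ 1 % 3
      square = ≡.trans (cong (_% 3) (expand i n)) (≡.trans ([m+kn]%n≡m%n (i ℕ.* i) (2 ℕ.* (i ℕ.* n) ℕ.+ 3 ℕ.* (n ℕ.* n)) 3) e)
    mon-cube : ∀ m → cube (mon m) ≈ mon (m ℕ.+ (m ℕ.+ m))
    mon-cube m = sym (trans (mon-+ m (m ℕ.+ m)) (*-congˡ (mon-+ m m)))
    ninth : cube (cube q) ≈ mon ((3 ℕ.+ k) ℕ.* (3 ℕ.+ k))
    ninth = trans (cube-cong (mon-cube (suc n ℕ.* suc n))) (trans (mon-cube (e ℕ.+ (e ℕ.+ e)))
      (reflexive (cong mon (expand n))))
      where
      e = suc n ℕ.* suc n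
      expand : ∀ n → let e = suc n ℕ.* suc n ; f = e ℕ.+ (e ℕ.+ e) in
        f ℕ.+ (f ℕ.+ f) ≡ (3 ℕ.+ n ℕ.* 3) ℕ.* (3 ℕ.+ n ℕ.* 3)
      expand = solve-∀
    y₃ : y 3 ≈ cube (cube s) * cube (cube q)
    y₃ = sym (*-cong (trans (cube-cong (sgn-cube (suc n))) (trans (sgn-cube (suc n)) (sym (sgn-*3 (suc n))))) ninth)
    cube-neg-* : ∀ a b → cube (- (a * b)) ≈ (- (cube a * cube b))
    cube-neg-* = solve 2 (λ a b → :- (a :* b) :* (:- (a :* b) :* :- (a :* b))
      := :- (a :* (a :* a) :* (b :* (b :* b)))) refl
    ninth-power : cube (cube (theta n + - (s * q))) ≈ (cube (cube (theta n)) + - (cube (cube s) * cube (cube q)))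
    ninth-power = trans (cube-cong (trans (cube-+ _ _) (+-congˡ (cube-neg-* s q))))
      (trans (cube-+ _ _) (+-congˡ (cube-neg-* (cube s) (cube q))))
    step : (theta (2 ℕ.+ k) + - cube (cube (theta n)) + - y 4 + - y 5)
      ≈ (theta (2 ℕ.+ k) + - y 3 + - y 4 + - y 5 + - cube (cube (theta n + - (s * q))))
    step = begin
      theta (2 ℕ.+ k) + - t + - y 4 + - y 5
        ≈⟨ solve 5 (λ a b c d e → a :+ :- b :+ :- d :+ :- e
             := a :+ :- c :+ :- d :+ :- e :+ :- (b :+ :- c)) refl _ t (y 3) (y 4) (y 5) ⟩
      theta (2 ℕ.+ k) + - y 3 + - y 4 + - y 5 + - (t + - y 3)
        ≈⟨ +-congˡ (-‿cong (trans (+-congˡ (-‿cong y₃)) (sym ninth-power))) ⟩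
      theta (2 ℕ.+ k) + - y 3 + - y 4 + - y 5 + - cube (cube (theta n + - (s * q))) ∎
      where t = cube (cube (theta n))

  Supp-W : Supp 3 1 W
  Supp-W = Supp-truncation (λ N → theta (2 ℕ.+ N ℕ.* 3) + - cube (cube (theta N)))
    (λ N → let open Calculus (upTo N) in
      +-cong (shrink (ℕₚ.≤-trans (ℕₚ.m≤m*n N 3) (ℕₚ.m≤n+m _ 2)) (V≈theta (2 ℕ.+ N ℕ.* 3)))
        (-‿cong (cube-cong (cube-cong (V≈theta N)))))
    theta-ninth

-- Theta identities of degrees two and four.

module _ where
  open PS

  w j : ℕ → PS
  w n = inv (one + - mon (suc n))
  j n = inv (one + mon n)

  w-inv : ∀ {D} n → ((one + - mon (suc n)) * w n) ≈[ D ] one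
  w-inv n = weaken (*-inv _ λ e → contradiction (≡.trans (≡.sym value) e) λ ())
    where
    value : (one + - mon (suc n)) 0 ≡ F₃.1#
    value = ≡.trans (+-at _ _ 0) (cong₂ F₃._+_ (const-0 _) (≡.trans (neg-at _ 0) (cong F₃.-_ (shift-0 _))))

  j-inv : ∀ {D} n → ((one + mon n) * j n) ≈[ D ] one
  j-inv n = weaken (*-inv _ λ e → nonzero n (≡.trans (≡.sym (+-at _ _ 0)) e))
    where
    nonzero : ∀ n → ¬ (one 0 F₃.+ mon n 0 ≡ F₃.0#)
    nonzero zero    e = contradiction (≡.trans (≡.sym (cong₂ F₃._+_ (const-0 _) (const-0 _))) e) λ ()
    nonzero (suc n) e = contradiction (≡.trans (≡.sym (cong₂ F₃._+_ (const-0 _) (shift-0 _))) e) λ ()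

  module T (N : ℕ) = Truncation (ring (upTo N)) (char3 (upTo N)) mon mon-0 mon-+ w w-inv j j-inv N (mon-nil N)

  sgn≡ : ∀ N n → T.G.sg N n ≡ sgn n
  sgn≡ N zero    = ≡.refl
  sgn≡ N (suc n) = cong -_ (sgn≡ N n)

  theta≡ : ∀ N n → T.G.Θ N n ≡ theta n
  theta≡ N zero    = ≡.refl
  theta≡ N (suc n) = cong₂ (λ t s → t + - (s * mon (suc n ℕ.* suc n))) (theta≡ N n) (sgn≡ N (suc n))

  V≈Θ : ∀ N → V ≈[ upTo N ] T.G.Θ N N
  V≈Θ N = trans (V≈theta N) (reflexive (≡.sym (theta≡ N N)))
    where open Calculus (upTo N)

  -- φ(q) φ(-q) = φ(-q²)² follows from Gauss' product: (q;q²) (-q;q²) = (q²;q⁴) is `alt-X`, and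
  -- (q²;q²) = (q²;q⁴) (q⁴;q⁴) is `F₂-dbl`.
  V*U : (V * U) ≈[ everything ] (dbl V * dbl V)
  V*U = by-truncation go
    where
    go : ∀ N → (V * U) ≈[ upTo N ] (dbl V * dbl V)
    go N = begin
      V * alt V
        ≈⟨ *-cong V≈ (trans (alt-cong V≈) (trans (alt-* _ _) (*-cong (alt-* _ _) (alt-F₂ N)))) ⟩
      X * X * F₂ * (alt X * alt X * F₂)
        ≈⟨ solve 3 (λ x y f → x :* x :* f :* (y :* y :* f) := (y :* x) :* (y :* x) :* (f :* f)) refl _ _ _ ⟩
      (alt X * X) * (alt X * X) * (F₂ * F₂)
        ≈⟨ *-cong (*-cong (alt-X N) (alt-X N)) (*-cong F₂-dbl F₂-dbl) ⟩
      dbl X * dbl X * ((dbl X * dbl F₂) * (dbl X * dbl F₂))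
        ≈⟨ solve 2 (λ x f → x :* x :* ((x :* f) :* (x :* f)) := (x :* x :* f) :* (x :* x :* f)) refl _ _ ⟩
      dbl X * dbl X * dbl F₂ * (dbl X * dbl X * dbl F₂)
        ≈⟨ *-cong dblV dblV ⟨
      dbl V * dbl V ∎
      where
      open Calculus (upTo N)
      open T N using (module G; module B₂; stable₁; stable₂; F-double; Θ-product)
      X F₂ : PS
      X = T.X N N
      F₂ = B₂.F N
      V≈ : V ≈ (X * X * F₂)
      V≈ = trans (V≈Θ N) (Θ-product {N} ℕₚ.≤-refl)
      dblV : dbl V ≈ (dbl X * dbl X * dbl F₂)
      dblV = trans (dbl-cong V≈) (trans (dbl-* _ _) (*-congʳ (dbl-* _ _)))
      alt-F₂ : ∀ n → alt (B₂.F n) ≈ B₂.F n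
      alt-F₂ zero    = alt-const F₃.1#
      alt-F₂ (suc n) = trans (alt-* _ _) (*-cong (trans (alt-+ _ _) (+-cong (alt-const F₃.1#)
        (trans (alt-neg _) (-‿cong (trans (alt-mon (suc n ℕ.+ suc n))
          (trans (*-congʳ (reflexive (cong const (parity-double (suc n))))) (*-identityˡ _))))))) (alt-F₂ n))
      alt-X : ∀ n → (alt (T.X N n) * T.X N n) ≈ dbl (T.X N n)
      alt-X zero    = trans (*-identityʳ _) (trans (alt-const F₃.1#) (sym (dbl-const F₃.1#)))
      alt-X (suc n) = begin
        alt ((one + - q) * T.X N n) * ((one + - q) * T.X N n)
          ≈⟨ *-congʳ (trans (alt-* _ _) (*-congʳ (trans (alt-+ _ _) (+-cong (alt-const F₃.1#) (alt-neg _))))) ⟩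
        (one + - alt q) * alt (T.X N n) * ((one + - q) * T.X N n)
          ≈⟨ *-congʳ (*-congʳ (+-congˡ (-‿cong (trans (alt-mon e)
               (*-congʳ (trans (reflexive (cong (λ x → const (F₃.- x)) (parity-double n))) (neg-const F₃.1#))))))) ⟩
        (one + - ((- one) * q)) * alt (T.X N n) * ((one + - q) * T.X N n)
          ≈⟨ solve 3 (λ q x y → (:1 :+ :- (:- :1 :* q)) :* y :* ((:1 :+ :- q) :* x)
               := (:1 :+ :- (q :* q)) :* (y :* x)) refl _ _ _ ⟩
        (one + - (q * q)) * (alt (T.X N n) * T.X N n)
          ≈⟨ *-cong (sym (trans (dbl-+ _ _) (+-cong (dbl-const F₃.1#) (trans (dbl-neg _)
               (-‿cong (trans (dbl-mon e) (mon-+ e e))))))) (alt-X n) ⟩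
        dbl (one + - q) * dbl (T.X N n)  ≈⟨ dbl-* _ _ ⟨
        dbl ((one + - q) * T.X N n)      ∎
        where
        e = suc (n ℕ.+ n)
        q = mon e
      F₂≈dblF₁ : ∀ n → B₂.F n ≈ dbl (G.F n)
      F₂≈dblF₁ zero    = sym (dbl-const F₃.1#)
      F₂≈dblF₁ (suc n) = sym (trans (dbl-* _ _) (*-cong (trans (dbl-+ _ _) (+-cong (dbl-const F₃.1#)
        (trans (dbl-neg _) (-‿cong (dbl-mon (suc n)))))) (sym (F₂≈dblF₁ n))))
      F₂-dbl : F₂ ≈ (dbl X * dbl F₂)
      F₂-dbl = trans (F₂≈dblF₁ N) (trans (dbl-cong (trans (sym (stable₁ (ℕₚ.m≤m+n N N))) (F-double N))) (dbl-* _ _))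

  coef₀-* : ∀ f g → (f * g) 0 ≡ f 0 F₃.* g 0
  coef₀-* f g = *-at f g 0

  V₀ : V 0 ≡ F₃.1#
  V₀ = const-0 F₃.1#

  U₀ : U 0 ≡ F₃.1#
  U₀ = cong (F₃._*_ F₃.1#) V₀

  -- With 2 = -1: U² + V² = 2 U(q²)², because D = U² + V² - 2 U(q²)² satisfies D = -2 D(q²).
  U²+V² : (U * U + V * V) ≈[ everything ] (- (dbl U * dbl U))
  U²+V² = begin
    U * U + V * V  ≈⟨ solve 2 (λ x y → x := x :+ y :+ :- y) refl _ _ ⟩
    D + - (dbl U * dbl U)
      ≈⟨ +-congʳ (trans (dbl-fixed D-fixed) (reflexive (cong const D₀))) ⟩
    const F₃.0# + - (dbl U * dbl U)  ≈⟨ +-identityˡ _ ⟩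
    - (dbl U * dbl U) ∎
    where
    open Calculus everything
    D : PS
    D = U * U + V * V + dbl U * dbl U
    D₀ : D 0 ≡ F₃.0#
    D₀ = ≡.trans (+-at _ _ 0) (cong₂ F₃._+_ (≡.trans (+-at _ _ 0)
      (cong₂ F₃._+_ (≡.trans (coef₀-* U U) (cong₂ F₃._*_ U₀ U₀)) (≡.trans (coef₀-* V V) (cong₂ F₃._*_ V₀ V₀))))
      (≡.trans (coef₀-* (dbl U) (dbl U)) (cong₂ F₃._*_ U₀ U₀)))
    D-fixed : D ≈ dbl D
    D-fixed = begin
      U * U + V * V + dbl U * dbl U
        ≈⟨ solve 3 (λ u v z → u :* u :+ v :* v :+ z := (v :+ u) :* (v :+ u) :+ v :* u :+ z) refl _ _ _ ⟩
      (V + U) * (V + U) + V * U + dbl U * dbl U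
        ≈⟨ +-congʳ (+-cong (*-cong V+U V+U) V*U) ⟩
      (- dbl (dbl U)) * (- dbl (dbl U)) + dbl V * dbl V + dbl U * dbl U
        ≈⟨ solve 3 (λ x y z → :- x :* :- x :+ y :+ z := z :+ y :+ x :* x) refl _ _ _ ⟩
      dbl U * dbl U + dbl V * dbl V + dbl (dbl U) * dbl (dbl U)
        ≈⟨ trans (dbl-+ _ _) (+-cong (trans (dbl-+ _ _) (+-cong (dbl-* _ _) (dbl-* _ _))) (dbl-* _ _)) ⟨
      dbl D ∎

  fourth : PS → PS
  fourth f = (f * f) * (f * f)

  -- Over the integers φ(q)⁴ + φ(-q)⁴ = 4 φ(q²)⁴ - 2 φ(-q²)⁴. Modulo 3 both coefficients are 1, so
  -- the sum is fixed by q ↦ q² and reduces to its constant term 2.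
  U⁴+V⁴ : (fourth U + fourth V) ≈[ everything ] (- one)
  U⁴+V⁴ = trans (dbl-fixed fixed) (trans (reflexive (cong const value)) (neg-const F₃.1#))
    where
    open Calculus everything
    value : (fourth U + fourth V) 0 ≡ F₃.- F₃.1#
    value = ≡.trans (+-at _ _ 0) (cong₂ F₃._+_ (fourth₀ U₀) (fourth₀ V₀))
      where
      fourth₀ : ∀ {f} → f 0 ≡ F₃.1# → fourth f 0 ≡ F₃.1#
      fourth₀ {f} e = ≡.trans (coef₀-* (f * f) (f * f)) (cong (λ x → x F₃.* x) (≡.trans (coef₀-* f f) (cong (λ x → x F₃.* x) e)))
    fixed : (fourth U + fourth V) ≈ dbl (fourth U + fourth V)
    fixed = begin
      fourth U + fourth V
        ≈⟨ solve 2 (λ u v → u :* u :* (u :* u) :+ v :* v :* (v :* v)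
             := (u :* u :+ v :* v) :* (u :* u :+ v :* v) :+ (v :* u) :* (v :* u)) refl U V ⟩
      (U * U + V * V) * (U * U + V * V) + (V * U) * (V * U)
        ≈⟨ +-cong (*-cong U²+V² U²+V²) (*-cong V*U V*U) ⟩
      (- (dbl U * dbl U)) * (- (dbl U * dbl U)) + fourth (dbl V)
        ≈⟨ +-congʳ (solve 1 (λ x → :- x :* :- x := x :* x) refl _) ⟩
      fourth (dbl U) + fourth (dbl V)
        ≈⟨ trans (dbl-+ _ _) (+-cong (dbl-fourth U) (dbl-fourth V)) ⟨
      dbl (fourth U + fourth V) ∎
      where
      dbl-fourth : ∀ f → dbl (fourth f) ≈ fourth (dbl f)
      dbl-fourth f = trans (dbl-* _ _) (*-cong (dbl-* _ _) (dbl-* _ _))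

  -- In (u + v)⁴ + (u - v)⁴ the mixed term 12 u² v² vanishes modulo 3 and 2 (u⁴ + v⁴) remains.
  A₀⁴+A₁⁴ : (fourth A₀ + fourth A₁) ≈[ everything ] one
  A₀⁴+A₁⁴ = begin
    fourth A₀ + fourth A₁
      ≈⟨ solve 2 (λ u v → let a = :- (v :+ u) ; b = u :+ :- v in a :* a :* (a :* a) :+ b :* b :* (b :* b)
           := :- (u :* u :* (u :* u) :+ v :* v :* (v :* v))) refl U V ⟩
    - (fourth U + fourth V)  ≈⟨ -‿cong U⁴+V⁴ ⟩
    - (- one)                ≈⟨ solve 0 (:- :- :1 := :1) refl ⟩
    one                      ∎
    where open Calculus everything

-- Reduction of pξ modulo 3

module _ where
  open PS

  red : (ℕ → ℕ) → PS
  red f m = f m mod 3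

  toℕ-mod : ∀ m → toℕ (m mod 3) ≡ m % 3
  toℕ-mod m = toℕ-fromℕ< (m%n<n m 3)

  mod-+ : ∀ m n → (m ℕ.+ n) mod 3 ≡ (m mod 3) F₃.+ (n mod 3)
  mod-+ m n = toℕ-injective (begin
    toℕ ((m ℕ.+ n) mod 3)      ≡⟨ toℕ-mod (m ℕ.+ n) ⟩
    (m ℕ.+ n) % 3              ≡⟨ %-distribˡ-+ m n 3 ⟩
    (m % 3 ℕ.+ n % 3) % 3      ≡⟨ cong₂ (λ x y → (x ℕ.+ y) % 3) (toℕ-mod m) (toℕ-mod n) ⟨
    (toℕ (m mod 3) ℕ.+ toℕ (n mod 3)) % 3      ≡⟨ toℕ-mod (toℕ (m mod 3) ℕ.+ toℕ (n mod 3)) ⟨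
    toℕ ((m mod 3) F₃.+ (n mod 3))             ∎)
    where open ≡.≡-Reasoning

  ≤ᵇ-suc : ∀ m n → (suc m ℕ.≤ᵇ suc n) ≡ (m ℕ.≤ᵇ n)
  ≤ᵇ-suc zero    n = ≡.refl
  ≤ᵇ-suc (suc m) n = ≡.refl

  ≤ᵇ-+ : ∀ k m n → (k ℕ.+ m ℕ.≤ᵇ k ℕ.+ n) ≡ (m ℕ.≤ᵇ n)
  ≤ᵇ-+ zero    m n = ≡.refl
  ≤ᵇ-+ (suc k) m n = ≡.trans (≤ᵇ-suc (k ℕ.+ m) (k ℕ.+ n)) (≤ᵇ-+ k m n)

  <⇒≤ᵇ-false : ∀ {m n} → m ℕ.< n → (n ℕ.≤ᵇ m) ≡ false
  <⇒≤ᵇ-false {zero}  {suc n} _          = ≡.refl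
  <⇒≤ᵇ-false {suc m} {suc n} (ℕ.s≤s lt) = ≡.trans (≤ᵇ-suc n m) (<⇒≤ᵇ-false lt)

  geomTerm : ℕ → (ℕ → ℕ) → ℕ → ℕ → ℕ
  geomTerm k f m t = if t ℕ.* suc k ℕ.≤ᵇ m then f (m ℕ.∸ t ℕ.* suc k) else 0

  geomTerm-0 : ∀ k f m t → m ℕ.< suc t ℕ.* suc k → geomTerm k f m (suc t) ≡ 0
  geomTerm-0 k f m t lt = cong (λ b → if b then f (m ℕ.∸ suc t ℕ.* suc k) else 0) (<⇒≤ᵇ-false lt)

  geomTerm-+ : ∀ k f m t → geomTerm k f (suc k ℕ.+ m) (suc t) ≡ geomTerm k f m t
  geomTerm-+ k f m t = cong₂ (λ b x → if b then f x else 0)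
    (≤ᵇ-+ (suc k) (t ℕ.* suc k) m) (ℕₚ.[m+n]∸[m+o]≡n∸o (suc k) m (t ℕ.* suc k))

  geomSum-small : ∀ k f m t → m ℕ.< suc k → geomSum k f m t ≡ f m
  geomSum-small k f m zero    lt = ≡.refl
  geomSum-small k f m (suc t) lt = ≡.trans
    (cong (ℕ._+ geomSum k f m t) (geomTerm-0 k f m t (ℕₚ.<-≤-trans lt (ℕₚ.m≤m+n (suc k) _))))
    (geomSum-small k f m t lt)

  geomSum-+ : ∀ k f m t →
    geomSum k f (suc k ℕ.+ m) (suc t) ≡ geomSum k f m t ℕ.+ f (suc k ℕ.+ m)
  geomSum-+ k f m zero    = cong (ℕ._+ f (suc k ℕ.+ m)) (geomTerm-+ k f m 0)
  geomSum-+ k f m (suc t) = ≡.trans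
    (cong₂ ℕ._+_ (geomTerm-+ k f m (suc t)) (geomSum-+ k f m t))
    (≡.sym (ℕₚ.+-assoc (geomTerm k f m (suc t)) _ _))

  geomSum-stable : ∀ k f m d → geomSum k f m (d ℕ.+ m) ≡ geomSum k f m m
  geomSum-stable k f m zero    = ≡.refl
  geomSum-stable k f m (suc d) = ≡.trans
    (cong (ℕ._+ geomSum k f m (d ℕ.+ m)) (geomTerm-0 k f m (d ℕ.+ m)
      (ℕₚ.<-≤-trans (ℕ.s≤s (ℕₚ.m≤n+m m d)) (ℕₚ.m≤m*n (suc (d ℕ.+ m)) (suc k)))))
    (geomSum-stable k f m d)

  divGeom-+ : ∀ k f m → divGeom k f (suc k ℕ.+ m) ≡ divGeom k f m ℕ.+ f (suc k ℕ.+ m)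
  divGeom-+ k f m = ≡.trans (geomSum-+ k f m (k ℕ.+ m))
    (cong (ℕ._+ f (suc k ℕ.+ m)) (geomSum-stable k f m k))

  mon-*-< : ∀ n f m → m ℕ.< n → (mon n * f) m ≡ F₃.0#
  mon-*-< (suc n) f zero    lt         = ≡.trans (shift-* _ _ 0) (shift-0 _)
  mon-*-< (suc n) f (suc m) (ℕ.s≤s lt) =
    ≡.trans (shift-* _ _ (suc m)) (≡.trans (shift-suc _ m) (mon-*-< n f m lt))

  mon-*-+ : ∀ n f m → (mon n * f) (n ℕ.+ m) ≡ f m
  mon-*-+ zero    f m = ≡.trans (const-* F₃.1# f m) (F₃.*-identityˡ (f m))
  mon-*-+ (suc n) f m = ≡.trans (shift-* _ _ _) (≡.trans (shift-suc _ (n ℕ.+ m)) (mon-*-+ n f m))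

  -- The quotient is recognised by its recurrence g = f + q^(k+1) g, which is checked separately
  -- below and above exponent k + 1.
  red-divGeom : ∀ {D} k f → red (divGeom k f) ≈[ D ] (w k * red f)
  red-divGeom k f = weaken (begin
    g                          ≈⟨ *-identityˡ g ⟨
    one * g                    ≈⟨ *-congʳ (trans (*-comm _ _) (w-inv k)) ⟨
    w k * (one + - q) * g      ≈⟨ solve 3 (λ w q g → w :* (:1 :+ :- q) :* g := w :* (g :+ :- (q :* g))) refl _ _ _ ⟩
    w k * (g + - (q * g))      ≈⟨ *-congˡ (trans (+-congʳ (exact recurrence))
      (solve 2 (λ f z → f :+ z :+ :- z := f) refl _ _)) ⟩
    w k * red f                ∎)
    where
    open Calculus everything
    g q : PS
    g = red (divGeom k f)
    q = mon (suc k)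
    recurrence : ∀ m → g m ≡ (red f + q * g) m
    recurrence m with ℕₚ.<-≤-connex m (suc k)
    ... | inj₁ lt = ≡.trans (cong (_mod 3) (geomSum-small k f m m lt)) (≡.sym (≡.trans (+-at _ _ m)
      (≡.trans (cong (red f m F₃.+_) (mon-*-< (suc k) g m lt)) (F₃.+-identityʳ (red f m)))))
    ... | inj₂ le = ≡.subst (λ m → g m ≡ (red f + q * g) m) (ℕₚ.m+[n∸m]≡n le) (large (m ℕ.∸ suc k))
      where
      large : ∀ m → g (suc k ℕ.+ m) ≡ (red f + q * g) (suc k ℕ.+ m)
      large m = ≡.trans (cong (_mod 3) (divGeom-+ k f m)) (≡.trans (mod-+ (divGeom k f m) (f (suc k ℕ.+ m)))
        (≡.trans (F₃.+-comm (g m) _) (≡.sym (≡.trans (+-at _ _ (suc k ℕ.+ m))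
          (cong (red f (suc k ℕ.+ m) F₃.+_) (mon-*-+ (suc k) g m))))))

  red-mono : ∀ {D} e → red (mono e) ≈[ D ] mon e
  red-mono e = exact (go e)
    where
    go : ∀ e m → red (mono e) m ≡ mon e m
    go zero    zero    = ≡.sym (const-0 _)
    go zero    (suc m) = ≡.sym (const-suc _ m)
    go (suc e) zero    = ≡.sym (shift-0 _)
    go (suc e) (suc m) = ≡.trans
      (cong₂ (λ b c → (if b then (if c then 1 else 0) else 0) mod 3) (≤ᵇ-suc e m) (≤ᵇ-suc m e))
      (≡.trans (go e m) (≡.sym (shift-suc _ m)))

  module _ (N : ℕ) where
    open Calculus (upTo N)
    open Convolution (ring (upTo N))
    open T N using (module PF₆; P₆; δ; ξ)

    red-divPoch : ∀ n f → red (divPoch (suc n) f) ≈ (PF₆.β n * red f)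
    red-divPoch zero    f = trans (red-divGeom 0 _) (trans (*-congˡ (red-divGeom 4 f)) (sym (*-assoc _ _ _)))
    red-divPoch (suc n) f = begin
      red (divGeom (6 ℕ.* i) (divGeom (6 ℕ.* i ℕ.+ 4) (divPoch i f)))
        ≈⟨ trans (red-divGeom (6 ℕ.* i) _) (*-congˡ (red-divGeom (6 ℕ.* i ℕ.+ 4) _)) ⟩
      w (6 ℕ.* i) * (w (6 ℕ.* i ℕ.+ 4) * red (divPoch i f))
        ≈⟨ *-congˡ (*-cong (reflexive (cong w (ℕₚ.+-comm (6 ℕ.* i) 4))) (red-divPoch n f)) ⟩
      w (6 ℕ.* i) * (w (4 ℕ.+ 6 ℕ.* i) * (PF₆.β n * red f))
        ≈⟨ solve 4 (λ a b c d → a :* (b :* (c :* d)) := a :* b :* c :* d) refl _ _ _ _ ⟩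
      PF₆.β i * red f ∎
      where i = suc n

    red-summand : ∀ k → red (summand k) ≈ (P₆ (k ℕ.* k ℕ.+ k) * (mon 1 * PF₆.β k))
    red-summand k = begin
      red (summand k)
        ≈⟨ trans (red-divPoch k _) (*-congˡ (red-mono (6 ℕ.* (suc k ℕ.* suc k) ℕ.∸ 6 ℕ.* suc k ℕ.+ 1))) ⟩
      PF₆.β k * mon (6 ℕ.* (suc k ℕ.* suc k) ℕ.∸ 6 ℕ.* suc k ℕ.+ 1)
        ≈⟨ *-congˡ (trans (reflexive (cong (λ e → mon (e ℕ.+ 1)) exponent)) (mon-+ (6 ℕ.* (k ℕ.* k ℕ.+ k)) 1)) ⟩
      PF₆.β k * (P₆ (k ℕ.* k ℕ.+ k) * mon 1)
        ≈⟨ solve 3 (λ b p q → b :* (p :* q) := p :* (q :* b)) refl _ _ _ ⟩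
      P₆ (k ℕ.* k ℕ.+ k) * (mon 1 * PF₆.β k) ∎
      where
      expand : ∀ k → 6 ℕ.* (suc k ℕ.* suc k) ≡ 6 ℕ.* (k ℕ.* k ℕ.+ k) ℕ.+ 6 ℕ.* suc k
      expand = solve-∀
      exponent : 6 ℕ.* (suc k ℕ.* suc k) ℕ.∸ 6 ℕ.* suc k ≡ 6 ℕ.* (k ℕ.* k ℕ.+ k)
      exponent = ≡.trans (cong (ℕ._∸ 6 ℕ.* suc k) (expand k)) (ℕₚ.m+n∸n≡m (6 ℕ.* (k ℕ.* k ℕ.+ k)) (6 ℕ.* suc k))

    summands : ℕ → ℕ → PS
    summands _ k = P₆ (k ℕ.* k ℕ.+ k) * (mon 1 * PF₆.β k)

    red-partialSum : ∀ t → red (partialSum t) ≈ conv t summands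
    red-partialSum zero    = red-summand 0
    red-partialSum (suc t) = begin
      red (partialSum (suc t))
        ≈⟨ exact (λ m → ≡.trans (mod-+ (summand (suc t) m) (partialSum t m)) (≡.sym (+-at _ _ m))) ⟩
      red (summand (suc t)) + red (partialSum t)
        ≈⟨ +-cong (red-summand (suc t)) (red-partialSum t) ⟩
      conv (suc t) summands ∎

    ξ≈ : ξ ≈ (one + - conv N summands)
    ξ≈ = begin
      ξ
        ≈⟨ conv-cong N (λ _ n _ → solve 3 (λ p d z → p :* (d :+ :- z) := p :* d :+ :- (p :* z)) refl
             (P₆ (n ℕ.* n ℕ.+ n)) (δ n) (mon 1 * PF₆.β n)) ⟩
      conv N (λ k n → P₆ (n ℕ.* n ℕ.+ n) * δ n + - summands k n)
        ≈⟨ trans (conv-+ N (λ _ n → P₆ (n ℕ.* n ℕ.+ n) * δ n) (λ k n → - summands k n))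
             (+-cong (first N) (conv-- N summands)) ⟩
      one + - conv N summands ∎
      where
      first : ∀ n → conv n (λ _ n → P₆ (n ℕ.* n ℕ.+ n) * δ n) ≈ one
      first zero    = *-identityˡ one
      first (suc n) = trans (+-cong (zeroʳ _) (first n)) (+-identityˡ one)

    -- Both sides cut the sum at index N, and the congruence modulo q^(N+1) is read off at exponent
    -- N itself. The factor 2 of `pξ` becomes the minus sign of `ξ≈`.
    pξ≡ξ : pξ N mod 3 ≡ ξ N
    pξ≡ξ = ≡.trans (mod-+ (mono 0 N) _) (≡.trans
      (cong₂ F₃._+_ (at (red-mono {upTo N} 0) N ℕₚ.≤-refl) (≡.trans (twice (partialSum N N))
        (≡.trans (cong F₃.-_ (at (red-partialSum N) N ℕₚ.≤-refl)) (≡.sym (neg-at _ N)))))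
      (≡.trans (≡.sym (+-at _ _ N)) (≡.sym (at ξ≈ N ℕₚ.≤-refl))))
      where
      twice : ∀ x → (2 ℕ.* x) mod 3 ≡ F₃.- (x mod 3)
      twice x = ≡.trans (cong (λ y → (x ℕ.+ y) mod 3) (ℕₚ.+-identityʳ x)) (≡.trans (mod-+ x x) (double (x mod 3)))
        where
        double : ∀ a → a F₃.+ a ≡ F₃.- a
        double = from-yes (all? λ a → (a F₃.+ a) ≟ (F₃.- a))

  -- Dissection of 1 / φ(-q) modulo 3.

  J : PS
  J = inv V

  V*J : ∀ {D} → (V * J) ≈[ D ] one
  V*J = weaken (*-inv V λ e → contradiction (≡.trans (≡.sym V₀) e) λ ())

  off-class : ∀ {n a f} .{{_ : ℕ.NonZero n}} → Supp n a f → ∀ {m r} → m % n ≡ r → ¬ (r ≡ a % n) → f m ≡ F₃.0#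
  off-class s {m} e ne = vanish s m λ e′ → ne (≡.trans (≡.sym e) e′)

  -- By `Θ*ξ`, ξ minus q² times a cube is inverse to φ(-q), as is `J`. A cube has only exponents
  -- divisible by 3, so the difference sits in class 2.
  pξ≡J : ∀ N {r} → N % 3 ≡ r → ¬ (r ≡ 2) → pξ N mod 3 ≡ J N
  pξ≡J N e ne = begin
    pξ N mod 3                           ≡⟨ pξ≡ξ N ⟩
    T.ξ N N                              ≡⟨ at split N ℕₚ.≤-refl ⟩
    (J + rest) N                         ≡⟨ +-at _ _ N ⟩
    J N F₃.+ rest N                      ≡⟨ cong (J N F₃.+_) (off-class Supp-rest e ne) ⟩
    J N F₃.+ F₃.0#                       ≡⟨ F₃.+-identityʳ (J N) ⟩
    J N                                  ∎
    where
    open ≡.≡-Reasoning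
    Z rest : PS
    Z = T.B₂.I N N * T.sum-L₁ N
    rest = mon 2 * cube Z
    Supp-rest : Supp 3 2 rest
    Supp-rest = Supp-* {a = 2} {b = 0} (Supp-mon 2)
      (Supp-cube {n = 1} {a = 0} Supp-all)
    split : T.ξ N ≈[ upTo N ] (J + rest)
    split = let open Calculus (upTo N) using (trans; sym; +-congʳ; *-congʳ; solve; refl; _:=_; _:+_; :-_) in
      trans (solve 2 (λ x y → x := (x :+ :- y) :+ y) refl _ rest)
        (+-congʳ (T.inverse-unique N (T.Θ*ξ N) (trans (*-congʳ (sym (V≈Θ N))) V*J)))

  B : PS
  B = cube V

  Supp-B : Supp 3 0 B
  Supp-B = Supp-cube {n = 1} {a = 0} Supp-all

  Supp-C : Supp 9 0 C
  Supp-C = Supp-cube {n = 3} {a = 0} Supp-B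

  module _ where
    open Calculus everything

    V≈C+W : V ≈ (C + W)
    V≈C+W = solve 2 (λ v c → v := c :+ (v :+ :- c)) refl V C

    B≈ : B ≈ (cube C + cube W)
    B≈ = trans (cube-cong V≈C+W) (cube-+ C W)

    -- J = J³ V², and J³ B = 1.
    J≈ : J ≈ (B * B * C + (- (B * B * W)) + cube J * W * W)
    J≈ = begin
      J
        ≈⟨ trans (sym (*-identityʳ J)) (*-congˡ (trans (sym (*-identityˡ one)) (sym (*-cong V*J V*J)))) ⟩
      J * ((V * J) * (V * J))
        ≈⟨ solve 2 (λ v j → j :* ((v :* j) :* (v :* j)) := j :* (j :* j) :* (v :* v)) refl V J ⟩
      cube J * (V * V)
        ≈⟨ *-congˡ (*-cong V≈C+W V≈C+W) ⟩
      cube J * ((C + W) * (C + W))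
        ≈⟨ solve 3 (λ k c w → k :* ((c :+ w) :* (c :+ w)) := k :* c :* c :+ :- (k :* c :* w) :+ k :* w :* w) refl (cube J) C W ⟩
      cube J * C * C + (- (cube J * C * W)) + cube J * W * W
        ≈⟨ +-congʳ (+-cong (*-congʳ JC) (-‿cong (*-congʳ JC))) ⟩
      B * B * C + (- (B * B * W)) + cube J * W * W ∎
      where
      JC : (cube J * C) ≈ (B * B)
      JC = begin
        cube J * cube B
          ≈⟨ solve 2 (λ v j → let b = v :* (v :* v) in j :* (j :* j) :* (b :* (b :* b))
               := (v :* j) :* ((v :* j) :* (v :* j)) :* (b :* b)) refl V J ⟩
        cube (V * J) * (B * B)
          ≈⟨ *-congʳ (trans (cube-cong V*J) (solve 0 (:1 :* (:1 :* :1) := :1) refl)) ⟩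
        one * (B * B)  ≈⟨ *-identityˡ _ ⟩
        B * B          ∎

    Supp-BBC : Supp 3 0 (B * B * C)
    Supp-BBC = Supp-* {a = 0} {b = 0} (Supp-* {a = 0} {b = 0} Supp-B Supp-B) (Supp-coarsen 3 3 Supp-C)

    Supp-BBW : Supp 3 1 (B * B * W)
    Supp-BBW = Supp-* {a = 0} {b = 1} (Supp-* {a = 0} {b = 0} Supp-B Supp-B) Supp-W

    Supp-JWW : Supp 3 2 (cube J * W * W)
    Supp-JWW = Supp-* {a = 1} {b = 1} (Supp-* {a = 0} {b = 1} (Supp-cube {n = 1} {a = 0} Supp-all) Supp-W) Supp-W

    -- B² Y in terms of the even and odd parts of B and Y, arranged so that modulo 8 only
    -- the term B₁ τ can reach the class 3.
    module Dissection (Y Y₀ Y₁ τ : PS) (Y≈ : Y ≈ (Y₀ + Y₁)) (τ≈ : (cube A₀ * Y₀ + cube A₁ * Y₁) ≈ τ)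
      (s₀ : Supp 4 0 Y₀) (s₁ : Supp 8 1 Y₁) where

      B₀ B₁ : PS
      B₀ = cube A₀
      B₁ = cube A₁

      B≈B₀+B₁ : B ≈ (B₀ + B₁)
      B≈B₀+B₁ = trans (cube-cong (solve 2 (λ v u → v := (:- (v :+ u)) :+ (u :+ :- v)) refl V U)) (cube-+ A₀ A₁)

      Supp-B₀ : Supp 4 0 B₀
      Supp-B₀ = Supp-coarsen 4 3 (Supp-cube Supp-A₀)

      Supp-B₁ : Supp 8 3 B₁
      Supp-B₁ = Supp-coarsen 8 3 (Supp-cube Supp-A₁)

      BBY≈ : (B * B * Y) ≈ (B₀ * B₀ * Y₀ + (- (B₀ * B₁ * Y₁)) + B₁ * B₁ * Y₀ + B₀ * B₀ * Y₁ + (- (B₁ * B₁ * Y₁)) + (- (B₁ * τ)))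
      BBY≈ = begin
        B * B * Y
          ≈⟨ *-cong (*-cong B≈B₀+B₁ B≈B₀+B₁) Y≈ ⟩
        (B₀ + B₁) * (B₀ + B₁) * (Y₀ + Y₁)
          ≈⟨ solve 4 (λ b c y z → (b :+ c) :* (b :+ c) :* (y :+ z)
               := b :* b :* y :+ :- (b :* c :* z) :+ c :* c :* y :+ b :* b :* z :+ :- (c :* c :* z)
                  :+ :- (c :* (b :* y :+ c :* z))) refl B₀ B₁ Y₀ Y₁ ⟩
        B₀ * B₀ * Y₀ + (- (B₀ * B₁ * Y₁)) + B₁ * B₁ * Y₀ + B₀ * B₀ * Y₁ + (- (B₁ * B₁ * Y₁))
          + (- (B₁ * (B₀ * Y₀ + B₁ * Y₁)))
          ≈⟨ +-congˡ (-‿cong (*-congˡ τ≈)) ⟩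
        B₀ * B₀ * Y₀ + (- (B₀ * B₁ * Y₁)) + B₁ * B₁ * Y₀ + B₀ * B₀ * Y₁ + (- (B₁ * B₁ * Y₁)) + (- (B₁ * τ)) ∎

      -- Modulo 4 the classes of `B₀`, `B₁`, `Y₀`, `Y₁` are 0, 3, 0, 1, so among the first five
      -- terms of `BBY≈` only `B₁ * B₁ * Y₁` reaches 3 mod 4, and modulo 8 it lies in 3 + 3 + 1 = 7.
      -- The troublesome term 2 B₀ B₁ Y₀ has gone into `B₁ * τ`.
      at-3-mod-8 : ∀ {m} → m % 8 ≡ 3 → (B * B * Y) m ≡ F₃.- (B₁ * τ) m
      at-3-mod-8 {m} e = ≡.trans (at BBY≈ m tt) (≡.trans (+-at _ _ m)
        (≡.trans (cong₂ F₃._+_ zeros (neg-at _ m)) (F₃.+-identityˡ _)))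
        where
        e₄ : m % 4 ≡ 3
        e₄ = ≡.trans (≡.sym (m∣n⇒o%n%m≡o%m 4 8 m (divides 2 ≡.refl))) (cong (_% 4) e)
        1₄ : Supp 4 1 Y₁
        1₄ = Supp-coarsen 4 2 s₁
        3₄ : Supp 4 3 B₁
        3₄ = Supp-coarsen 4 2 Supp-B₁
        infixl 6 _⊕_
        _⊕_ : ∀ {f g} → f m ≡ F₃.0# → g m ≡ F₃.0# → (f + g) m ≡ F₃.0#
        _⊕_ {f} {g} x y = ≡.trans (+-at f g m) (cong₂ F₃._+_ x y)
        ⊖_ : ∀ {f} → f m ≡ F₃.0# → (- f) m ≡ F₃.0#
        ⊖_ {f} x = ≡.trans (neg-at f m) (cong F₃.-_ x)
        zeros : (B₀ * B₀ * Y₀ + (- (B₀ * B₁ * Y₁)) + B₁ * B₁ * Y₀ + B₀ * B₀ * Y₁ + (- (B₁ * B₁ * Y₁))) m ≡ F₃.0#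
        zeros = off-class (Supp-* (Supp-* Supp-B₀ Supp-B₀) s₀) e₄ (λ ())
          ⊕ ⊖ off-class (Supp-* (Supp-* Supp-B₀ 3₄) 1₄) e₄ (λ ())
          ⊕ off-class (Supp-* (Supp-* 3₄ 3₄) s₀) e₄ (λ ())
          ⊕ off-class (Supp-* (Supp-* Supp-B₀ Supp-B₀) 1₄) e₄ (λ ())
          ⊕ ⊖ off-class (Supp-* (Supp-* Supp-B₁ Supp-B₁) s₁) e (λ ())

    ninth : PS → PS
    ninth f = cube (cube f)

    C≈ : C ≈ (ninth A₀ + ninth A₁)
    C≈ = trans (cube-cong (trans (cube-cong (solve 2 (λ v u → v := (:- (v :+ u)) :+ (u :+ :- v)) refl V U)) (cube-+ A₀ A₁)))
      (cube-+ _ _)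

    -- In characteristic 3 the sum of twelfth powers is the cube of A₀⁴ + A₁⁴.
    τC : (cube A₀ * ninth A₀ + cube A₁ * ninth A₁) ≈ one
    τC = begin
      cube A₀ * ninth A₀ + cube A₁ * ninth A₁
        ≈⟨ solve 2 (λ a b →
             let c = a :* (a :* a)
                 d = b :* (b :* b)
                 s = a :* a :* (a :* a) :+ b :* b :* (b :* b)
             in
             c :* (c :* (c :* c)) :+ d :* (d :* (d :* d)) := s :* (s :* s)) refl A₀ A₁ ⟩
      cube (fourth A₀ + fourth A₁)
        ≈⟨ trans (cube-cong A₀⁴+A₁⁴) (solve 0 (:1 :* (:1 :* :1) := :1) refl) ⟩
      one ∎

    -- The fourth powers contribute 1, and the twelfth powers take it away by `τC`.
    τW : (cube A₀ * (A₀ + - ninth A₀) + cube A₁ * (A₁ + - ninth A₁)) ≈ const F₃.0#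
    τW = begin
      cube A₀ * (A₀ + - ninth A₀) + cube A₁ * (A₁ + - ninth A₁)
        ≈⟨ solve 4 (λ a b x y → let c = a :* (a :* a) ; d = b :* (b :* b) in
             c :* (a :+ :- x) :+ d :* (b :+ :- y)
             := (a :* a :* (a :* a) :+ b :* b :* (b :* b)) :+ :- (c :* x :+ d :* y)) refl A₀ A₁ (ninth A₀) (ninth A₁) ⟩
      fourth A₀ + fourth A₁ + - (cube A₀ * ninth A₀ + cube A₁ * ninth A₁)
        ≈⟨ +-cong A₀⁴+A₁⁴ (-‿cong τC) ⟩
      one + - one  ≈⟨ -‿inverseʳ one ⟩
      const F₃.0#  ∎

    W≈ : W ≈ ((A₀ + - ninth A₀) + (A₁ + - ninth A₁))
    W≈ = trans (+-congˡ (-‿cong C≈)) (solve 4 (λ v u x y → v :+ :- (x :+ y)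
      := ((:- (v :+ u)) :+ :- x) :+ ((u :+ :- v) :+ :- y)) refl V U _ _)

    s₀ : Supp 4 0 (ninth A₀)
    s₀ = Supp-coarsen 4 9 (Supp-cube {n = 12} {a = 0} (Supp-cube {n = 4} {a = 0} Supp-A₀))

    s₁ : Supp 8 1 (ninth A₁)
    s₁ = Supp-class {a = 9} ≡.refl (Supp-coarsen 8 9 (Supp-cube {n = 24} {a = 3} (Supp-cube {n = 8} {a = 1} Supp-A₁)))

    module DC = Dissection C (ninth A₀) (ninth A₁) one C≈ τC s₀ s₁
    module DW = Dissection W (A₀ + - ninth A₀) (A₁ + - ninth A₁) (const F₃.0#) W≈ τW
      (Supp-+ Supp-A₀ (Supp-neg s₀)) (Supp-+ Supp-A₁ (Supp-neg s₁))

  J-split : ∀ m → J m ≡ ((B * B * C) m F₃.+ (F₃.- (B * B * W) m)) F₃.+ (cube J * W * W) m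
  J-split m = ≡.trans (at J≈ m tt) (≡.trans (+-at _ _ m) (cong (F₃._+ (cube J * W * W) m)
    (≡.trans (+-at _ _ m) (cong ((B * B * C) m F₃.+_) (neg-at _ m)))))

  J-0-mod-3 : ∀ {m} → m % 3 ≡ 0 → J m ≡ (B * B * C) m
  J-0-mod-3 {m} e = ≡.trans (J-split m) (≡.trans
    (cong₂ (λ x y → ((B * B * C) m F₃.+ (F₃.- x)) F₃.+ y) (off-class Supp-BBW e λ ()) (off-class Supp-JWW e λ ()))
    (≡.trans (F₃.+-identityʳ _) (F₃.+-identityʳ _)))

  J-1-mod-3 : ∀ {m} → m % 3 ≡ 1 → J m ≡ F₃.- (B * B * W) m
  J-1-mod-3 {m} e = ≡.trans (J-split m) (≡.trans
    (cong₂ (λ x y → (x F₃.+ (F₃.- (B * B * W) m)) F₃.+ y) (off-class Supp-BBC e λ ()) (off-class Supp-JWW e λ ()))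
    (≡.trans (F₃.+-identityʳ _) (F₃.+-identityˡ _)))

  -- In class 1 mod 3 only -B² W contributes, and its part in 3 mod 8 is `B₁ * τ` with τ = 0.
  J-19-mod-24 : ∀ m → m % 3 ≡ 1 → m % 8 ≡ 3 → J m ≡ F₃.0#
  J-19-mod-24 m e₃ e₈ = ≡.trans (J-1-mod-3 e₃) (cong F₃.-_ (≡.trans (DW.at-3-mod-8 e₈)
    (cong F₃.-_ (≡.trans (at (zeroʳ _) m tt) (zero-at m)))))
    where
    open Calculus everything
    zero-at : ∀ m → const F₃.0# m ≡ F₃.0#
    zero-at zero    = const-0 _
    zero-at (suc m) = const-suc _ m

  Supp-cube-C : Supp 27 0 (cube C)
  Supp-cube-C = Supp-cube {n = 9} {a = 0} Supp-C

  Supp-cube-W : Supp 9 3 (cube W)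
  Supp-cube-W = Supp-cube {n = 3} {a = 1} Supp-W

  -- Here τ = 1, so the coefficient of B² C is that of -B₁. At 3 mod 4 the part B₀ is silent and B₁
  -- agrees with B = C³ + W³, whose exponents are 0 or 3 mod 9.
  J-51-mod-72 : ∀ m → m % 3 ≡ 0 → m % 8 ≡ 3 → m % 9 ≡ 6 → J m ≡ F₃.0#
  J-51-mod-72 m e₃ e₈ e₉ = ≡.trans (J-0-mod-3 e₃) (≡.trans (DC.at-3-mod-8 e₈)
    (cong F₃.-_ (≡.trans (at (*-identityʳ _) m tt) B₁≡0)))
    where
    open Calculus everything
    B≡0 : B m ≡ F₃.0#
    B≡0 = ≡.trans (at B≈ m tt) (≡.trans (+-at _ _ m) (cong₂ F₃._+_
      (off-class (Supp-coarsen 9 3 Supp-cube-C) e₉ λ ()) (off-class Supp-cube-W e₉ λ ())))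
    B₀≡0 : DC.B₀ m ≡ F₃.0#
    B₀≡0 = off-class DC.Supp-B₀ (≡.trans (≡.sym (m∣n⇒o%n%m≡o%m 4 8 m (divides 2 ≡.refl))) (cong (_% 4) e₈)) λ ()
    B₁≡0 : DC.B₁ m ≡ F₃.0#
    B₁≡0 = ≡.trans (≡.sym (F₃.+-identityˡ _)) (≡.trans (cong (F₃._+ DC.B₁ m) (≡.sym B₀≡0))
      (≡.trans (≡.sym (+-at _ _ m)) (≡.trans (≡.sym (at DC.B≈B₀+B₁ m tt)) B≡0)))

  -- In (C³ + W³)² C the terms containing W³ lie in 3 or 6 mod 9. In the remaining C⁶ C the last
  -- factor is known only modulo 9, so it is expanded once more as C = B³ = C⁹ + W⁹, which gives the
  -- classes 0 and 9 mod 27.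
  J-18-mod-27 : ∀ m → m % 3 ≡ 0 → m % 9 ≡ 0 → m % 27 ≡ 18 → J m ≡ F₃.0#
  J-18-mod-27 m e₃ e₉ e₂₇ = ≡.trans (J-0-mod-3 e₃) (≡.trans (at expand m tt)
    (≡.trans (+-at _ _ m) (cong₂ F₃._+_
      (≡.trans (+-at _ _ m) (cong₂ F₃._+_
        (≡.trans (+-at _ _ m) (cong₂ F₃._+_
          (off-class (Supp-* (Supp-* Supp-cube-C Supp-cube-C) (Supp-coarsen 27 3 (Supp-cube {n = 27} {a = 0} Supp-cube-C))) e₂₇ λ ())
          (off-class (Supp-* (Supp-* Supp-cube-C Supp-cube-C) (Supp-cube {n = 9} {a = 3} Supp-cube-W)) e₂₇ λ ())))
        (≡.trans (neg-at _ m) (cong F₃.-_ (off-class (Supp-* (Supp-* c₉ Supp-cube-W) Supp-C) e₉ λ ())))))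
      (off-class (Supp-* (Supp-* Supp-cube-W Supp-cube-W) Supp-C) e₉ λ ()))))
    where
    open Calculus everything
    c w₃ : PS
    c = cube C
    w₃ = cube W
    c₉ : Supp 9 0 c
    c₉ = Supp-coarsen 9 3 Supp-cube-C
    expand : (B * B * C) ≈ (c * c * cube c + c * c * cube w₃ + (- (c * w₃ * C)) + w₃ * w₃ * C)
    expand = begin
      B * B * C
        ≈⟨ *-congʳ (*-cong B≈ B≈) ⟩
      (c + w₃) * (c + w₃) * C
        ≈⟨ solve 3 (λ c w z → (c :+ w) :* (c :+ w) :* z := c :* c :* z :+ :- (c :* w :* z) :+ w :* w :* z) refl c w₃ C ⟩
      c * c * C + (- (c * w₃ * C)) + w₃ * w₃ * C
        ≈⟨ +-congʳ (+-congʳ (trans (*-congˡ (trans (cube-cong B≈) (cube-+ c w₃))) (distribˡ _ _ _))) ⟩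
      c * c * cube c + c * c * cube w₃ + (- (c * w₃ * C)) + w₃ * w₃ * C ∎

  conclude : ∀ m {r} → m % 3 ≡ r → ¬ (r ≡ 2) → J m ≡ F₃.0# → 3 ∣ pξ m
  conclude m e ne J≡0 = m%n≡0⇒n∣m (pξ m) 3
    (≡.trans (≡.sym (toℕ-mod (pξ m))) (cong toℕ (≡.trans (pξ≡J m e ne) J≡0)))

-- The three progressions.

open import Data.Nat using (_+_; _*_)

%-progression : ∀ {m} r k d .{{_ : ℕ.NonZero d}} → m ≡ r + k * d → m % d ≡ r % d
%-progression r k d e = ≡.trans (cong (_% d) e) ([m+kn]%n≡m%n r k d)

theorem5p1 : (n : ℕ) →
    (3 ∣ pξ (24 * n + 19)) × (3 ∣ pξ (27 * n + 18)) × (3 ∣ pξ (72 * n + 51))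
theorem5p1 n =
  conclude (24 * n + 19) a₃ (λ ()) (J-19-mod-24 (24 * n + 19) a₃ (%-progression 19 (3 * n) 8 (a₈ n))) ,
  conclude (27 * n + 18) b₃ (λ ()) (J-18-mod-27 (27 * n + 18) b₃ (%-progression 18 (3 * n) 9 (b₉ n)) (%-progression 18 n 27 (b₂₇ n))) ,
  conclude (72 * n + 51) c₃ (λ ()) (J-51-mod-72 (72 * n + 51) c₃ (%-progression 51 (9 * n) 8 (c₈ n)) (%-progression 51 (8 * n) 9 (c₉ n)))
  where
  a₃′ : ∀ n → 24 * n + 19 ≡ 19 + 8 * n * 3
  a₃′ = solve-∀
  a₃ : (24 * n + 19) % 3 ≡ 1
  a₃ = %-progression 19 (8 * n) 3 (a₃′ n)
  a₈ : ∀ n → 24 * n + 19 ≡ 19 + 3 * n * 8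
  a₈ = solve-∀
  b₃′ : ∀ n → 27 * n + 18 ≡ 18 + 9 * n * 3
  b₃′ = solve-∀
  b₃ : (27 * n + 18) % 3 ≡ 0
  b₃ = %-progression 18 (9 * n) 3 (b₃′ n)
  b₉ : ∀ n → 27 * n + 18 ≡ 18 + 3 * n * 9
  b₉ = solve-∀
  b₂₇ : ∀ n → 27 * n + 18 ≡ 18 + n * 27
  b₂₇ = solve-∀
  c₃′ : ∀ n → 72 * n + 51 ≡ 51 + 24 * n * 3
  c₃′ = solve-∀
  c₃ : (72 * n + 51) % 3 ≡ 0
  c₃ = %-progression 51 (24 * n) 3 (c₃′ n)
  c₈ : ∀ n → 72 * n + 51 ≡ 51 + 9 * n * 8
  c₈ = solve-∀
  c₉ : ∀ n → 72 * n + 51 ≡ 51 + 8 * n * 9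
  c₉ = solve-∀
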